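{- Let $d\ge1$ be an integer. Suppose that every cosimple zonotope with generators in $\mathbb{Z}^{d-1}$ has covering radius at most $\frac{d-1}{d+1}$. Then: (a) every Strong Lonely Runner Zonotope $Z\subseteq\mathbb{R}^d$ with $\mu(Z)>\frac{d}{d+2}$ contains at most $\binom{d+2}{2}^d$ points of $\mathbb{Z}^d$; and (b) every Lonely Runner Zonotope $Z\subseteq\mathbb{R}^d$ with center $\mathbf x$ such that $\frac{d}{d+2}(Z-\mathbf x)\cap(\mathbf x+\mathbb{Z}^d)=\varnothing$ contains at most $\binom{d+2}{2}^d$ points of $\mathbb{Z}^d$.
   Context: A finite collection of vectors $\mathbf u_1,\dots,\mathbf u_n\in\mathbb{Z}^d$ that linearly spans $\mathbb{R}^d$ is cosimple if there is a linear dependence $\sum_i\lambda_i\mathbf u_i=\mathbf 0$ whose coefficients are all non-zero and have pairwise different absolute values; a cosimple zonotope is a zonotope $\sum_i[\mathbf 0,\mathbf u_i]$ generated by a cosimple collection. The covering radius of a convex body $M\subseteq\mathbb{R}^d$ is $\mu(M)=\min\{\rho>0:\rho M+\mathbb{Z}^d=\mathbb{R}^d\}$. A Lonely Runner Zonotope in $\mathbb{R}^d$ is a zonotope $Z=\sum_{i=1}^{d+1}[\mathbf 0,\mathbf u_i]$ with $d+1$ generators $\mathbf u_i\in\mathbb{Z}^d$, every $d$ of which are linearly independent; its center is $\mathbf x=\frac12\sum_i\mathbf u_i$. For $\mathbf v=(v_1,\dots,v_{d+1})\in\mathbb{Z}_{>0}^{d+1}$ with $\gcd(v_1,\dots,v_{d+1})=1$,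 let $Z_{\mathbf v}=\sum_{i=1}^{d+1}[\mathbf 0,\mathbf u_i]$, where $\mathbf u_1,\dots,\mathbf u_{d+1}$ generate $\mathbb{Z}^d$ as a lattice and $\sum_iv_i\mathbf u_i=\mathbf 0$ (unique up to unimodular equivalence). A Strong Lonely Runner Zonotope is a $Z_{\mathbf v}$ for which the entries of $\mathbf v$ are pairwise distinct. -}

module Defs where

open import Data.Fin.Base using (Fin)
import Data.Integer.Base as ℤ
open ℤ using (ℤ; +_)
import Data.Nat.Base as ℕ
open ℕ using (ℕ; suc)
open import Data.Nat.GCD using (gcd)
import Data.Nat.Properties as ℕ
open import Data.Product.Base using (∃-syntax; Σ-syntax; _×_; _,_)
open import Data.Rational.Base
open import Data.Rational.Properties
open import Data.Rational.Solver using (module +-*-Solver)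
open import Data.Sum.Base using (inj₁; inj₂)
open import Data.Vec.Functional using (Vector; foldr)
open import Function.Base using (_∘_)
open import Function.Definitions using (Injective)
open import Level using (0ℓ)
open import Relation.Binary.PropositionalEquality
  using (_≡_; _≢_; _≗_; refl; sym; trans; cong; subst)
open import Relation.Nullary.Negation.Core using (¬_)
open import Relation.Unary using (Pred; _∈_)

------------------------------------------------------------------------
-- Real numbers: Cauchy sequences of rationals, identified up to _≈ᵣ_.
-- There is no modulus of convergence in the data; the definitions are
-- meant to be read classically.

Cauchy : (ℕ → ℚ) → Set
Cauchy x = ∀ ε → 0ℚ < ε →
  ∃[ N ] (∀ m n → N ℕ.≤ m → N ℕ.≤ n → ∣ x m - x n ∣ < ε)

record ℝ : Set where
  constructor mkℝ
  field
    seq    : ℕ → ℚ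
    cauchy : Cauchy seq

open ℝ public

infix 4 _≈ᵣ_ _≤ᵣ_ _<ᵣ_

_≈ᵣ_ : ℝ → ℝ → Set
x ≈ᵣ y = ∀ ε → 0ℚ < ε → ∃[ N ] (∀ n → N ℕ.≤ n → ∣ seq x n - seq y n ∣ < ε)

_≤ᵣ_ : ℝ → ℝ → Set
x ≤ᵣ y = ∀ ε → 0ℚ < ε → ∃[ N ] (∀ n → N ℕ.≤ n → seq x n < seq y n + ε)

_<ᵣ_ : ℝ → ℝ → Set
x <ᵣ y = ∃[ ε ] (0ℚ < ε × ∃[ N ] (∀ n → N ℕ.≤ n → seq x n + ε < seq y n))

open +-*-Solver using (solve; _:+_; _:*_; _:-_; :-_; _:=_)

-- Abstract so that comparing reals never unfolds these proofs.
private abstract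
  p-p≡0 : ∀ p → p - p ≡ 0ℚ
  p-p≡0 = +-inverseʳ

  split-+ : ∀ a b c d → (a + b) - (c + d) ≡ (a - c) + (b - d)
  split-+ = solve 4 (λ a b c d → (a :+ b) :- (c :+ d) := (a :- c) :+ (b :- d)) refl

  split-* : ∀ a b c d → a * b - c * d ≡ a * (b - d) + d * (a - c)
  split-* = solve 4 (λ a b c d → a :* b :- c :* d := a :* (b :- d) :+ d :* (a :- c)) refl

  swap-neg : ∀ a c → (- a) - (- c) ≡ - (a - c)
  swap-neg = solve 2 (λ a c → (:- a) :- (:- c) := :- (a :- c)) refl

  p≡[p-q]+q : ∀ p q → p ≡ (p - q) + q
  p≡[p-q]+q = solve 2 (λ p q → p := (p :- q) :+ q) refl

  p+q-q≡p : ∀ p q → (p + q) - q ≡ p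
  p+q-q≡p = solve 2 (λ p q → (p :+ q) :- q := p) refl

  -[p-q]≡q-p : ∀ p q → - (p - q) ≡ q - p
  -[p-q]≡q-p = solve 2 (λ p q → :- (p :- q) := q :- p) refl

  ∣p-q∣≡∣q-p∣ : ∀ p q → ∣ p - q ∣ ≡ ∣ q - p ∣
  ∣p-q∣≡∣q-p∣ p q = trans (sym (∣-p∣≡∣p∣ (p - q))) (cong ∣_∣ (-[p-q]≡q-p p q))

  ∣p∣≤∣p-q∣+∣q∣ : ∀ p q → ∣ p ∣ ≤ ∣ p - q ∣ + ∣ q ∣
  ∣p∣≤∣p-q∣+∣q∣ p q = subst (λ r → ∣ r ∣ ≤ ∣ p - q ∣ + ∣ q ∣) (sym (p≡[p-q]+q p q))
    (∣p+q∣≤∣p∣+∣q∣ (p - q) q)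

  ∣p∣-∣q∣≤∣p-q∣ : ∀ p q → ∣ p ∣ - ∣ q ∣ ≤ ∣ p - q ∣
  ∣p∣-∣q∣≤∣p-q∣ p q = subst (∣ p ∣ - ∣ q ∣ ≤_) (p+q-q≡p ∣ p - q ∣ ∣ q ∣)
    (+-monoˡ-≤ (- ∣ q ∣) (∣p∣≤∣p-q∣+∣q∣ p q))

  ∣∣p∣-∣q∣∣≤∣p-q∣ : ∀ p q → ∣ ∣ p ∣ - ∣ q ∣ ∣ ≤ ∣ p - q ∣
  ∣∣p∣-∣q∣∣≤∣p-q∣ p q with ∣p∣≡p∨∣p∣≡-p (∣ p ∣ - ∣ q ∣)
  ... | inj₁ eq = subst (_≤ ∣ p - q ∣) (sym eq) (∣p∣-∣q∣≤∣p-q∣ p q)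
  ... | inj₂ eq = begin
    ∣ ∣ p ∣ - ∣ q ∣ ∣  ≡⟨ eq ⟩
    - (∣ p ∣ - ∣ q ∣)  ≡⟨ -[p-q]≡q-p ∣ p ∣ ∣ q ∣ ⟩
    ∣ q ∣ - ∣ p ∣      ≤⟨ ∣p∣-∣q∣≤∣p-q∣ q p ⟩
    ∣ q - p ∣          ≡⟨ ∣p-q∣≡∣q-p∣ q p ⟩
    ∣ p - q ∣          ∎
    where open ≤-Reasoning

  half-pos : ∀ ε → 0ℚ < ε → 0ℚ < ½ * ε
  half-pos ε 0<ε = subst (_< ½ * ε) (*-zeroʳ ½) (*-monoʳ-<-pos ½ 0<ε)

  halves : ∀ ε → ½ * ε + ½ * ε ≡ ε
  halves ε = trans (sym (*-distribʳ-+ ε ½ ½)) (*-identityˡ ε)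

  bounded : ∀ {x} → Cauchy x →
            ∃[ B ] (0ℚ < B × ∃[ N ] (∀ n → N ℕ.≤ n → ∣ x n ∣ ≤ B))
  bounded {x} cx with cx 1ℚ (positive⁻¹ 1ℚ)
  ... | N , h = 1ℚ + ∣ x N ∣ , 0<B , N , λ n N≤n → begin
    ∣ x n ∣                  ≤⟨ ∣p∣≤∣p-q∣+∣q∣ (x n) (x N) ⟩
    ∣ x n - x N ∣ + ∣ x N ∣  ≤⟨ +-monoˡ-≤ ∣ x N ∣ (<⇒≤ (h n N N≤n ℕ.≤-refl)) ⟩
    1ℚ + ∣ x N ∣             ∎
    where
    open ≤-Reasoning
    0<B : 0ℚ < 1ℚ + ∣ x N ∣
    0<B = subst (_< 1ℚ + ∣ x N ∣) (+-identityˡ 0ℚ)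
      (+-mono-<-≤ (positive⁻¹ 1ℚ) (0≤∣p∣ (x N)))

  cauchy-const : ∀ q → Cauchy (λ _ → q)
  cauchy-const q ε 0<ε = 0 , λ _ _ _ _ → subst (λ r → ∣ r ∣ < ε) (sym (p-p≡0 q)) 0<ε

  cauchy-neg : ∀ {x} → Cauchy x → Cauchy (λ n → - x n)
  cauchy-neg {x} cx ε 0<ε with cx ε 0<ε
  ... | N , h = N , λ m n N≤m N≤n → subst (_< ε)
    (sym (trans (cong ∣_∣ (swap-neg (x m) (x n))) (∣-p∣≡∣p∣ (x m - x n))))
    (h m n N≤m N≤n)

  cauchy-abs : ∀ {x} → Cauchy x → Cauchy (λ n → ∣ x n ∣)
  cauchy-abs {x} cx ε 0<ε with cx ε 0<ε
  ... | N , h = N , λ m n N≤m N≤n →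
    ≤-<-trans (∣∣p∣-∣q∣∣≤∣p-q∣ (x m) (x n)) (h m n N≤m N≤n)

  cauchy-+ : ∀ {x y} → Cauchy x → Cauchy y → Cauchy (λ n → x n + y n)
  cauchy-+ {x} {y} cx cy ε 0<ε with cx (½ * ε) (half-pos ε 0<ε) | cy (½ * ε) (half-pos ε 0<ε)
  ... | N₁ , h₁ | N₂ , h₂ = N₁ ℕ.⊔ N₂ , λ m n N≤m N≤n → begin-strict
    ∣ (x m + y m) - (x n + y n) ∣      ≡⟨ cong ∣_∣ (split-+ (x m) (y m) (x n) (y n)) ⟩
    ∣ (x m - x n) + (y m - y n) ∣      ≤⟨ ∣p+q∣≤∣p∣+∣q∣ (x m - x n) (y m - y n) ⟩
    ∣ x m - x n ∣ + ∣ y m - y n ∣      <⟨ +-mono-<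
      (h₁ m n (ℕ.m⊔n≤o⇒m≤o N₁ N₂ N≤m) (ℕ.m⊔n≤o⇒m≤o N₁ N₂ N≤n))
      (h₂ m n (ℕ.m⊔n≤o⇒n≤o N₁ N₂ N≤m) (ℕ.m⊔n≤o⇒n≤o N₁ N₂ N≤n)) ⟩
    ½ * ε + ½ * ε                      ≡⟨ halves ε ⟩
    ε                                  ∎
    where open ≤-Reasoning

  ∣p*q∣≤ : ∀ p q {B δ} → 0ℚ < B → ∣ p ∣ ≤ B → ∣ q ∣ ≤ δ → ∣ p * q ∣ ≤ B * δ
  ∣p*q∣≤ p q {B} {δ} 0<B p≤ q≤ = begin
    ∣ p * q ∣      ≡⟨ ∣p*q∣≡∣p∣*∣q∣ p q ⟩
    ∣ p ∣ * ∣ q ∣  ≤⟨ *-monoʳ-≤-nonNeg ∣ q ∣ {{∣-∣-nonNeg q}} p≤ ⟩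
    B * ∣ q ∣      ≤⟨ *-monoˡ-≤-nonNeg B {{nonNegative (<⇒≤ 0<B)}} q≤ ⟩
    B * δ          ∎
    where open ≤-Reasoning

  scale-down : ∀ C → 0ℚ < C → ∀ ε → 0ℚ < ε → ∃[ δ ] (0ℚ < δ × C * δ ≡ ε)
  scale-down C 0<C ε 0<ε = 1/C * ε , 0<δ , eq
    where
    instance
      C>0 : Positive C
      C>0 = positive 0<C
      C≢0 : NonZero C
      C≢0 = pos⇒nonZero C
    1/C : ℚ
    1/C = 1/ C
    0<δ : 0ℚ < 1/C * ε
    0<δ = subst (_< 1/C * ε) (*-zeroʳ 1/C) (*-monoʳ-<-pos 1/C {{1/pos⇒pos C}} 0<ε)
    eq : C * (1/C * ε) ≡ ε
    eq = trans (sym (*-assoc C 1/C ε))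
      (trans (cong (_* ε) (*-inverseʳ C)) (*-identityˡ ε))

  ∣pq-rs∣≤ : ∀ p q r s {A B δ} → 0ℚ < A → 0ℚ < B → ∣ p ∣ ≤ A → ∣ s ∣ ≤ B →
             ∣ p - r ∣ ≤ δ → ∣ q - s ∣ ≤ δ → ∣ p * q - r * s ∣ ≤ (A + B) * δ
  ∣pq-rs∣≤ p q r s {A} {B} {δ} 0<A 0<B p≤ s≤ pr qs = begin
    ∣ p * q - r * s ∣                  ≡⟨ cong ∣_∣ (split-* p q r s) ⟩
    ∣ p * (q - s) + s * (p - r) ∣      ≤⟨ ∣p+q∣≤∣p∣+∣q∣ (p * (q - s)) (s * (p - r)) ⟩
    ∣ p * (q - s) ∣ + ∣ s * (p - r) ∣  ≤⟨ +-mono-≤ (∣p*q∣≤ p (q - s) 0<A p≤ qs)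
                                                  (∣p*q∣≤ s (p - r) 0<B s≤ pr) ⟩
    A * δ + B * δ                      ≡⟨ sym (*-distribʳ-+ δ A B) ⟩
    (A + B) * δ                        ∎
    where open ≤-Reasoning

  half< : ∀ ε → 0ℚ < ε → ½ * ε < ε
  half< ε 0<ε = subst (½ * ε <_) (halves ε)
    (subst (_< ½ * ε + ½ * ε) (+-identityʳ (½ * ε)) (+-monoʳ-< (½ * ε) (half-pos ε 0<ε)))

  cauchy-* : ∀ {x y} → Cauchy x → Cauchy y → Cauchy (λ n → x n * y n)
  cauchy-* {x} {y} cx cy ε 0<ε =
    let A , 0<A , M₁ , a = bounded {x} cx
        B , 0<B , M₂ , b = bounded {y} cy
        δ , 0<δ , eq = scale-down (A + B)
          (subst (_< A + B) (+-identityˡ 0ℚ) (+-mono-< 0<A 0<B)) (½ * ε) (half-pos ε 0<ε)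
        N₁ , h₁ = cx δ 0<δ
        N₂ , h₂ = cy δ 0<δ
        M = M₁ ℕ.⊔ M₂
        N = N₁ ℕ.⊔ N₂
    in M ℕ.⊔ N , λ m n K≤m K≤n →
      let M≤m = ℕ.m⊔n≤o⇒m≤o M N K≤m
          M≤n = ℕ.m⊔n≤o⇒m≤o M N K≤n
          N≤m = ℕ.m⊔n≤o⇒n≤o M N K≤m
          N≤n = ℕ.m⊔n≤o⇒n≤o M N K≤n
      in ≤-<-trans
        (subst (∣ x m * y m - x n * y n ∣ ≤_) eq
          (∣pq-rs∣≤ (x m) (y m) (x n) (y n) 0<A 0<B
            (a m (ℕ.m⊔n≤o⇒m≤o M₁ M₂ M≤m)) (b n (ℕ.m⊔n≤o⇒n≤o M₁ M₂ M≤n))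
            (<⇒≤ (h₁ m n (ℕ.m⊔n≤o⇒m≤o N₁ N₂ N≤m) (ℕ.m⊔n≤o⇒m≤o N₁ N₂ N≤n)))
            (<⇒≤ (h₂ m n (ℕ.m⊔n≤o⇒n≤o N₁ N₂ N≤m) (ℕ.m⊔n≤o⇒n≤o N₁ N₂ N≤n)))))
        (half< ε 0<ε)

infixl 6 _+ᵣ_
infixl 7 _*ᵣ_
infix  8 -ᵣ_

fromℚ : ℚ → ℝ
fromℚ q = mkℝ (λ _ → q) (cauchy-const q)

fromℤ : ℤ → ℝ
fromℤ z = fromℚ (z / 1)

0ᵣ 1ᵣ : ℝ
0ᵣ = fromℚ 0ℚ
1ᵣ = fromℚ 1ℚ

_+ᵣ_ _*ᵣ_ : ℝ → ℝ → ℝ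
mkℝ x cx +ᵣ mkℝ y cy = mkℝ (λ n → x n + y n) (cauchy-+ {x} {y} cx cy)
mkℝ x cx *ᵣ mkℝ y cy = mkℝ (λ n → x n * y n) (cauchy-* {x} {y} cx cy)

-ᵣ_ ∣_∣ᵣ : ℝ → ℝ
-ᵣ mkℝ x cx     = mkℝ (λ n → - x n) (cauchy-neg {x} cx)
∣ mkℝ x cx ∣ᵣ = mkℝ (λ n → ∣ x n ∣) (cauchy-abs {x} cx)

------------------------------------------------------------------------
-- Vectors and linear algebra

ℝ^_ ℤ^_ : ℕ → Set
ℝ^ d = Vector ℝ d
ℤ^ d = Vector ℤ d

infix  4 _≈ᵥ_
infixl 6 _+ᵥ_
infixl 7 _·ᵥ_

_≈ᵥ_ : ∀ {d} → ℝ^ d → ℝ^ d → Set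
x ≈ᵥ y = ∀ k → x k ≈ᵣ y k

_+ᵥ_ : ∀ {d} → ℝ^ d → ℝ^ d → ℝ^ d
(x +ᵥ y) k = x k +ᵣ y k

-ᵥ_ : ∀ {d} → ℝ^ d → ℝ^ d
(-ᵥ x) k = -ᵣ x k

_·ᵥ_ : ∀ {d} → ℝ → ℝ^ d → ℝ^ d
(ρ ·ᵥ x) k = ρ *ᵣ x k

0ᵥ : ∀ {d} → ℝ^ d
0ᵥ _ = 0ᵣ

embed : ∀ {d} → ℤ^ d → ℝ^ d
embed z k = fromℤ (z k)

combℝ : ∀ {n d} → Vector ℝ n → Vector (ℤ^ d) n → ℝ^ d
combℝ c u k = foldr _+ᵣ_ 0ᵣ (λ i → c i *ᵣ fromℤ (u i k))

combℤ : ∀ {n d} → Vector ℤ n → Vector (ℤ^ d) n → ℤ^ d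
combℤ a u k = foldr ℤ._+_ (+ 0) (λ i → a i ℤ.* u i k)

Spanning : ∀ {n d} → Vector (ℤ^ d) n → Set
Spanning {n} {d} u = ∀ (x : ℝ^ d) → Σ[ c ∈ Vector ℝ n ] x ≈ᵥ combℝ c u

LinearlyIndependent : ∀ {n d} → Vector (ℤ^ d) n → Set
LinearlyIndependent {n} u =
  ∀ (c : Vector ℝ n) → combℝ c u ≈ᵥ 0ᵥ → ∀ i → c i ≈ᵣ 0ᵣ

GeneratesLattice : ∀ {n d} → Vector (ℤ^ d) n → Set
GeneratesLattice {n} {d} u = ∀ (z : ℤ^ d) → Σ[ a ∈ Vector ℤ n ] z ≗ combℤ a u

Cosimple : ∀ {n d} → Vector (ℤ^ d) n → Set
Cosimple {n} u = Spanning u × Σ[ c ∈ Vector ℝ n ]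
  ( combℝ c u ≈ᵥ 0ᵥ
  × (∀ i → ¬ (c i ≈ᵣ 0ᵣ))
  × (∀ i j → i ≢ j → ¬ (∣ c i ∣ᵣ ≈ᵣ ∣ c j ∣ᵣ)))

------------------------------------------------------------------------
-- Subsets of ℝ^d, zonotopes and the covering radius

Region : ℕ → Set₁
Region d = Pred (ℝ^ d) 0ℓ

dilate : ∀ {d} → ℝ → Region d → Region d
dilate {d} ρ M x = Σ[ y ∈ ℝ^ d ] (y ∈ M × x ≈ᵥ ρ ·ᵥ y)

translate : ∀ {d} → Region d → ℝ^ d → Region d
translate {d} M t x = Σ[ y ∈ ℝ^ d ] (y ∈ M × x ≈ᵥ y +ᵥ t)

-- x + ℤ^d
latticeCoset : ∀ {d} → ℝ^ d → Region d
latticeCoset {d} x y = Σ[ z ∈ ℤ^ d ] y ≈ᵥ x +ᵥ embed z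

-- The Minkowski sum of the segments [0, u i].
zonotope : ∀ {n d} → Vector (ℤ^ d) n → Region d
zonotope {n} u x = Σ[ t ∈ Vector ℝ n ]
  ((∀ i → 0ᵣ ≤ᵣ t i × t i ≤ᵣ 1ᵣ) × x ≈ᵥ combℝ t u)

center : ∀ {n d} → Vector (ℤ^ d) n → ℝ^ d
center u = fromℚ ½ ·ᵥ combℝ (λ _ → 1ᵣ) u

-- M + ℤ^d = ℝ^d
CoversSpace : ∀ {d} → Region d → Set
CoversSpace {d} M = ∀ (x : ℝ^ d) → Σ[ y ∈ ℝ^ d ] (y ∈ M × x ∈ latticeCoset y)

-- The minimum is taken over ρ ≥ 0 rather than ρ > 0. For a bounded M in
-- dimension d ≥ 1 this changes nothing, since 0 · M + ℤ^d ≠ ℝ^d; in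
-- dimension 0, where no minimum over ρ > 0 exists, it makes the covering
-- radius equal to the infimum 0.
IsCoveringRadius : ∀ {d} → Region d → ℝ → Set
IsCoveringRadius M μ =
    0ᵣ ≤ᵣ μ
  × CoversSpace (dilate μ M)
  × (∀ ρ → 0ᵣ ≤ᵣ ρ → CoversSpace (dilate ρ M) → μ ≤ᵣ ρ)

-- #(M ∩ ℤ^d) ≤ N
AtMostLatticePoints : ∀ {d} → ℕ → Region d → Set
AtMostLatticePoints {d} N M = ∀ {k} (p : Fin k → ℤ^ d) →
  Injective _≡_ _≗_ p → (∀ i → embed (p i) ∈ M) → k ℕ.≤ N

------------------------------------------------------------------------
-- Lonely Runner Zonotopes, given by their generators

IsLonelyRunner : ∀ {d} → Vector (ℤ^ d) (suc d) → Set
IsLonelyRunner {d} u = ∀ (f : Fin d → Fin (suc d)) → Injective _≡_ _≡_ f →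
  LinearlyIndependent (u ∘ f)

gcdOf : ∀ {n} → Vector ℕ n → ℕ
gcdOf = foldr gcd 0

-- u generates the zonotope Z_v; these u form one orbit under unimodular
-- maps of ℤ^d.
IsZonotopeOf : ∀ {d} → Vector ℕ (suc d) → Vector (ℤ^ d) (suc d) → Set
IsZonotopeOf v u =
    (∀ i → 0 ℕ.< v i)
  × gcdOf v ≡ 1
  × GeneratesLattice u
  × combℤ (λ i → + v i) u ≗ (λ _ → + 0)

IsStrongLonelyRunner : ∀ {d} → Vector (ℤ^ d) (suc d) → Set
IsStrongLonelyRunner {d} u =
  Σ[ v ∈ Vector ℕ (suc d) ] (IsZonotopeOf v u × Injective _≡_ _≡_ v)

{-# OPTIONS --safe #-}

-- Write k = binom (d + 2) 2. Among more than k^d lattice points of the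
-- zonotope Z two are congruent modulo k, so that Z contains a translate of
-- [0, k w] for some non-zero w ∈ ℤ^d. Project along w to ℤ^(d - 1). If the
-- projection of x is covered by ρ π(Z) + ℤ^(d - 1), then x is covered by
-- (ρ + 1 / k) Z + ℤ^d, because (1 / k) Z contains a translate of [0, w]; and
-- (d - 1) / (d + 1) + 1 / k = d / (d + 2).
--
-- In (a) the velocities witness that π(Z) is cosimple. In (b) only the center
-- has to be covered. If π(Z) is not cosimple, then two coordinates agree up to
-- sign on all dependences of its generators, and by duality some linear form f
-- vanishes on all generators but these two, u and v, and on one of u ± v.
-- Replacing u and v by this vector gives a smaller zonotope in the hyperplane
-- f = 0, with the same center modulo the lattice, and one proceeds by induction
-- on the dimension.
module Submission where

open import Defs
open import Algebra.Bundles using (CommutativeRing)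
import Algebra.Morphism.Construct.Identity as Identity
open import Algebra.Morphism.Structures using (IsRingHomomorphism)
import Algebra.Properties.Semiring.Sum as SemiringSum
open import Axiom.ExcludedMiddle using (ExcludedMiddle)
open import Data.Bool.Base using (Bool; true; false)
open import Data.Fin.Base using (Fin; zero; suc; punchIn; punchOut; toℕ; fromℕ<; funToFin; finToFun)
import Data.Fin.Properties as Fin
import Data.Integer.Base as ℤ
open ℤ using (ℤ; +_; 0ℤ; 1ℤ; -1ℤ)
import Data.Integer.DivMod as ℤ
import Data.Integer.Properties as ℤ
import Data.Integer.Solver as ℤSolver
open import Data.List.Base as List using (List; []; _∷_; _++_)
import Data.List.Membership.Propositional.Properties as List
open import Data.List.Relation.Unary.All as All using (All; []; _∷_)
import Data.List.Relation.Unary.All.Properties as All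
open import Data.List.Relation.Unary.Any as Any using (Any; here; there)
import Data.List.Relation.Unary.Any.Properties as Any
import Data.Nat.Base as ℕ
open ℕ using (ℕ; zero; suc)
open import Data.Nat.Combinatorics using (_C_; nC1≡n; nCk+nC[k+1]≡[n+1]C[k+1])
open import Data.Nat.Induction using (<-wellFounded)
import Data.Nat.Properties as ℕ
import Data.Nat.Solver as ℕSolver
open import Data.Product.Base using (∃-syntax; Σ-syntax; _×_; _,_; proj₁; proj₂)
import Data.Rational.Base as ℚ
open ℚ using (ℚ; 0ℚ; 1ℚ; ½; _/_)
import Data.Rational.Properties as ℚ
open import Data.Rational.Solver using (module +-*-Solver)
import Data.Rational.Unnormalised.Base as ℚᵘ
import Data.Rational.Unnormalised.Properties as ℚᵘ
open import Data.Sum.Base using (_⊎_; inj₁; inj₂)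
open import Data.Vec.Functional using (Vector; removeAt; insertAt)
import Data.Vec.Functional.Properties as Vector
open import Function.Base using (_∘_; id)
open import Function.Definitions using (Injective)
open import Induction.WellFounded using (Acc; acc)
open import Level using (0ℓ)
open import Relation.Binary.PropositionalEquality
  using (_≡_; _≢_; _≗_; refl; sym; trans; cong; cong₂; subst; subst₂; module ≡-Reasoning)
import Relation.Binary.Reasoning.Setoid as SetoidReasoning
open import Relation.Nullary using (¬_; yes; no; contradiction)
open import Relation.Unary using (_∩_; Empty; _∈_)

-- The real numbers as an ordered commutative ring

-- Dependences, dual forms and bases are all kept over ℤ, where equality is decidable and a carried
-- non-zero factor replaces division; the hypothesis is applied only to collections with an integer
-- dependence. Real numbers enter through coefficients, and excluded middle through rounding a real
-- number to an integer.
--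
-- Dilates are traded for symmetric coefficients: `Reach h u x` puts x into the sum of the segments
-- [-h u i, h u i] plus ℤ^d. For h = ρ / 2 and all x this is covering by ρ Z, and at the center x of
-- Z alone it says that ρ (Z - x) meets x + ℤ^d. So (a) and (b) share one lifting step, in which the
-- two radii simply add.
--
-- An obstacle in (b) is that merging two generators leaves dimension d - 1, the only one about
-- which the hypothesis speaks. `lower-dimension` carries its bound down with the same radius. What
-- survives each merging is a dependence without zero coefficients, and this is exactly what the
-- search for a cosimple dependence needs as a starting point.

Eventually : (ℕ → Set) → Set
Eventually P = ∃[ N ] (∀ n → N ℕ.≤ n → P n)

Eventually-map : ∀ {P Q : ℕ → Set} → (∀ n → P n → Q n) → Eventually P → Eventually Q
Eventually-map f (N , p) = N , λ n N≤n → f n (p n N≤n)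

Eventually-zip : ∀ {P Q R : ℕ → Set} → (∀ n → P n → Q n → R n) →
  Eventually P → Eventually Q → Eventually R
Eventually-zip f (M , p) (N , q) = M ℕ.⊔ N , λ n M⊔N≤n →
  f n (p n (ℕ.m⊔n≤o⇒m≤o M N M⊔N≤n)) (q n (ℕ.m⊔n≤o⇒n≤o M N M⊔N≤n))

always : ∀ {P : ℕ → Set} → (∀ n → P n) → Eventually P
always p = 0 , λ n _ → p n

-- Records, because _≈ᵣ_ and _≤ᵣ_ unfold to function types, from which the
-- two reals cannot be inferred.
infix 4 _≃_ _≲_

record _≃_ (x y : ℝ) : Set where
  constructor wrap≃
  field unwrap≃ : x ≈ᵣ y

record _≲_ (x y : ℝ) : Set where
  constructor wrap≲
  field unwrap≲ : x ≤ᵣ y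

open _≃_ public
open _≲_ public

module RationalLemmas where
  open +-*-Solver

  half-pos : ∀ {ε} → 0ℚ ℚ.< ε → 0ℚ ℚ.< ½ ℚ.* ε
  half-pos {ε} 0<ε = subst (ℚ._< ½ ℚ.* ε) (ℚ.*-zeroʳ ½) (ℚ.*-monoʳ-<-pos ½ 0<ε)

  halves : ∀ ε → ½ ℚ.* ε ℚ.+ ½ ℚ.* ε ≡ ε
  halves ε = trans (sym (ℚ.*-distribʳ-+ ε ½ ½)) (ℚ.*-identityˡ ε)

  ∣p-p∣≡0 : ∀ p → ℚ.∣ p ℚ.- p ∣ ≡ 0ℚ
  ∣p-p∣≡0 p = cong ℚ.∣_∣ (ℚ.+-inverseʳ p)

  ∣p-q∣≡∣q-p∣ : ∀ p q → ℚ.∣ p ℚ.- q ∣ ≡ ℚ.∣ q ℚ.- p ∣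
  ∣p-q∣≡∣q-p∣ p q = trans (sym (ℚ.∣-p∣≡∣p∣ (p ℚ.- q)))
    (cong ℚ.∣_∣ (solve 2 (λ p q → :- (p :- q) := q :- p) refl p q))

  telescope : ∀ p q r → p ℚ.- r ≡ (p ℚ.- q) ℚ.+ (q ℚ.- r)
  telescope = solve 3 (λ p q r → p :- r := (p :- q) :+ (q :- r)) refl

  ∣p-r∣≤ : ∀ p q r → ℚ.∣ p ℚ.- r ∣ ℚ.≤ ℚ.∣ p ℚ.- q ∣ ℚ.+ ℚ.∣ q ℚ.- r ∣
  ∣p-r∣≤ p q r = subst (λ s → ℚ.∣ s ∣ ℚ.≤ ℚ.∣ p ℚ.- q ∣ ℚ.+ ℚ.∣ q ℚ.- r ∣)
    (sym (telescope p q r)) (ℚ.∣p+q∣≤∣p∣+∣q∣ (p ℚ.- q) (q ℚ.- r))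

  p≤∣p∣ : ∀ p → p ℚ.≤ ℚ.∣ p ∣
  p≤∣p∣ p with ℚ.≤-total 0ℚ p
  ... | inj₁ 0≤p = ℚ.≤-reflexive (sym (ℚ.0≤p⇒∣p∣≡p 0≤p))
  ... | inj₂ p≤0 = ℚ.≤-trans p≤0 (ℚ.0≤∣p∣ p)

  -p≤∣p∣ : ∀ p → ℚ.- p ℚ.≤ ℚ.∣ p ∣
  -p≤∣p∣ p = subst (ℚ.- p ℚ.≤_) (ℚ.∣-p∣≡∣p∣ p) (p≤∣p∣ (ℚ.- p))

  ∣p-q∣<⇒p<q+ : ∀ p q {ε} → ℚ.∣ p ℚ.- q ∣ ℚ.< ε → p ℚ.< q ℚ.+ ε
  ∣p-q∣<⇒p<q+ p q {ε} lt = subst (ℚ._< q ℚ.+ ε)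
    (solve 2 (λ p q → q :+ (p :- q) := p) refl p q)
    (ℚ.+-monoʳ-< q (ℚ.≤-<-trans (p≤∣p∣ (p ℚ.- q)) lt))

  ∣p-q∣<⇒q<p+ : ∀ p q {ε} → ℚ.∣ p ℚ.- q ∣ ℚ.< ε → q ℚ.< p ℚ.+ ε
  ∣p-q∣<⇒q<p+ p q lt = ∣p-q∣<⇒p<q+ q p (subst (ℚ._< _) (∣p-q∣≡∣q-p∣ p q) lt)

  <⇒∣p-q∣< : ∀ {p q ε} → p ℚ.< q ℚ.+ ε → q ℚ.< p ℚ.+ ε → ℚ.∣ p ℚ.- q ∣ ℚ.< ε
  <⇒∣p-q∣< {p} {q} {ε} p<q+ε q<p+ε with ℚ.∣p∣≡p∨∣p∣≡-p (p ℚ.- q)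
  ... | inj₁ eq = subst₂ ℚ._<_ (sym eq) (solve 2 (λ q ε → q :+ ε :- q := ε) refl q ε)
    (ℚ.+-monoˡ-< (ℚ.- q) p<q+ε)
  ... | inj₂ eq = subst₂ ℚ._<_
    (trans (solve 2 (λ p q → q :- p := :- (p :- q)) refl p q) (sym eq))
    (solve 2 (λ q ε → q :+ ε :- q := ε) refl p ε)
    (ℚ.+-monoˡ-< (ℚ.- p) q<p+ε)

  ∣p∣≤∣p-q∣+∣q∣ : ∀ p q → ℚ.∣ p ∣ ℚ.≤ ℚ.∣ p ℚ.- q ∣ ℚ.+ ℚ.∣ q ∣
  ∣p∣≤∣p-q∣+∣q∣ p q = subst (λ r → ℚ.∣ r ∣ ℚ.≤ ℚ.∣ p ℚ.- q ∣ ℚ.+ ℚ.∣ q ∣)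
    (solve 2 (λ p q → p :- q :+ q := p) refl p q)
    (ℚ.∣p+q∣≤∣p∣+∣q∣ (p ℚ.- q) q)

  p<p+ε : ∀ p {ε} → 0ℚ ℚ.< ε → p ℚ.< p ℚ.+ ε
  p<p+ε p {ε} 0<ε = subst (ℚ._< p ℚ.+ ε) (ℚ.+-identityʳ p) (ℚ.+-monoʳ-< p 0<ε)

  interchange : ∀ a b c d → (a ℚ.+ b) ℚ.+ (c ℚ.+ d) ≡ (a ℚ.+ c) ℚ.+ (b ℚ.+ d)
  interchange = solve 4 (λ a b c d → (a :+ b) :+ (c :+ d) := (a :+ c) :+ (b :+ d)) refl

  interchange-+- : ∀ a b c d → (a ℚ.+ b) ℚ.- (c ℚ.+ d) ≡ (a ℚ.- c) ℚ.+ (b ℚ.- d)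
  interchange-+- = solve 4 (λ a b c d → (a :+ b) :- (c :+ d) := (a :- c) :+ (b :- d)) refl

  *-distribˡ-- : ∀ a b c → a ℚ.* b ℚ.- a ℚ.* c ≡ a ℚ.* (b ℚ.- c)
  *-distribˡ-- = solve 3 (λ a b c → a :* b :- a :* c := a :* (b :- c)) refl

  neg-- : ∀ a b → (ℚ.- a) ℚ.- (ℚ.- b) ≡ ℚ.- (a ℚ.- b)
  neg-- = solve 2 (λ a b → (:- a) :- (:- b) := :- (a :- b)) refl

open RationalLemmas public

pointwise-≃ : ∀ {x y} → (∀ n → seq x n ≡ seq y n) → x ≃ y
pointwise-≃ {x} {y} eq = wrap≃ λ ε 0<ε → always λ n →
  subst (ℚ._< ε) (sym (trans (cong (λ s → ℚ.∣ s ℚ.- seq y n ∣) (eq n)) (∣p-p∣≡0 (seq y n)))) 0<ε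

pointwise-≲ : ∀ {x y} → (∀ n → seq x n ℚ.≤ seq y n) → x ≲ y
pointwise-≲ {x} {y} le = wrap≲ λ ε 0<ε → always λ n →
  ℚ.≤-<-trans (le n) (p<p+ε (seq y n) 0<ε)

≃-refl : ∀ {x} → x ≃ x
≃-refl {x} = pointwise-≃ {x} {x} λ _ → refl

≃-sym : ∀ {x y} → x ≃ y → y ≃ x
≃-sym {x} {y} (wrap≃ x≃y) = wrap≃ λ ε 0<ε →
  Eventually-map (λ n → subst (ℚ._< ε) (∣p-q∣≡∣q-p∣ (seq x n) (seq y n))) (x≃y ε 0<ε)

≃-trans : ∀ {x y z} → x ≃ y → y ≃ z → x ≃ z
≃-trans {x} {y} {z} (wrap≃ x≃y) (wrap≃ y≃z) = wrap≃ λ ε 0<ε →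
  Eventually-zip (λ n p q → ℚ.≤-<-trans (∣p-r∣≤ (seq x n) (seq y n) (seq z n))
      (subst (_ ℚ.<_) (halves ε) (ℚ.+-mono-< p q)))
    (x≃y _ (half-pos 0<ε)) (y≃z _ (half-pos 0<ε))

+ᵣ-cong : ∀ {x x′ y y′} → x ≃ x′ → y ≃ y′ → x +ᵣ y ≃ x′ +ᵣ y′
+ᵣ-cong {x} {x′} {y} {y′} (wrap≃ p) (wrap≃ q) = wrap≃ λ ε 0<ε →
  Eventually-zip (λ n p q → ℚ.≤-<-trans
      (subst (λ s → ℚ.∣ s ∣ ℚ.≤ ℚ.∣ seq x n ℚ.- seq x′ n ∣ ℚ.+ ℚ.∣ seq y n ℚ.- seq y′ n ∣)
        (sym (interchange-+- (seq x n) (seq y n) (seq x′ n) (seq y′ n)))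
        (ℚ.∣p+q∣≤∣p∣+∣q∣ (seq x n ℚ.- seq x′ n) (seq y n ℚ.- seq y′ n)))
      (subst (_ ℚ.<_) (halves ε) (ℚ.+-mono-< p q)))
    (p _ (half-pos 0<ε)) (q _ (half-pos 0<ε))

-ᵣ-cong : ∀ {x y} → x ≃ y → -ᵣ x ≃ -ᵣ y
-ᵣ-cong {x} {y} (wrap≃ p) = wrap≃ λ ε 0<ε → Eventually-map (λ n → subst (ℚ._< ε)
  (sym (trans (cong ℚ.∣_∣ (neg-- (seq x n) (seq y n))) (ℚ.∣-p∣≡∣p∣ (seq x n ℚ.- seq y n))))) (p ε 0<ε)

eventually-bounded : ∀ x → ∃[ B ] (0ℚ ℚ.< B × Eventually (λ n → ℚ.∣ seq x n ∣ ℚ.≤ B))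
eventually-bounded x with cauchy x 1ℚ (ℚ.positive⁻¹ 1ℚ)
... | N , h = 1ℚ ℚ.+ ℚ.∣ seq x N ∣ ,
  subst (ℚ._< 1ℚ ℚ.+ ℚ.∣ seq x N ∣) (ℚ.+-identityˡ 0ℚ)
    (ℚ.+-mono-<-≤ (ℚ.positive⁻¹ 1ℚ) (ℚ.0≤∣p∣ (seq x N))) ,
  N , λ n N≤n → ℚ.≤-trans (∣p∣≤∣p-q∣+∣q∣ (seq x n) (seq x N))
    (ℚ.+-monoˡ-≤ ℚ.∣ seq x N ∣ (ℚ.<⇒≤ (h n N N≤n ℕ.≤-refl)))

positive-scale : ∀ {B ε} → 0ℚ ℚ.< B → 0ℚ ℚ.< ε → ∃[ δ ] (0ℚ ℚ.< δ × B ℚ.* δ ≡ ε)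
positive-scale {B} {ε} 0<B 0<ε = 1/B ℚ.* ε ,
  subst (ℚ._< 1/B ℚ.* ε) (ℚ.*-zeroʳ 1/B) (ℚ.*-monoʳ-<-pos 1/B {{ℚ.1/pos⇒pos B}} 0<ε) ,
  trans (sym (ℚ.*-assoc B 1/B ε)) (trans (cong (ℚ._* ε) (ℚ.*-inverseʳ B)) (ℚ.*-identityˡ ε))
  where
  instance
    B>0 : ℚ.Positive B
    B>0 = ℚ.positive 0<B
    B≢0 : ℚ.NonZero B
    B≢0 = ℚ.pos⇒nonZero B
  1/B : ℚ
  1/B = ℚ.1/ B

∣a*b∣<A*δ : ∀ a b {A δ} → 0ℚ ℚ.< A → ℚ.∣ a ∣ ℚ.≤ A → ℚ.∣ b ∣ ℚ.< δ → ℚ.∣ a ℚ.* b ∣ ℚ.< A ℚ.* δ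
∣a*b∣<A*δ a b {A} {δ} 0<A a≤A b<δ = subst (ℚ._< A ℚ.* δ) (sym (ℚ.∣p*q∣≡∣p∣*∣q∣ a b))
  (ℚ.≤-<-trans (ℚ.*-monoʳ-≤-nonNeg ℚ.∣ b ∣ {{ℚ.∣-∣-nonNeg b}} a≤A)
    (ℚ.*-monoʳ-<-pos A {{ℚ.positive 0<A}} b<δ))

∣ab-ac∣<ε : ∀ a b c {A δ ε} → 0ℚ ℚ.< A → ℚ.∣ a ∣ ℚ.≤ A → A ℚ.* δ ≡ ε →
  ℚ.∣ b ℚ.- c ∣ ℚ.< δ → ℚ.∣ a ℚ.* b ℚ.- a ℚ.* c ∣ ℚ.< ε
∣ab-ac∣<ε a b c 0<A a≤A refl lt = subst (λ s → ℚ.∣ s ∣ ℚ.< _) (sym (*-distribˡ-- a b c))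
  (∣a*b∣<A*δ a (b ℚ.- c) 0<A a≤A lt)

*ᵣ-congˡ : ∀ x {y y′} → y ≃ y′ → x *ᵣ y ≃ x *ᵣ y′
*ᵣ-congˡ x {y} {y′} (wrap≃ y≃y′) = wrap≃ (go (eventually-bounded x))
  where
  close : ∀ {B ε} → 0ℚ ℚ.< B → Eventually (λ n → ℚ.∣ seq x n ∣ ℚ.≤ B) →
    ∃[ δ ] (0ℚ ℚ.< δ × B ℚ.* δ ≡ ε) →
    Eventually (λ n → ℚ.∣ seq x n ℚ.* seq y n ℚ.- seq x n ℚ.* seq y′ n ∣ ℚ.< ε)
  close 0<B x≤B (δ , 0<δ , Bδ≡ε) = Eventually-zip
    (λ n x≤B lt → ∣ab-ac∣<ε (seq x n) (seq y n) (seq y′ n) 0<B x≤B Bδ≡ε lt) x≤B (y≃y′ δ 0<δ)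
  go : ∃[ B ] (0ℚ ℚ.< B × Eventually (λ n → ℚ.∣ seq x n ∣ ℚ.≤ B)) → x *ᵣ y ≈ᵣ x *ᵣ y′
  go (B , 0<B , x≤B) ε 0<ε = close 0<B x≤B (positive-scale 0<B 0<ε)

*ᵣ-comm : ∀ x y → x *ᵣ y ≃ y *ᵣ x
*ᵣ-comm x y = pointwise-≃ λ n → ℚ.*-comm (seq x n) (seq y n)

*ᵣ-cong : ∀ {x x′ y y′} → x ≃ x′ → y ≃ y′ → x *ᵣ y ≃ x′ *ᵣ y′
*ᵣ-cong {x} {x′} {y} {y′} p q = ≃-trans (*ᵣ-congˡ x q)
  (≃-trans (*ᵣ-comm x y′) (≃-trans (*ᵣ-congˡ y′ p) (*ᵣ-comm y′ x′)))

ℝ-commutativeRing : CommutativeRing 0ℓ 0ℓ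
ℝ-commutativeRing = record
  { Carrier = ℝ ; _≈_ = _≃_ ; _+_ = _+ᵣ_ ; _*_ = _*ᵣ_ ; -_ = -ᵣ_ ; 0# = 0ᵣ ; 1# = 1ᵣ
  ; isCommutativeRing = record
    { isRing = record
      { +-isAbelianGroup = record
        { isGroup = record
          { isMonoid = record
            { isSemigroup = record
              { isMagma = record
                { isEquivalence = record { refl = ≃-refl ; sym = ≃-sym ; trans = ≃-trans }
                ; ∙-cong = +ᵣ-cong }
              ; assoc = λ x y z → pointwise-≃ λ n → ℚ.+-assoc (seq x n) (seq y n) (seq z n) }
            ; identity = (λ x → pointwise-≃ λ n → ℚ.+-identityˡ (seq x n))
                       , (λ x → pointwise-≃ λ n → ℚ.+-identityʳ (seq x n)) }
          ; inverse = (λ x → pointwise-≃ λ n → ℚ.+-inverseˡ (seq x n))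
                    , (λ x → pointwise-≃ λ n → ℚ.+-inverseʳ (seq x n))
          ; ⁻¹-cong = -ᵣ-cong }
        ; comm = λ x y → pointwise-≃ λ n → ℚ.+-comm (seq x n) (seq y n) }
      ; *-cong = *ᵣ-cong
      ; *-assoc = λ x y z → pointwise-≃ λ n → ℚ.*-assoc (seq x n) (seq y n) (seq z n)
      ; *-identity = (λ x → pointwise-≃ λ n → ℚ.*-identityˡ (seq x n))
                   , (λ x → pointwise-≃ λ n → ℚ.*-identityʳ (seq x n))
      ; distrib = (λ x y z → pointwise-≃ λ n → ℚ.*-distribˡ-+ (seq x n) (seq y n) (seq z n))
                , (λ x y z → pointwise-≃ λ n → ℚ.*-distribʳ-+ (seq x n) (seq y n) (seq z n)) }
    ; *-comm = *ᵣ-comm } }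

≃⇒≲ : ∀ {x y} → x ≃ y → x ≲ y
≃⇒≲ {x} {y} (wrap≃ p) = wrap≲ λ ε 0<ε → Eventually-map (λ n → ∣p-q∣<⇒p<q+ (seq x n) (seq y n)) (p ε 0<ε)

≲-antisym : ∀ {x y} → x ≲ y → y ≲ x → x ≃ y
≲-antisym (wrap≲ p) (wrap≲ q) = wrap≃ λ ε 0<ε →
  Eventually-zip (λ _ → <⇒∣p-q∣<) (p ε 0<ε) (q ε 0<ε)

≲-trans : ∀ {x y z} → x ≲ y → y ≲ z → x ≲ z
≲-trans {x} {y} {z} (wrap≲ p) (wrap≲ q) = wrap≲ λ ε 0<ε →
  Eventually-zip (λ n p q → ℚ.<-trans p (subst (seq y n ℚ.+ ½ ℚ.* ε ℚ.<_)
      (trans (ℚ.+-assoc (seq z n) _ _) (cong (seq z n ℚ.+_) (halves ε)))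
      (ℚ.+-monoˡ-< (½ ℚ.* ε) q)))
    (p _ (half-pos 0<ε)) (q _ (half-pos 0<ε))

≲-resp-≃ : ∀ {x x′ y y′} → x ≃ x′ → y ≃ y′ → x ≲ y → x′ ≲ y′
≲-resp-≃ p q le = ≲-trans (≃⇒≲ (≃-sym p)) (≲-trans le (≃⇒≲ q))

+ᵣ-mono-≲ : ∀ {x x′ y y′} → x ≲ x′ → y ≲ y′ → x +ᵣ y ≲ x′ +ᵣ y′
+ᵣ-mono-≲ {x} {x′} {y} {y′} (wrap≲ p) (wrap≲ q) = wrap≲ λ ε 0<ε →
  Eventually-zip (λ n p q → subst (seq x n ℚ.+ seq y n ℚ.<_)
      (trans (interchange (seq x′ n) _ (seq y′ n) _) (cong ((seq x′ n ℚ.+ seq y′ n) ℚ.+_) (halves ε)))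
      (ℚ.+-mono-< p q))
    (p _ (half-pos 0<ε)) (q _ (half-pos 0<ε))

fromℚ-mono-≤ : ∀ {p q} → p ℚ.≤ q → fromℚ p ≲ fromℚ q
fromℚ-mono-≤ p≤q = pointwise-≲ λ _ → p≤q

x≲∣x∣ : ∀ x → x ≲ ∣ x ∣ᵣ
x≲∣x∣ x = pointwise-≲ λ n → p≤∣p∣ (seq x n)

-x≲∣x∣ : ∀ x → -ᵣ x ≲ ∣ x ∣ᵣ
-x≲∣x∣ x = pointwise-≲ λ n → -p≤∣p∣ (seq x n)

∣x∣≲ : ∀ {x y} → x ≲ y → -ᵣ x ≲ y → ∣ x ∣ᵣ ≲ y
∣x∣≲ {x} {y} (wrap≲ p) (wrap≲ q) = wrap≲ λ ε 0<ε → Eventually-zip (λ n → choose n ε) (p ε 0<ε) (q ε 0<ε)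
  where
  choose : ∀ n ε → seq x n ℚ.< seq y n ℚ.+ ε → ℚ.- seq x n ℚ.< seq y n ℚ.+ ε → ℚ.∣ seq x n ∣ ℚ.< seq y n ℚ.+ ε
  choose n ε p q with ℚ.∣p∣≡p∨∣p∣≡-p (seq x n)
  ... | inj₁ eq = subst (ℚ._< _) (sym eq) p
  ... | inj₂ eq = subst (ℚ._< _) (sym eq) q

0≲x⇒x≃∣x∣ : ∀ {x} → 0ᵣ ≲ x → x ≃ ∣ x ∣ᵣ
0≲x⇒x≃∣x∣ {x} 0≲x = ≲-antisym (x≲∣x∣ x) (∣x∣≲ (≃⇒≲ ≃-refl) (≲-trans -x≲0 0≲x))
  where
  open +-*-Solver
  -x≲0 : -ᵣ x ≲ 0ᵣ
  -x≲0 = wrap≲ λ ε 0<ε → Eventually-map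
    (λ n lt → subst₂ ℚ._<_ (ℚ.+-identityˡ _)
      (solve 2 (λ a ε → a :+ ε :- a := con 0ℚ :+ ε) refl (seq x n) ε)
      (ℚ.+-monoˡ-< (ℚ.- seq x n) lt)) (unwrap≲ 0≲x ε 0<ε)

-- A non-negative real may have negative terms. Replacing both factors by their absolute values
-- makes the product non-negative term by term.
0≲* : ∀ {x y} → 0ᵣ ≲ x → 0ᵣ ≲ y → 0ᵣ ≲ x *ᵣ y
0≲* {x} {y} 0≲x 0≲y = ≲-resp-≃ ≃-refl (*ᵣ-cong (≃-sym (0≲x⇒x≃∣x∣ 0≲x)) (≃-sym (0≲x⇒x≃∣x∣ 0≲y)))
  (pointwise-≲ λ n → subst (0ℚ ℚ.≤_) (ℚ.∣p*q∣≡∣p∣*∣q∣ (seq x n) (seq y n)) (ℚ.0≤∣p∣ _))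

≲⇒0≲- : ∀ {x y} → x ≲ y → 0ᵣ ≲ y +ᵣ -ᵣ x
≲⇒0≲- {x} x≲y = ≲-resp-≃ (pointwise-≃ λ n → ℚ.+-inverseʳ (seq x n)) ≃-refl
  (+ᵣ-mono-≲ x≲y (≃⇒≲ ≃-refl))

0≲-⇒≲ : ∀ {x y} → 0ᵣ ≲ y +ᵣ -ᵣ x → x ≲ y
0≲-⇒≲ {x} {y} le = ≲-resp-≃ (pointwise-≃ λ n → ℚ.+-identityˡ (seq x n))
  (pointwise-≃ λ n → solve 2 (λ x y → y :- x :+ x := y) refl (seq x n) (seq y n))
  (+ᵣ-mono-≲ le (≃⇒≲ (≃-refl {x})))
  where open +-*-Solver

*ᵣ-monoˡ-≲ : ∀ {x y z} → 0ᵣ ≲ z → x ≲ y → z *ᵣ x ≲ z *ᵣ y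
*ᵣ-monoˡ-≲ {x} {y} {z} 0≲z x≲y = 0≲-⇒≲ (≲-resp-≃ ≃-refl
  (pointwise-≃ λ n → solve 3 (λ x y z → z :* (y :- x) := z :* y :- z :* x) refl
    (seq x n) (seq y n) (seq z n))
  (0≲* 0≲z (≲⇒0≲- x≲y)))
  where open +-*-Solver

∣x+y∣≲ : ∀ {x y a b} → ∣ x ∣ᵣ ≲ a → ∣ y ∣ᵣ ≲ b → ∣ x +ᵣ y ∣ᵣ ≲ a +ᵣ b
∣x+y∣≲ {x} {y} p q = ≲-trans (pointwise-≲ λ n → ℚ.∣p+q∣≤∣p∣+∣q∣ (seq x n) (seq y n)) (+ᵣ-mono-≲ p q)

∣x*y∣≲ : ∀ {x y a b} → ∣ x ∣ᵣ ≲ a → ∣ y ∣ᵣ ≲ b → ∣ x *ᵣ y ∣ᵣ ≲ a *ᵣ b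
∣x*y∣≲ {x} {y} {a} {b} p q = ≲-resp-≃
  (pointwise-≃ λ n → sym (ℚ.∣p*q∣≡∣p∣*∣q∣ (seq x n) (seq y n))) ≃-refl
  (≲-trans (*ᵣ-monoˡ-≲ (pointwise-≲ λ n → ℚ.0≤∣p∣ (seq x n)) q)
    (≲-resp-≃ (*ᵣ-comm b ∣ x ∣ᵣ) (*ᵣ-comm b a)
      (*ᵣ-monoˡ-≲ (≲-trans (pointwise-≲ λ n → ℚ.0≤∣p∣ (seq y n)) q) p)))

<ᵣ⇒¬≲ : ∀ {x y} → x <ᵣ y → ¬ (y ≲ x)
<ᵣ⇒¬≲ {x} {y} (ε , 0<ε , x+ε<y) (wrap≲ y≲x) with Eventually-zip (λ n p q → ℚ.<-irrefl {seq y n} refl (ℚ.<-trans q p)) x+ε<y (y≲x ε 0<ε)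
... | N , absurd = absurd N ℕ.≤-refl

-- If x ≲ y fails, it fails for some ε, so y n + ε ≤ x n for arbitrarily late n. One such n beyond
-- the Cauchy moduli for ε / 2 forces y m < x m for all late m.
≲-total : ExcludedMiddle 0ℓ → ∀ x y → x ≲ y ⊎ y ≲ x
≲-total em x y with em {∀ ε → 0ℚ ℚ.< ε → Eventually (λ n → seq x n ℚ.< seq y n ℚ.+ ε)}
... | yes p = inj₁ (wrap≲ p)
... | no ¬p with em {∃[ ε ] (0ℚ ℚ.< ε × ¬ Eventually (λ n → seq x n ℚ.< seq y n ℚ.+ ε))}
...   | no ¬q = contradiction (λ ε 0<ε → dne ε 0<ε) ¬p
  where
  dne : ∀ ε → 0ℚ ℚ.< ε → Eventually (λ n → seq x n ℚ.< seq y n ℚ.+ ε)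
  dne ε 0<ε with em {Eventually (λ n → seq x n ℚ.< seq y n ℚ.+ ε)}
  ... | yes e = e
  ... | no ¬e = contradiction (ε , 0<ε , ¬e) ¬q
...   | yes (ε , 0<ε , ¬e) = inj₂ (wrap≲ λ ε′ 0<ε′ → Eventually-map (λ n lt → ℚ.<-trans lt (p<p+ε (seq x n) 0<ε′)) y<x)
  where
  open +-*-Solver
  δ : ℚ
  δ = ½ ℚ.* ε
  Nx = proj₁ (cauchy x δ (half-pos 0<ε))
  Ny = proj₁ (cauchy y δ (half-pos 0<ε))
  N = Nx ℕ.⊔ Ny
  y<x : Eventually (λ n → seq y n ℚ.< seq x n)
  y<x with em {∃[ n ] (N ℕ.≤ n × seq y n ℚ.+ ε ℚ.≤ seq x n)}
  ... | no ¬n = contradiction (N , λ n N≤n → ℚ.≰⇒> (λ le → ¬n (n , N≤n , le))) ¬e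
  ... | yes (n , N≤n , y+ε≤x) = N , λ m N≤m → below (seq x m) (seq x n) (seq y m) (seq y n) y+ε≤x
    (proj₂ (cauchy x δ (half-pos 0<ε)) m n (ℕ.m⊔n≤o⇒m≤o Nx Ny N≤m) (ℕ.m⊔n≤o⇒m≤o Nx Ny N≤n))
    (proj₂ (cauchy y δ (half-pos 0<ε)) m n (ℕ.m⊔n≤o⇒n≤o Nx Ny N≤m) (ℕ.m⊔n≤o⇒n≤o Nx Ny N≤n))
    where
    below : ∀ a a′ b b′ → b′ ℚ.+ ε ℚ.≤ a′ → ℚ.∣ a ℚ.- a′ ∣ ℚ.< δ → ℚ.∣ b ℚ.- b′ ∣ ℚ.< δ → b ℚ.< a
    below a a′ b b′ b′+ε≤a′ a-a′<δ b-b′<δ = begin-strict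
      b                      ≡⟨ solve 2 (λ b δ → b := b :+ δ :- δ) refl b δ ⟩
      b ℚ.+ δ ℚ.- δ          <⟨ ℚ.+-monoˡ-< (ℚ.- δ) (ℚ.+-monoˡ-< δ (∣p-q∣<⇒p<q+ b b′ b-b′<δ)) ⟩
      b′ ℚ.+ δ ℚ.+ δ ℚ.- δ   ≡⟨ cong (ℚ._- δ) (trans (ℚ.+-assoc b′ δ δ) (cong (b′ ℚ.+_) (halves ε))) ⟩
      b′ ℚ.+ ε ℚ.- δ         ≤⟨ ℚ.+-monoˡ-≤ (ℚ.- δ) b′+ε≤a′ ⟩
      a′ ℚ.- δ               <⟨ ℚ.+-monoˡ-< (ℚ.- δ) (∣p-q∣<⇒q<p+ a a′ a-a′<δ) ⟩
      a ℚ.+ δ ℚ.- δ          ≡⟨ solve 2 (λ a δ → a :+ δ :- δ := a) refl a δ ⟩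
      a                      ∎
      where open ℚ.≤-Reasoning

-- The embedding of the integers

toℚᵘ-/1 : ∀ a → ℚ.toℚᵘ (a / 1) ℚᵘ.≃ ℚᵘ.mkℚᵘ a 0
toℚᵘ-/1 a = ℚ.toℚᵘ-fromℚᵘ (ℚᵘ.mkℚᵘ a 0)

/1-homo-+ : ∀ a b → (a ℤ.+ b) / 1 ≡ a / 1 ℚ.+ b / 1
/1-homo-+ a b = ℚ.toℚᵘ-injective (begin
  ℚ.toℚᵘ ((a ℤ.+ b) / 1)              ≈⟨ toℚᵘ-/1 (a ℤ.+ b) ⟩
  ℚᵘ.mkℚᵘ (a ℤ.+ b) 0                  ≈⟨ ℚᵘ.*≡* (cong (ℤ._* + 1) (cong₂ ℤ._+_ (sym (ℤ.*-identityʳ a)) (sym (ℤ.*-identityʳ b)))) ⟩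
  ℚᵘ.mkℚᵘ a 0 ℚᵘ.+ ℚᵘ.mkℚᵘ b 0        ≈⟨ ℚᵘ.+-cong (ℚᵘ.≃-sym (toℚᵘ-/1 a)) (ℚᵘ.≃-sym (toℚᵘ-/1 b)) ⟩
  ℚ.toℚᵘ (a / 1) ℚᵘ.+ ℚ.toℚᵘ (b / 1)  ≈⟨ ℚᵘ.≃-sym (ℚ.toℚᵘ-homo-+ (a / 1) (b / 1)) ⟩
  ℚ.toℚᵘ (a / 1 ℚ.+ b / 1)            ∎)
  where open ℚᵘ.≃-Reasoning

/1-homo-* : ∀ a b → (a ℤ.* b) / 1 ≡ a / 1 ℚ.* (b / 1)
/1-homo-* a b = ℚ.toℚᵘ-injective (begin
  ℚ.toℚᵘ ((a ℤ.* b) / 1)                ≈⟨ toℚᵘ-/1 (a ℤ.* b) ⟩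
  ℚᵘ.mkℚᵘ a 0 ℚᵘ.* ℚᵘ.mkℚᵘ b 0          ≈⟨ ℚᵘ.*-cong (ℚᵘ.≃-sym (toℚᵘ-/1 a)) (ℚᵘ.≃-sym (toℚᵘ-/1 b)) ⟩
  ℚ.toℚᵘ (a / 1) ℚᵘ.* ℚ.toℚᵘ (b / 1)    ≈⟨ ℚᵘ.≃-sym (ℚ.toℚᵘ-homo-* (a / 1) (b / 1)) ⟩
  ℚ.toℚᵘ (a / 1 ℚ.* (b / 1))            ∎)
  where open ℚᵘ.≃-Reasoning

/1-homo-neg : ∀ a → (ℤ.- a) / 1 ≡ ℚ.- (a / 1)
/1-homo-neg a = ℚ.toℚᵘ-injective (begin
  ℚ.toℚᵘ ((ℤ.- a) / 1)    ≈⟨ toℚᵘ-/1 (ℤ.- a) ⟩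
  ℚᵘ.- ℚᵘ.mkℚᵘ a 0        ≈⟨ ℚᵘ.-‿cong (ℚᵘ.≃-sym (toℚᵘ-/1 a)) ⟩
  ℚᵘ.- ℚ.toℚᵘ (a / 1)     ≈⟨ ℚᵘ.≃-sym (ℚ.toℚᵘ-homo‿- (a / 1)) ⟩
  ℚ.toℚᵘ (ℚ.- (a / 1))    ∎)
  where open ℚᵘ.≃-Reasoning

/1-mono-≤ : ∀ {a b} → a ℤ.≤ b → a / 1 ℚ.≤ b / 1
/1-mono-≤ {a} {b} a≤b = ℚ.toℚᵘ-cancel-≤ (ℚᵘ.≤-respˡ-≃ (ℚᵘ.≃-sym (toℚᵘ-/1 a))
  (ℚᵘ.≤-respʳ-≃ (ℚᵘ.≃-sym (toℚᵘ-/1 b)) (ℚᵘ.*≤* (ℤ.*-monoʳ-≤-nonNeg (+ 1) a≤b))))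

/1-injective : ∀ {a b} → a / 1 ≡ b / 1 → a ≡ b
/1-injective {a} {b} eq with ℚᵘ.≃-trans (ℚᵘ.≃-sym (toℚᵘ-/1 a)) (ℚᵘ.≃-trans (ℚᵘ.≃-reflexive (cong ℚ.toℚᵘ eq)) (toℚᵘ-/1 b))
... | ℚᵘ.*≡* p = trans (sym (ℤ.*-identityʳ a)) (trans p (ℤ.*-identityʳ b))

∣/1∣ : ∀ a → ℚ.∣ a / 1 ∣ ≡ + ℤ.∣ a ∣ / 1
∣/1∣ a = ℚ.toℚᵘ-injective (ℚᵘ.≃-trans (ℚ.toℚᵘ-homo-∣-∣ (a / 1))
  (ℚᵘ.≃-trans (ℚᵘ.∣-∣-cong (toℚᵘ-/1 a)) (ℚᵘ.≃-sym (toℚᵘ-/1 (+ ℤ.∣ a ∣)))))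

p-q≡0⇒p≡q : ∀ p q → p ℚ.- q ≡ 0ℚ → p ≡ q
p-q≡0⇒p≡q p q eq = trans (solve 2 (λ p q → p := p :- q :+ q) refl p q)
  (trans (cong (ℚ._+ q) eq) (ℚ.+-identityˡ q))
  where open +-*-Solver

≢⇒0<∣p-q∣ : ∀ p q → p ≢ q → 0ℚ ℚ.< ℚ.∣ p ℚ.- q ∣
≢⇒0<∣p-q∣ p q p≢q = ℚ.≰⇒> λ le → p≢q (p-q≡0⇒p≡q p q
  (ℚ.∣p∣≡0⇒p≡0 (p ℚ.- q) (ℚ.≤-antisym le (ℚ.0≤∣p∣ (p ℚ.- q)))))

fromℚ-injective : ∀ {p q} → fromℚ p ≃ fromℚ q → p ≡ q
fromℚ-injective {p} {q} eq with p ℚ.≟ q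
... | yes p≡q = p≡q
... | no p≢q = contradiction (proj₂ small (proj₁ small) ℕ.≤-refl) (ℚ.<-irrefl refl)
  where
  small : Eventually (λ _ → ℚ.∣ p ℚ.- q ∣ ℚ.< ℚ.∣ p ℚ.- q ∣)
  small = unwrap≃ eq ℚ.∣ p ℚ.- q ∣ (≢⇒0<∣p-q∣ p q p≢q)

fromℤ-injective : ∀ {a b} → fromℤ a ≃ fromℤ b → a ≡ b
fromℤ-injective eq = /1-injective (fromℚ-injective eq)

⌊_⌋ : ℚ → ℤ
⌊ p ⌋ = ℚ.↥ p ℤ./ℕ ℚ.↧ₙ p

⌊p⌋≤p : ∀ p → ⌊ p ⌋ / 1 ℚ.≤ p
⌊p⌋≤p p@(ℚ.mkℚ a d-1 _) = ℚ.toℚᵘ-cancel-≤ (ℚᵘ.≤-respˡ-≃ (ℚᵘ.≃-sym (toℚᵘ-/1 ⌊ p ⌋))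
  (ℚᵘ.*≤* (subst (⌊ p ⌋ ℤ.* + suc d-1 ℤ.≤_) (sym (ℤ.*-identityʳ a)) (ℤ.[n/ℕd]*d≤n a (suc d-1)))))

p≤⌊p⌋+1 : ∀ p → p ℚ.≤ (⌊ p ⌋ ℤ.+ + 1) / 1
p≤⌊p⌋+1 p@(ℚ.mkℚ a d-1 _) = ℚ.toℚᵘ-cancel-≤ (ℚᵘ.≤-respʳ-≃ (ℚᵘ.≃-sym (toℚᵘ-/1 (⌊ p ⌋ ℤ.+ + 1)))
  (ℚᵘ.*≤* (subst₂ ℤ._≤_ (sym (ℤ.*-identityʳ a)) (cong (ℤ._* + suc d-1) (ℤ.+-comm (+ 1) ⌊ p ⌋))
    (ℤ.<⇒≤ (ℤ.n<s[n/ℕd]*d a (suc d-1))))))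

-- A late term of the sequence is within ½ of x, so with m its floor, x lies between m - ½ and m + 1
-- + ½. Comparing x with m + ½ then decides between m and m + 1.
nearest-integer : ExcludedMiddle 0ℓ → ∀ x → ∃[ m ] ∣ x +ᵣ -ᵣ fromℤ m ∣ᵣ ≲ fromℚ ½
nearest-integer em x with cauchy x ½ (ℚ.positive⁻¹ ½)
... | N , h = choose (≲-total em x (fromℚ (q ℚ.+ ½)))
  where
  open +-*-Solver
  m = ⌊ seq x N ⌋
  q = m / 1
  ≤-shift : ∀ {a b} c {d} → a ℚ.≤ b → b ℚ.- c ≡ d → a ℚ.- c ℚ.≤ d
  ≤-shift c a≤b refl = ℚ.+-monoˡ-≤ (ℚ.- c) a≤b
  lower : fromℚ (q ℚ.- ½) ≲ x
  lower = wrap≲ λ ε 0<ε → N , λ n N≤n → ℚ.≤-<-trans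
    (≤-shift ½ (ℚ.≤-trans (⌊p⌋≤p (seq x N)) (ℚ.<⇒≤ (∣p-q∣<⇒p<q+ (seq x N) (seq x n) (h N n ℕ.≤-refl N≤n))))
      (solve 2 (λ a b → a :+ b :- b := a) refl (seq x n) ½))
    (p<p+ε (seq x n) 0<ε)
  upper : x ≲ fromℚ ((m ℤ.+ + 1) / 1 ℚ.+ ½)
  upper = wrap≲ λ ε 0<ε → N , λ n N≤n → ℚ.<-trans (∣p-q∣<⇒p<q+ (seq x n) (seq x N) (h n N N≤n ℕ.≤-refl))
    (ℚ.≤-<-trans (ℚ.+-monoˡ-≤ ½ (p≤⌊p⌋+1 (seq x N))) (p<p+ε _ 0<ε))
  near : ∀ r → fromℚ (r ℚ.- ½) ≲ x → x ≲ fromℚ (r ℚ.+ ½) → ∣ x +ᵣ -ᵣ fromℚ r ∣ᵣ ≲ fromℚ ½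
  near r lo hi = ∣x∣≲
    (≲-resp-≃ ≃-refl (pointwise-≃ λ n → solve 2 (λ r h → r :+ h :- r := h) refl r ½)
      (+ᵣ-mono-≲ hi (≃⇒≲ (≃-refl { -ᵣ fromℚ r}))))
    (0≲-⇒≲ (≲-resp-≃ ≃-refl (pointwise-≃ λ n → solve 3 (λ r x h → x :- (r :- h) := h :- (:- (x :- r))) refl r (seq x n) ½)
      (≲⇒0≲- lo)))
  choose : x ≲ fromℚ (q ℚ.+ ½) ⊎ fromℚ (q ℚ.+ ½) ≲ x → ∃[ m ] ∣ x +ᵣ -ᵣ fromℤ m ∣ᵣ ≲ fromℚ ½
  choose (inj₁ le) = m , near q lower le
  choose (inj₂ ge) = m ℤ.+ + 1 , near ((m ℤ.+ + 1) / 1)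
    (≲-resp-≃ (pointwise-≃ λ _ → sym (trans (cong (ℚ._- ½) (/1-homo-+ m (+ 1)))
      (solve 1 (λ q → q :+ con 1ℚ :- con ½ := q :+ con ½) refl q))) ≃-refl ge)
    upper

-- Dot products with integer vectors

δ : ∀ {n} → Fin n → ℤ^ n
δ zero    zero    = 1ℤ
δ zero    (suc _) = 0ℤ
δ (suc _) zero    = 0ℤ
δ (suc i) (suc j) = δ i j

δ-sym : ∀ {n} (i j : Fin n) → δ i j ≡ δ j i
δ-sym zero    zero    = refl
δ-sym zero    (suc _) = refl
δ-sym (suc _) zero    = refl
δ-sym (suc i) (suc j) = δ-sym i j

-- The factor `δ l k` replaces a case distinction on whether l is k, so that `dot-merge` follows
-- from linearity.
merge : ∀ {n d} → Vector (ℤ^ d) (suc n) → Fin (suc n) → Fin n → ℤ → Vector (ℤ^ d) n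
merge u j k a l r = u (punchIn j l) r ℤ.+ a ℤ.* u j r ℤ.* δ l k

-- One development serves for R = ℤ (dependences, dual forms) and R = ℝ (coefficients); the right
-- argument of `dot` is an integer vector in both. `combℝ c u k` unfolds to the real dot product of
-- c with the k-th coordinates of u.
module LinearForms (R : CommutativeRing 0ℓ 0ℓ) (ι : ℤ → CommutativeRing.Carrier R)
  (ι-hom : IsRingHomomorphism ℤ.+-*-rawRing (CommutativeRing.rawRing R) ι) where

  private
    module R = CommutativeRing R
    module ι = IsRingHomomorphism ι-hom
  open R using (Carrier; _≈_; _+_; _*_; -_; 0#; 1#; setoid)
  open SemiringSum R.semiring using (sum; sum-cong-≋; ∑-distrib-+; ∑-comm; sum-remove;
    sum-replicate-zero; *-distribˡ-sum; *-distribʳ-sum)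
  open SetoidReasoning setoid

  dot : ∀ {n} → Vector Carrier n → ℤ^ n → Carrier
  dot x t = sum (λ i → x i * ι (t i))

  dot-cong : ∀ {n} {x y : Vector Carrier n} {s t : ℤ^ n} →
    (∀ i → x i ≈ y i) → s ≗ t → dot x s ≈ dot y t
  dot-cong x≈y s≗t = sum-cong-≋ λ i → R.*-cong (x≈y i) (R.reflexive (cong ι (s≗t i)))

  dot-congˡ : ∀ {n} {x y : Vector Carrier n} (t : ℤ^ n) → (∀ i → x i ≈ y i) → dot x t ≈ dot y t
  dot-congˡ t x≈y = dot-cong {t = t} x≈y λ _ → refl

  dot-congʳ : ∀ {n} (x : Vector Carrier n) {s t : ℤ^ n} → s ≗ t → dot x s ≈ dot x t
  dot-congʳ x = dot-cong {x = x} λ _ → R.refl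

  sum-zero : ∀ {n} {f : Vector Carrier n} → (∀ i → f i ≈ 0#) → sum f ≈ 0#
  sum-zero {n} f≈0 = R.trans (sum-cong-≋ f≈0) (sum-replicate-zero n)

  dot-zeroˡ : ∀ {n} {x : Vector Carrier n} (t : ℤ^ n) → (∀ i → x i ≈ 0#) → dot x t ≈ 0#
  dot-zeroˡ t x≈0 = sum-zero λ i → R.trans (R.*-congʳ (x≈0 i)) (R.zeroˡ (ι (t i)))

  dot-zeroʳ : ∀ {n} (x : Vector Carrier n) {t : ℤ^ n} → (∀ i → t i ≡ 0ℤ) → dot x t ≈ 0#
  dot-zeroʳ x t≡0 = sum-zero λ i →
    R.trans (R.*-congˡ (R.trans (R.reflexive (cong ι (t≡0 i))) ι.0#-homo)) (R.zeroʳ (x i))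

  dot-+ˡ : ∀ {n} (x y : Vector Carrier n) (t : ℤ^ n) → dot (λ i → x i + y i) t ≈ dot x t + dot y t
  dot-+ˡ x y t = R.trans (sum-cong-≋ λ i → R.distribʳ (ι (t i)) (x i) (y i))
    (∑-distrib-+ (λ i → x i * ι (t i)) (λ i → y i * ι (t i)))

  dot-*ˡ : ∀ {n} a (x : Vector Carrier n) (t : ℤ^ n) → dot (λ i → a * x i) t ≈ a * dot x t
  dot-*ˡ a x t = R.trans (sum-cong-≋ λ i → R.*-assoc a (x i) (ι (t i)))
    (R.sym (*-distribˡ-sum a (λ i → x i * ι (t i))))

  dot-negˡ : ∀ {n} (x : Vector Carrier n) (t : ℤ^ n) → dot (λ i → - x i) t ≈ - dot x t
  dot-negˡ x t = begin
    dot (λ i → - x i) t                        ≈⟨ R.+-identityʳ (dot (λ i → - x i) t) ⟨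
    dot (λ i → - x i) t + 0#                   ≈⟨ R.+-congˡ (R.-‿inverseʳ (dot x t)) ⟨
    dot (λ i → - x i) t + (dot x t + - dot x t) ≈⟨ R.+-assoc (dot (λ i → - x i) t) (dot x t) (- dot x t) ⟨
    dot (λ i → - x i) t + dot x t + - dot x t  ≈⟨ R.+-congʳ (dot-+ˡ (λ i → - x i) x t) ⟨
    dot (λ i → - x i + x i) t + - dot x t      ≈⟨ R.+-congʳ (dot-zeroˡ t λ i → R.-‿inverseˡ (x i)) ⟩
    0# + - dot x t                             ≈⟨ R.+-identityˡ (- dot x t) ⟩
    - dot x t                                  ∎

  dot-+ʳ : ∀ {n} (x : Vector Carrier n) (s t : ℤ^ n) → dot x (λ i → s i ℤ.+ t i) ≈ dot x s + dot x t
  dot-+ʳ x s t = R.trans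
    (sum-cong-≋ λ i → R.trans (R.*-congˡ (ι.+-homo (s i) (t i))) (R.distribˡ (x i) (ι (s i)) (ι (t i))))
    (∑-distrib-+ (λ i → x i * ι (s i)) (λ i → x i * ι (t i)))

  dot-*ʳ : ∀ {n} (x : Vector Carrier n) a (t : ℤ^ n) → dot x (λ i → a ℤ.* t i) ≈ ι a * dot x t
  dot-*ʳ x a t = R.trans (sum-cong-≋ λ i → begin
      x i * ι (a ℤ.* t i)     ≈⟨ R.*-congˡ (ι.*-homo a (t i)) ⟩
      x i * (ι a * ι (t i))   ≈⟨ R.*-assoc _ _ _ ⟨
      x i * ι a * ι (t i)     ≈⟨ R.*-congʳ (R.*-comm (x i) (ι a)) ⟩
      ι a * x i * ι (t i)     ≈⟨ R.*-assoc _ _ _ ⟩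
      ι a * (x i * ι (t i))   ∎)
    (R.sym (*-distribˡ-sum (ι a) (λ i → x i * ι (t i))))

  dot-δ : ∀ {n} (x : Vector Carrier n) k → dot x (λ i → δ i k) ≈ x k
  dot-δ {suc n} x zero = begin
    x zero * ι 1ℤ + dot (x ∘ suc) (λ _ → 0ℤ)  ≈⟨ R.+-cong (R.*-congˡ ι.1#-homo) (dot-zeroʳ (x ∘ suc) λ _ → refl) ⟩
    x zero * 1# + 0#                          ≈⟨ R.+-identityʳ _ ⟩
    x zero * 1#                               ≈⟨ R.*-identityʳ _ ⟩
    x zero                                    ∎
  dot-δ {suc n} x (suc k) = begin
    x zero * ι 0ℤ + dot (x ∘ suc) (λ i → δ i k)  ≈⟨ R.+-cong (R.*-congˡ ι.0#-homo) (dot-δ (x ∘ suc) k) ⟩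
    x zero * 0# + x (suc k)                      ≈⟨ R.+-congʳ (R.zeroʳ _) ⟩
    0# + x (suc k)                               ≈⟨ R.+-identityˡ _ ⟩
    x (suc k)                                    ∎

  dot-removeAt : ∀ {n} (x : Vector Carrier (suc n)) t i →
    dot x t ≈ x i * ι (t i) + dot (removeAt x i) (removeAt t i)
  dot-removeAt x t i = sum-remove {i = i} (λ i → x i * ι (t i))

  dot-insertAt : ∀ {n} (x : Vector Carrier n) j a (t : ℤ^ (suc n)) →
    dot (insertAt x j a) t ≈ a * ι (t j) + dot x (removeAt t j)
  dot-insertAt x j a t = R.trans (dot-removeAt (insertAt x j a) t j) (R.+-cong
    (R.*-congʳ (R.reflexive (Vector.insertAt-lookup x j a)))
    (dot-congˡ (removeAt t j) λ i → R.reflexive (Vector.removeAt-insertAt x j a i)))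

  dot-merge : ∀ {n d} (u : Vector (ℤ^ d) (suc n)) j k a (x : Vector Carrier n) r →
    dot x (λ l → merge u j k a l r) ≈ dot (insertAt x j (ι a * x k)) (λ i → u i r)
  dot-merge u j k a x r = begin
    dot x (λ l → u (punchIn j l) r ℤ.+ a ℤ.* u j r ℤ.* δ l k)
      ≈⟨ dot-+ʳ x (λ l → u (punchIn j l) r) (λ l → a ℤ.* u j r ℤ.* δ l k) ⟩
    dot x (λ l → u (punchIn j l) r) + dot x (λ l → a ℤ.* u j r ℤ.* δ l k)
      ≈⟨ R.+-comm _ _ ⟩
    dot x (λ l → a ℤ.* u j r ℤ.* δ l k) + dot x (λ l → u (punchIn j l) r)
      ≈⟨ R.+-congʳ (R.trans (dot-*ʳ x (a ℤ.* u j r) (λ l → δ l k)) (R.*-congˡ (dot-δ x k))) ⟩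
    ι (a ℤ.* u j r) * x k + dot x (λ l → u (punchIn j l) r)
      ≈⟨ R.+-congʳ (R.trans (R.*-congʳ (ι.*-homo a (u j r))) (R.trans (R.*-assoc (ι a) (ι (u j r)) (x k))
           (R.trans (R.*-congˡ (R.*-comm (ι (u j r)) (x k))) (R.sym (R.*-assoc (ι a) (x k) (ι (u j r))))))) ⟩
    ι a * x k * ι (u j r) + dot x (λ l → u (punchIn j l) r)
      ≈⟨ dot-insertAt x j (ι a * x k) (λ i → u i r) ⟨
    dot (insertAt x j (ι a * x k)) (λ i → u i r) ∎

  ι-sum : ∀ {n} (a : ℤ^ n) → ι (SemiringSum.sum ℤ.+-*-semiring a) ≈ sum (ι ∘ a)
  ι-sum {zero}  a = ι.0#-homo
  ι-sum {suc n} a = R.trans (ι.+-homo (a zero) (SemiringSum.sum ℤ.+-*-semiring (a ∘ suc))) (R.+-congˡ (ι-sum (a ∘ suc)))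

  dot-ι : ∀ {n} (a t : ℤ^ n) → ι (SemiringSum.sum ℤ.+-*-semiring (λ i → a i ℤ.* t i)) ≈ dot (ι ∘ a) t
  dot-ι a t = R.trans (ι-sum (λ i → a i ℤ.* t i)) (sum-cong-≋ λ i → ι.*-homo (a i) (t i))

  -- Associativity of the product x U t. With it dependences and forms are carried through changes
  -- of basis.
  dot-dot : ∀ {m n} (x : Vector Carrier n) (U : Vector (ℤ^ m) n) (t : ℤ^ m) →
    dot (λ j → dot x (λ i → U i j)) t ≈ dot x (λ i → SemiringSum.sum ℤ.+-*-semiring (λ j → U i j ℤ.* t j))
  dot-dot {m} {n} x U t = begin
    sum (λ j → sum (λ i → x i * ι (U i j)) * ι (t j))
      ≈⟨ sum-cong-≋ (λ j → *-distribʳ-sum (ι (t j)) (λ i → x i * ι (U i j))) ⟩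
    sum (λ j → sum (λ i → x i * ι (U i j) * ι (t j)))
      ≈⟨ ∑-comm (λ j i → x i * ι (U i j) * ι (t j)) ⟩
    sum (λ i → sum (λ j → x i * ι (U i j) * ι (t j)))
      ≈⟨ sum-cong-≋ (λ i → sum-cong-≋ λ j →
           R.trans (R.*-assoc (x i) (ι (U i j)) (ι (t j))) (R.*-congˡ (R.sym (ι.*-homo (U i j) (t j))))) ⟩
    sum (λ i → sum (λ j → x i * ι (U i j ℤ.* t j)))
      ≈⟨ sum-cong-≋ (λ i → *-distribˡ-sum (x i) (λ j → ι (U i j ℤ.* t j))) ⟨
    sum (λ i → x i * sum (λ j → ι (U i j ℤ.* t j)))
      ≈⟨ sum-cong-≋ (λ i → R.*-congˡ (ι-sum (λ j → U i j ℤ.* t j))) ⟨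
    dot x (λ i → SemiringSum.sum ℤ.+-*-semiring (λ j → U i j ℤ.* t j)) ∎

module ℤᴸ = LinearForms ℤ.+-*-commutativeRing id (Identity.isRingHomomorphism ℤ.+-*-rawRing refl)
open ℤᴸ public using () renaming (dot to infix 8 _•_)

fromℤ-isRingHomomorphism : IsRingHomomorphism ℤ.+-*-rawRing (CommutativeRing.rawRing ℝ-commutativeRing) fromℤ
fromℤ-isRingHomomorphism = record
  { isSemiringHomomorphism = record
    { isNearSemiringHomomorphism = record
      { +-isMonoidHomomorphism = record
        { isMagmaHomomorphism = record
          { isRelHomomorphism = record { cong = λ { refl → ≃-refl } }
          ; homo = λ a b → pointwise-≃ λ _ → /1-homo-+ a b }
        ; ε-homo = ≃-refl }
      ; *-homo = λ a b → pointwise-≃ λ _ → /1-homo-* a b }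
    ; 1#-homo = ≃-refl }
  ; -‿homo = λ a → pointwise-≃ λ _ → /1-homo-neg a }

module ℝᴸ = LinearForms ℝ-commutativeRing fromℤ fromℤ-isRingHomomorphism

•-comm : ∀ {n} (x y : ℤ^ n) → x • y ≡ y • x
•-comm x y = SemiringSum.sum-cong-≋ ℤ.+-*-semiring λ i → ℤ.*-comm (x i) (y i)

-- Splitting off an integer direction

-- Euclid's algorithm, returning cofactors instead of divisibility: (α, β) is then a primitive
-- vector even for x = y = 0, where g = 0.
bezout : ∀ x y → ∃[ g ] ∃[ α ] ∃[ β ] ∃[ a ] ∃[ b ]
  (x ≡ g ℤ.* α × y ≡ g ℤ.* β × a ℤ.* α ℤ.+ b ℤ.* β ≡ 1ℤ)
bezout x y = go x y (<-wellFounded ℤ.∣ y ∣)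
  where
  open ℤSolver.+-*-Solver
  go : ∀ x y → Acc ℕ._<_ ℤ.∣ y ∣ → ∃[ g ] ∃[ α ] ∃[ β ] ∃[ a ] ∃[ b ]
    (x ≡ g ℤ.* α × y ≡ g ℤ.* β × a ℤ.* α ℤ.+ b ℤ.* β ≡ 1ℤ)
  go x y (acc rec) with y ℤ.≟ 0ℤ
  ... | yes refl = x , 1ℤ , 0ℤ , 1ℤ , 0ℤ , sym (ℤ.*-identityʳ x) , sym (ℤ.*-zeroʳ x) , refl
  ... | no y≢0 with go y (+ (x ℤ.% y)) (rec (ℤ.n%d<d x y))
    where instance _ = ℤ.≢-nonZero y≢0
  ... | g , α , β , a , b , y≡gα , r≡gβ , eq =
    g , β ℤ.+ q ℤ.* α , α , b , a ℤ.- b ℤ.* q , x≡ , y≡gα ,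
    trans (solve 5 (λ α β a b q → b :* (β :+ q :* α) :+ (a :- b :* q) :* α := a :* α :+ b :* β) refl α β a b q) eq
    where
    instance _ = ℤ.≢-nonZero y≢0
    q = x ℤ./ y
    x≡ : x ≡ g ℤ.* (β ℤ.+ q ℤ.* α)
    x≡ = trans (ℤ.a≡a%n+[a/n]*n x y) (trans (cong₂ (λ r y → r ℤ.+ q ℤ.* y) r≡gβ y≡gα)
      (solve 4 (λ g α β q → g :* β :+ q :* (g :* α) := g :* (β :+ q :* α)) refl g α β q))

-- A basis of ℤ^(1+m) starting with e, a primitive vector on the line of w,
-- and its dual basis, which starts with φ: P are the remaining coordinates
-- and S the remaining basis vectors.
record Splitting {m} (w : ℤ^ (suc m)) : Set where
  field
    g      : ℤ
    e φ    : ℤ^ (suc m)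
    P      : Vector (ℤ^ m) (suc m)
    S      : Vector (ℤ^ (suc m)) m
    w≡ge   : ∀ k → w k ≡ g ℤ.* e k
    φe+SP  : ∀ i k → φ i ℤ.* e k ℤ.+ P i • (λ j → S j k) ≡ δ i k
    PS     : ∀ j l → S j • (λ k → P k l) ≡ δ j l
    φS     : ∀ j → S j • φ ≡ 0ℤ
    Pe     : ∀ l → e • (λ k → P k l) ≡ 0ℤ
    φe     : e • φ ≡ 1ℤ

-- Induction on the dimension: the tail of w is g′ e, so w lies in the plane of the new unit vector
-- and e, where it has coordinates (w₀, g′) = g (α, β). The matrix with rows (α, β) and (-b, a) has
-- determinant 1 by Bézout; its rows give the new e and one new basis vector, its inverse gives the
-- new φ and the new column of P. The other basis vectors are padded by 0.
splitting : ∀ {m} (w : ℤ^ (suc m)) → Splitting w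
splitting {zero} w = record
  { g = w zero ; e = λ _ → 1ℤ ; φ = λ _ → 1ℤ ; P = λ _ () ; S = λ ()
  ; w≡ge = λ { zero → sym (ℤ.*-identityʳ (w zero)) }
  ; φe+SP = λ { zero zero → refl }
  ; PS = λ () ; φS = λ () ; Pe = λ () ; φe = refl }
splitting {suc m} w with splitting (w ∘ suc)
... | record { g = g′ ; e = e ; φ = φ ; P = P ; S = S ; w≡ge = w≡ge ; φe+SP = φe+SP
             ; PS = PS ; φS = φS ; Pe = Pe ; φe = φe } with bezout (w zero) g′
...   | g , α , β , a , b , w₀≡gα , g′≡gβ , aα+bβ≡1 = record
  { g = g ; e = e⁺ ; φ = φ⁺ ; P = P⁺ ; S = S⁺
  ; w≡ge = λ
    { zero → w₀≡gα
    ; (suc k) → trans (w≡ge k) (trans (cong (ℤ._* e k) g′≡gβ) (ℤ.*-assoc g β (e k))) }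
  ; φe+SP = φe+SP⁺ ; PS = PS⁺ ; φS = φS⁺ ; Pe = Pe⁺ ; φe = φe⁺ }
  where
  open ℤSolver.+-*-Solver
  open ≡-Reasoning
  e⁺ φ⁺ : ℤ^ (suc (suc m))
  e⁺ zero    = α
  e⁺ (suc k) = β ℤ.* e k
  φ⁺ zero    = a
  φ⁺ (suc k) = b ℤ.* φ k
  P⁺ : Vector (ℤ^ (suc m)) (suc (suc m))
  P⁺ zero    zero    = ℤ.- β
  P⁺ zero    (suc l) = 0ℤ
  P⁺ (suc i) zero    = α ℤ.* φ i
  P⁺ (suc i) (suc l) = P i l
  S⁺ : Vector (ℤ^ (suc (suc m))) (suc m)
  S⁺ zero    zero    = ℤ.- b
  S⁺ zero    (suc k) = a ℤ.* e k
  S⁺ (suc j) zero    = 0ℤ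
  S⁺ (suc j) (suc k) = S j k

  scaled : ∀ a b {k} (x y : ℤ^ k) → (λ i → a ℤ.* x i) • (λ i → b ℤ.* y i) ≡ a ℤ.* b ℤ.* (x • y)
  scaled a b x y = begin
    (λ i → a ℤ.* x i) • (λ i → b ℤ.* y i)  ≡⟨ ℤᴸ.dot-*ˡ a x (λ i → b ℤ.* y i) ⟩
    a ℤ.* (x • (λ i → b ℤ.* y i))          ≡⟨ cong (a ℤ.*_) (ℤᴸ.dot-*ʳ x b y) ⟩
    a ℤ.* (b ℤ.* (x • y))                  ≡⟨ ℤ.*-assoc a b (x • y) ⟨
    a ℤ.* b ℤ.* (x • y)                    ∎

  φe+SP⁺ : ∀ i k → φ⁺ i ℤ.* e⁺ k ℤ.+ P⁺ i • (λ j → S⁺ j k) ≡ δ i k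
  φe+SP⁺ zero zero = begin
    a ℤ.* α ℤ.+ (ℤ.- β ℤ.* ℤ.- b ℤ.+ _•_ {m} (λ _ → 0ℤ) (λ _ → 0ℤ))
      ≡⟨ cong (λ z → a ℤ.* α ℤ.+ (ℤ.- β ℤ.* ℤ.- b ℤ.+ z)) (ℤᴸ.dot-zeroˡ {m} {λ _ → 0ℤ} (λ _ → 0ℤ) (λ _ → refl)) ⟩
    a ℤ.* α ℤ.+ (ℤ.- β ℤ.* ℤ.- b ℤ.+ 0ℤ)
      ≡⟨ solve 4 (λ a b α β → a :* α :+ (:- β :* :- b :+ con 0ℤ) := a :* α :+ b :* β) refl a b α β ⟩
    a ℤ.* α ℤ.+ b ℤ.* β
      ≡⟨ aα+bβ≡1 ⟩
    1ℤ ∎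
  φe+SP⁺ zero (suc k) = begin
    a ℤ.* (β ℤ.* e k) ℤ.+ (ℤ.- β ℤ.* (a ℤ.* e k) ℤ.+ (λ _ → 0ℤ) • (λ j → S j k))
      ≡⟨ cong (λ z → a ℤ.* (β ℤ.* e k) ℤ.+ (ℤ.- β ℤ.* (a ℤ.* e k) ℤ.+ z)) (ℤᴸ.dot-zeroˡ {x = λ _ → 0ℤ} (λ j → S j k) (λ _ → refl)) ⟩
    a ℤ.* (β ℤ.* e k) ℤ.+ (ℤ.- β ℤ.* (a ℤ.* e k) ℤ.+ 0ℤ)
      ≡⟨ solve 3 (λ a β e → a :* (β :* e) :+ (:- β :* (a :* e) :+ con 0ℤ) := con 0ℤ) refl a β (e k) ⟩
    0ℤ ∎
  φe+SP⁺ (suc i) zero = begin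
    b ℤ.* φ i ℤ.* α ℤ.+ (α ℤ.* φ i ℤ.* ℤ.- b ℤ.+ P i • (λ _ → 0ℤ))
      ≡⟨ cong (λ z → b ℤ.* φ i ℤ.* α ℤ.+ (α ℤ.* φ i ℤ.* ℤ.- b ℤ.+ z)) (ℤᴸ.dot-zeroʳ (P i) (λ _ → refl)) ⟩
    b ℤ.* φ i ℤ.* α ℤ.+ (α ℤ.* φ i ℤ.* ℤ.- b ℤ.+ 0ℤ)
      ≡⟨ solve 3 (λ b α f → b :* f :* α :+ (α :* f :* :- b :+ con 0ℤ) := con 0ℤ) refl b α (φ i) ⟩
    0ℤ ∎
  φe+SP⁺ (suc i) (suc k) = begin
    b ℤ.* φ i ℤ.* (β ℤ.* e k) ℤ.+ (α ℤ.* φ i ℤ.* (a ℤ.* e k) ℤ.+ P i • (λ j → S j k))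
      ≡⟨ solve 7 (λ a b α β f e d → b :* f :* (β :* e) :+ (α :* f :* (a :* e) :+ d)
           := (a :* α :+ b :* β) :* (f :* e) :+ d) refl a b α β (φ i) (e k) (P i • (λ j → S j k)) ⟩
    (a ℤ.* α ℤ.+ b ℤ.* β) ℤ.* (φ i ℤ.* e k) ℤ.+ P i • (λ j → S j k)
      ≡⟨ cong (λ z → z ℤ.* (φ i ℤ.* e k) ℤ.+ P i • (λ j → S j k)) aα+bβ≡1 ⟩
    1ℤ ℤ.* (φ i ℤ.* e k) ℤ.+ P i • (λ j → S j k)
      ≡⟨ cong (ℤ._+ P i • (λ j → S j k)) (ℤ.*-identityˡ (φ i ℤ.* e k)) ⟩
    φ i ℤ.* e k ℤ.+ P i • (λ j → S j k)
      ≡⟨ φe+SP i k ⟩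
    δ i k ∎

  PS⁺ : ∀ j l → S⁺ j • (λ k → P⁺ k l) ≡ δ j l
  PS⁺ zero zero = begin
    ℤ.- b ℤ.* ℤ.- β ℤ.+ (λ k → a ℤ.* e k) • (λ k → α ℤ.* φ k)
      ≡⟨ cong (λ z → ℤ.- b ℤ.* ℤ.- β ℤ.+ z) (trans (scaled a α e φ) (cong (a ℤ.* α ℤ.*_) φe)) ⟩
    ℤ.- b ℤ.* ℤ.- β ℤ.+ a ℤ.* α ℤ.* 1ℤ
      ≡⟨ solve 4 (λ a b α β → :- b :* :- β :+ a :* α :* con 1ℤ := a :* α :+ b :* β) refl a b α β ⟩
    a ℤ.* α ℤ.+ b ℤ.* β
      ≡⟨ aα+bβ≡1 ⟩
    1ℤ ∎
  PS⁺ zero (suc l) = begin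
    ℤ.- b ℤ.* 0ℤ ℤ.+ (λ k → a ℤ.* e k) • (λ k → P k l)
      ≡⟨ cong (λ z → ℤ.- b ℤ.* 0ℤ ℤ.+ z) (trans (ℤᴸ.dot-*ˡ a e (λ k → P k l)) (cong (a ℤ.*_) (Pe l))) ⟩
    ℤ.- b ℤ.* 0ℤ ℤ.+ a ℤ.* 0ℤ
      ≡⟨ cong₂ ℤ._+_ (ℤ.*-zeroʳ (ℤ.- b)) (ℤ.*-zeroʳ a) ⟩
    0ℤ ∎
  PS⁺ (suc j) zero = begin
    0ℤ ℤ.* ℤ.- β ℤ.+ S j • (λ k → α ℤ.* φ k)
      ≡⟨ cong (λ z → 0ℤ ℤ.* ℤ.- β ℤ.+ z) (trans (ℤᴸ.dot-*ʳ (S j) α φ) (trans (cong (α ℤ.*_) (φS j)) (ℤ.*-zeroʳ α))) ⟩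
    0ℤ ℤ.* ℤ.- β ℤ.+ 0ℤ
      ≡⟨ cong (ℤ._+ 0ℤ) (ℤ.*-zeroˡ (ℤ.- β)) ⟩
    0ℤ ∎
  PS⁺ (suc j) (suc l) = trans (ℤ.+-identityˡ _) (PS j l)

  φS⁺ : ∀ j → S⁺ j • φ⁺ ≡ 0ℤ
  φS⁺ zero = begin
    ℤ.- b ℤ.* a ℤ.+ (λ k → a ℤ.* e k) • (λ k → b ℤ.* φ k)
      ≡⟨ cong (λ z → ℤ.- b ℤ.* a ℤ.+ z) (trans (scaled a b e φ) (cong (a ℤ.* b ℤ.*_) φe)) ⟩
    ℤ.- b ℤ.* a ℤ.+ a ℤ.* b ℤ.* 1ℤ
      ≡⟨ solve 2 (λ a b → :- b :* a :+ a :* b :* con 1ℤ := con 0ℤ) refl a b ⟩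
    0ℤ ∎
  φS⁺ (suc j) = trans (ℤ.+-identityˡ _)
    (trans (ℤᴸ.dot-*ʳ (S j) b φ) (trans (cong (b ℤ.*_) (φS j)) (ℤ.*-zeroʳ b)))

  Pe⁺ : ∀ l → e⁺ • (λ k → P⁺ k l) ≡ 0ℤ
  Pe⁺ zero = begin
    α ℤ.* ℤ.- β ℤ.+ (λ k → β ℤ.* e k) • (λ k → α ℤ.* φ k)
      ≡⟨ cong (λ z → α ℤ.* ℤ.- β ℤ.+ z) (trans (scaled β α e φ) (cong (β ℤ.* α ℤ.*_) φe)) ⟩
    α ℤ.* ℤ.- β ℤ.+ β ℤ.* α ℤ.* 1ℤ
      ≡⟨ solve 2 (λ α β → α :* :- β :+ β :* α :* con 1ℤ := con 0ℤ) refl α β ⟩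
    0ℤ ∎
  Pe⁺ (suc l) = begin
    α ℤ.* 0ℤ ℤ.+ (λ k → β ℤ.* e k) • (λ k → P k l)
      ≡⟨ cong (λ z → α ℤ.* 0ℤ ℤ.+ z) (trans (ℤᴸ.dot-*ˡ β e (λ k → P k l)) (cong (β ℤ.*_) (Pe l))) ⟩
    α ℤ.* 0ℤ ℤ.+ β ℤ.* 0ℤ
      ≡⟨ cong₂ ℤ._+_ (ℤ.*-zeroʳ α) (ℤ.*-zeroʳ β) ⟩
    0ℤ ∎

  φe⁺ : e⁺ • φ⁺ ≡ 1ℤ
  φe⁺ = begin
    α ℤ.* a ℤ.+ (λ k → β ℤ.* e k) • (λ k → b ℤ.* φ k)
      ≡⟨ cong (λ z → α ℤ.* a ℤ.+ z) (trans (scaled β b e φ) (cong (β ℤ.* b ℤ.*_) φe)) ⟩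
    α ℤ.* a ℤ.+ β ℤ.* b ℤ.* 1ℤ
      ≡⟨ solve 4 (λ a b α β → α :* a :+ β :* b :* con 1ℤ := a :* α :+ b :* β) refl a b α β ⟩
    a ℤ.* α ℤ.+ b ℤ.* β
      ≡⟨ aα+bβ≡1 ⟩
    1ℤ ∎

a*b≡0⇒b≡0 : ∀ a b → a ≢ 0ℤ → a ℤ.* b ≡ 0ℤ → b ≡ 0ℤ
a*b≡0⇒b≡0 a b a≢0 ab≡0 with ℤ.i*j≡0⇒i≡0∨j≡0 a {b} ab≡0
... | inj₁ a≡0 = contradiction a≡0 a≢0
... | inj₂ b≡0 = b≡0

*-≢0 : ∀ {a b} → a ≢ 0ℤ → b ≢ 0ℤ → a ℤ.* b ≢ 0ℤ
*-≢0 {a} {b} a≢0 b≢0 = b≢0 ∘ a*b≡0⇒b≡0 a b a≢0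

•-linear : ∀ {n} a b (x y t : ℤ^ n) →
  (λ i → a ℤ.* x i ℤ.+ b ℤ.* y i) • t ≡ a ℤ.* (x • t) ℤ.+ b ℤ.* (y • t)
•-linear a b x y t = trans (ℤᴸ.dot-+ˡ (λ i → a ℤ.* x i) (λ i → b ℤ.* y i) t)
  (cong₂ ℤ._+_ (ℤᴸ.dot-*ˡ a x t) (ℤᴸ.dot-*ˡ b y t))

-- Integer linear systems

Kernel : ∀ {m n} → Vector (ℤ^ n) m → ℤ^ n → Set
Kernel A x = ∀ r → x • A r ≡ 0ℤ

Kernel-linear : ∀ {m n} (A : Vector (ℤ^ n) m) a b {x y} → Kernel A x → Kernel A y →
  Kernel A (λ i → a ℤ.* x i ℤ.+ b ℤ.* y i)
Kernel-linear A a b {x} {y} Ax≡0 Ay≡0 r = begin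
  (λ i → a ℤ.* x i ℤ.+ b ℤ.* y i) • A r    ≡⟨ •-linear a b x y (A r) ⟩
  a ℤ.* (x • A r) ℤ.+ b ℤ.* (y • A r)      ≡⟨ cong₂ (λ p q → a ℤ.* p ℤ.+ b ℤ.* q) (Ax≡0 r) (Ay≡0 r) ⟩
  a ℤ.* 0ℤ ℤ.+ b ℤ.* 0ℤ                    ≡⟨ cong₂ ℤ._+_ (ℤ.*-zeroʳ a) (ℤ.*-zeroʳ b) ⟩
  0ℤ                                       ∎
  where open ≡-Reasoning

-- The factor c is a common denominator: t lies in the rational row space of A.
RowMultiple : ∀ {m n} → Vector (ℤ^ n) m → ℤ^ n → Set
RowMultiple {m} A t = Σ[ f ∈ ℤ^ m ] ∃[ c ] (c ≢ 0ℤ × (∀ i → f • (λ r → A r i) ≡ c ℤ.* t i))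

-- The Fredholm alternative over ℚ with denominators cleared, by induction on the rows. The hard
-- case is a vector x killed by the later rows but neither by t nor by the first row A₀. Then t′ =
-- (x • A₀) t - (x • t) A₀ is tried against the later rows: if it is a combination of them, solve
-- for t; if y detects it, subtracting from (x • A₀) y the multiple of x that makes it vanish on A₀
-- gives a vector whose product with t is y • t′.
fredholm : ∀ {m n} (A : Vector (ℤ^ n) m) (t : ℤ^ n) →
  RowMultiple A t ⊎ Σ[ x ∈ ℤ^ n ] (Kernel A x × x • t ≢ 0ℤ)
fredholm {zero} A t with Fin.all? (λ i → t i ℤ.≟ 0ℤ)
... | yes t≡0 = inj₁ ((λ ()) , 1ℤ , (λ ()) , λ i → sym (trans (ℤ.*-identityˡ (t i)) (t≡0 i)))
... | no t≢0 with Fin.¬∀⟶∃¬ _ _ (λ i → t i ℤ.≟ 0ℤ) t≢0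
...   | i , tᵢ≢0 = inj₂ ((λ j → δ j i) , (λ ()) ,
  λ eq → tᵢ≢0 (trans (sym (trans (•-comm (λ j → δ j i) t) (ℤᴸ.dot-δ t i))) eq))
fredholm {suc m} A t with fredholm (A ∘ suc) t
... | inj₁ (f , c , c≢0 , fA≡ct) = inj₁ ((λ { zero → 0ℤ ; (suc r) → f r }) , c , c≢0 ,
  λ i → trans (cong (ℤ._+ f • (λ r → A (suc r) i)) (ℤ.*-zeroˡ (A zero i))) (trans (ℤ.+-identityˡ _) (fA≡ct i)))
... | inj₂ (x , Ax≡0 , x•t≢0) with x • A zero ℤ.≟ 0ℤ
...   | yes x•A₀≡0 = inj₂ (x , (λ { zero → x•A₀≡0 ; (suc r) → Ax≡0 r }) , x•t≢0)
...   | no x•A₀≢0 with fredholm (A ∘ suc) (λ i → x • A zero ℤ.* t i ℤ.+ ℤ.- (x • t) ℤ.* A zero i)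
...     | inj₁ (f , c , c≢0 , fA≡ct′) = inj₁
  ( (λ { zero → c ℤ.* (x • t) ; (suc r) → f r })
  , c ℤ.* (x • A zero) , *-≢0 c≢0 x•A₀≢0
  , λ i → trans (cong (λ z → c ℤ.* (x • t) ℤ.* A zero i ℤ.+ z) (fA≡ct′ i))
      (solve 5 (λ c a b t r → c :* b :* r :+ c :* (a :* t :+ :- b :* r) := c :* a :* t) refl
        c (x • A zero) (x • t) (t i) (A zero i)))
  where open ℤSolver.+-*-Solver
...     | inj₂ (y , Ay≡0 , y•t′≢0) = inj₂
  ( (λ i → a ℤ.* y i ℤ.+ ℤ.- (y • A zero) ℤ.* x i)
  , (λ { zero → trans (•-linear a (ℤ.- (y • A zero)) y x (A zero))
                  (solve 2 (λ a r → a :* r :+ :- r :* a := con 0ℤ) refl a (y • A zero))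
       ; (suc r) → Kernel-linear (A ∘ suc) a (ℤ.- (y • A zero)) Ay≡0 Ax≡0 r })
  , λ eq → y•t′≢0 (trans (trans expand
      (solve 4 (λ a b s r → a :* s :+ :- b :* r := a :* s :+ :- r :* b) refl a b (y • t) (y • A zero)))
      (trans (sym (•-linear a (ℤ.- (y • A zero)) y x t)) eq)))
  where
  open ℤSolver.+-*-Solver
  a = x • A zero
  b = x • t
  expand : y • (λ i → a ℤ.* t i ℤ.+ ℤ.- b ℤ.* A zero i) ≡ a ℤ.* (y • t) ℤ.+ ℤ.- b ℤ.* (y • A zero)
  expand = trans (ℤᴸ.dot-+ʳ y (λ i → a ℤ.* t i) (λ i → ℤ.- b ℤ.* A zero i))
    (cong₂ ℤ._+_ (ℤᴸ.dot-*ʳ y a t) (ℤᴸ.dot-*ʳ y (ℤ.- b) (A zero)))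

column : ∀ {m n} → Vector (ℤ^ m) n → Vector (ℤ^ n) m
column u k i = u i k

-- Induction on the dimension. Splitting along the vector of first coordinates, the columns of P are
-- relations among these coordinates; combining the generators by them leaves one generator and one
-- coordinate fewer. Pairing with S recovers the smaller dependence, so the new one is non-zero.
nontrivial-dependence : ∀ {m} (u : Vector (ℤ^ m) (suc m)) →
  Σ[ c ∈ ℤ^ (suc m) ] ((∃[ i ] c i ≢ 0ℤ) × Kernel (column u) c)
nontrivial-dependence {zero} u = (λ _ → 1ℤ) , (zero , λ ()) , λ ()
nontrivial-dependence {suc m} u = extend (nontrivial-dependence u′)
  where
  open Splitting (splitting (column u zero))
  u′ : Vector (ℤ^ m) (suc m)
  u′ l k = column P l • column u (suc k)
  extend : Σ[ c ∈ ℤ^ (suc m) ] ((∃[ i ] c i ≢ 0ℤ) × Kernel (column u′) c) →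
    Σ[ c ∈ ℤ^ (suc (suc m)) ] ((∃[ i ] c i ≢ 0ℤ) × Kernel (column u) c)
  extend (c′ , (l , c′ₗ≢0) , uc′≡0) = c , nonzero , λ
    { zero → trans (ℤᴸ.dot-dot c′ (column P) (column u zero)) (ℤᴸ.dot-zeroʳ c′ first)
    ; (suc k) → trans (ℤᴸ.dot-dot c′ (column P) (column u (suc k))) (uc′≡0 k) }
    where
    c : ℤ^ (suc (suc m))
    c k = c′ • P k
    first : ∀ j → column P j • column u zero ≡ 0ℤ
    first j = trans (ℤᴸ.dot-congʳ (column P j) w≡ge) (trans (ℤᴸ.dot-*ʳ (column P j) g e)
      (trans (cong (g ℤ.*_) (trans (•-comm (column P j) e) (Pe j))) (ℤ.*-zeroʳ g)))
    Sc : c • S l ≡ c′ l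
    Sc = trans (ℤᴸ.dot-dot c′ (column P) (S l)) (trans
      (ℤᴸ.dot-congʳ c′ λ j → trans (•-comm (column P j) (S l)) (trans (PS l j) (δ-sym l j)))
      (ℤᴸ.dot-δ c′ l))
    nonzero : ∃[ i ] c i ≢ 0ℤ
    nonzero with Fin.all? (λ i → c i ℤ.≟ 0ℤ)
    ... | yes c≡0 = contradiction (trans (sym Sc) (ℤᴸ.dot-zeroˡ (S l) c≡0)) c′ₗ≢0
    ... | no c≢0 = Fin.¬∀⟶∃¬ _ _ (λ i → c i ℤ.≟ 0ℤ) c≢0

-- Avoiding finitely many hyperplanes

strict-bound : ∀ {A : Set} (f : A → ℕ) (xs : List A) → ∃[ M ] All (λ x → f x ℕ.< M) xs
strict-bound f [] = 0 , []
strict-bound f (x ∷ xs) with strict-bound f xs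
... | M , xs<M = suc (f x) ℕ.⊔ M , ℕ.m≤m⊔n (suc (f x)) M ∷
  All.map (λ lt → ℕ.≤-trans lt (ℕ.m≤n⊔m (suc (f x)) M)) xs<M

M*x+y≢0 : ∀ M {x y} → x ≢ 0ℤ → ℤ.∣ y ∣ ℕ.< M → + M ℤ.* x ℤ.+ y ≢ 0ℤ
M*x+y≢0 M {x} {y} x≢0 y<M eq = ℕ.<⇒≱ y<M (subst (M ℕ.≤_) ∣Mx∣≡∣y∣
    (ℕ.m≤m*n M ℤ.∣ x ∣ {{ℕ.≢-nonZero (x≢0 ∘ ℤ.∣i∣≡0⇒i≡0)}}))
  where
  open ℤSolver.+-*-Solver
  Mx≡-y : + M ℤ.* x ≡ ℤ.- y
  Mx≡-y = trans (solve 2 (λ a y → a := a :+ y :+ :- y) refl (+ M ℤ.* x) y)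
    (trans (cong (ℤ._+ ℤ.- y) eq) (ℤ.+-identityˡ (ℤ.- y)))
  ∣Mx∣≡∣y∣ : M ℕ.* ℤ.∣ x ∣ ≡ ℤ.∣ y ∣
  ∣Mx∣≡∣y∣ = trans (sym (ℤ.abs-* (+ M) x)) (trans (cong ℤ.∣_∣ Mx≡-y) (ℤ.∣-i∣≡∣i∣ y))

-- A form that is not in the rational row space is non-zero at some kernel vector y. Passing from x
-- to M x + y with M above all values of y keeps every form that was non-zero at x and makes the new
-- one non-zero. The list `ss` holds the forms that the starting vector already avoids.
avoid-hyperplanes : ∀ {m n} (A : Vector (ℤ^ n) m) (ts ss : List (ℤ^ n)) →
  Σ[ x ∈ ℤ^ n ] (Kernel A x × All (λ s → x • s ≢ 0ℤ) ss) →
  Any (RowMultiple A) ts ⊎ Σ[ x ∈ ℤ^ n ] (Kernel A x × All (λ s → x • s ≢ 0ℤ) (ts ++ ss))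
avoid-hyperplanes A [] ss x = inj₂ x
avoid-hyperplanes A (t ∷ ts) ss x with avoid-hyperplanes A ts ss x
... | inj₁ any = inj₁ (there any)
... | inj₂ (x , Ax≡0 , x•s≢0) with fredholm A t
...   | inj₁ row = inj₁ (here row)
...   | inj₂ (y , Ay≡0 , y•t≢0) with strict-bound (λ s → ℤ.∣ y • s ∣) (t ∷ ts ++ ss)
...     | M , y•t<M ∷ y•s<M = inj₂ (z , Kernel-linear A (+ M) 1ℤ Ax≡0 Ay≡0 ,
  z•t≢0 ∷ All.zipWith (λ { {s} (x•s≢0 , y•s<M) → M*x+y≢0 M x•s≢0 y•s<M ∘ trans (sym (expand s)) })
    (x•s≢0 , y•s<M))
  where
  z : ℤ^ _
  z i = + M ℤ.* x i ℤ.+ 1ℤ ℤ.* y i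
  expand : ∀ s → z • s ≡ + M ℤ.* (x • s) ℤ.+ y • s
  expand s = trans (•-linear (+ M) 1ℤ x y s) (cong (λ a → + M ℤ.* (x • s) ℤ.+ a) (ℤ.*-identityˡ (y • s)))
  z•t≢0 : z • t ≢ 0ℤ
  z•t≢0 eq with x • t ℤ.≟ 0ℤ
  ... | no x•t≢0 = M*x+y≢0 M x•t≢0 y•t<M (trans (sym (expand t)) eq)
  ... | yes x•t≡0 = y•t≢0 (trans (sym (trans (cong (λ a → + M ℤ.* a ℤ.+ y • t) x•t≡0)
    (trans (cong (ℤ._+ y • t) (ℤ.*-zeroʳ (+ M))) (ℤ.+-identityˡ (y • t))))) (trans (sym (expand t)) eq))

-- Cosimple collections with an integer dependence

-- Spanning, tested by integer forms: this version passes to projections and to merged collections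
-- by pulling back forms.
DualSpanning : ∀ {n d} → Vector (ℤ^ d) n → Set
DualSpanning u = ∀ f → (∀ i → f • u i ≡ 0ℤ) → ∀ k → f k ≡ 0ℤ

Distinguishing : ∀ {n} → ℤ^ n → Set
Distinguishing c = (∀ i → c i ≢ 0ℤ) × (∀ i j → i ≢ j → ℤ.∣ c i ∣ ≢ ℤ.∣ c j ∣)

signOf : Bool → ℤ
signOf true  = 1ℤ
signOf false = -1ℤ

∣i∣≡∣j∣⇒ : ∀ i j → ℤ.∣ i ∣ ≡ ℤ.∣ j ∣ → ∃[ s ] i ≡ signOf s ℤ.* j
∣i∣≡∣j∣⇒ (+ m)        (+ n)         refl = true , sym (ℤ.*-identityˡ _)
∣i∣≡∣j∣⇒ (+ m)        ℤ.-[1+ n ]  refl = false , sym (ℤ.-1*i≡-i ℤ.-[1+ n ])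
∣i∣≡∣j∣⇒ ℤ.-[1+ m ]   (+ n)         refl = false , sym (ℤ.-1*i≡-i (+ suc m))
∣i∣≡∣j∣⇒ ℤ.-[1+ m ]   ℤ.-[1+ n ]  refl = true , sym (ℤ.*-identityˡ _)

-- The coefficients of the form sending x to x i - s x j, with i = `punchIn j k` and the sign s.
signedDifference : ∀ {n} → Fin (suc n) × Fin n × Bool → ℤ^ (suc n)
signedDifference (j , k , s) l = δ l (punchIn j k) ℤ.- signOf s ℤ.* δ l j

-- Pairs of different coordinates are given as j and punchIn j k.
signedPairs : ∀ n → List (Fin (suc n) × Fin n × Bool)
signedPairs n = List.cartesianProduct (List.allFin (suc n)) (List.cartesianProduct (List.allFin n) (true ∷ false ∷ []))

∈-signedPairs : ∀ {n} (j : Fin (suc n)) (k : Fin n) s → Any ((j , k , s) ≡_) (signedPairs n)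
∈-signedPairs j k s =
  List.∈-cartesianProduct⁺ (List.∈-allFin j) (List.∈-cartesianProduct⁺ (List.∈-allFin k) (bools s))
  where
  bools : ∀ s → Any (s ≡_) (true ∷ false ∷ [])
  bools true  = here refl
  bools false = there (here refl)

-- The dual expression of two coordinates agreeing up to sign on all dependences; the vector inside
-- `RowMultiple` is the form f on which the merging step is built.
Coincidence : ∀ {m n} → Vector (ℤ^ m) (suc n) → Set
Coincidence u = ∃[ p ] RowMultiple (column u) (signedDifference p)

•-δ-difference : ∀ {n} (c : ℤ^ n) i j a → c • (λ l → δ l i ℤ.- a ℤ.* δ l j) ≡ c i ℤ.- a ℤ.* c j
•-δ-difference c i j a = trans (ℤᴸ.dot-+ʳ c (λ l → δ l i) (λ l → ℤ.- (a ℤ.* δ l j)))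
  (cong₂ ℤ._+_ (ℤᴸ.dot-δ c i)
    (trans (ℤᴸ.dot-congʳ c (λ l → ℤ.neg-distribˡ-* a (δ l j))) (trans (ℤᴸ.dot-*ʳ c (ℤ.- a) (λ l → δ l j))
      (trans (cong (ℤ.- a ℤ.*_) (ℤᴸ.dot-δ c j)) (sym (ℤ.neg-distribˡ-* a (c j)))))))

distinguish : ∀ {m n} (u : Vector (ℤ^ m) (suc n)) (c : ℤ^ (suc n)) →
  Kernel (column u) c → (∀ i → c i ≢ 0ℤ) →
  Coincidence u ⊎ Σ[ x ∈ ℤ^ (suc n) ] (Kernel (column u) x × Distinguishing x)
distinguish {m} {n} u c uc≡0 c≢0 with avoid-hyperplanes (column u)
    -- The signed differences are to be avoided; the coordinate forms are avoided by c from the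
    -- start.
    (List.map signedDifference (signedPairs n)) (List.map (λ i l → δ l i) (List.allFin (suc n)))
    (c , uc≡0 , All.map⁺ (All.tabulate λ {i} _ → c≢0 i ∘ trans (sym (ℤᴸ.dot-δ c i))))
... | inj₁ row = inj₁ (Any.satisfied (Any.map⁻ row))
... | inj₂ (x , ux≡0 , x•≢0) = inj₂ (x , ux≡0 , x≢0 , ∣x∣≢)
  where
  x≢0 : ∀ i → x i ≢ 0ℤ
  x≢0 i xᵢ≡0 = All.lookup (All.map⁻ (All.++⁻ʳ (List.map signedDifference (signedPairs n)) x•≢0)) (List.∈-allFin i)
    (trans (ℤᴸ.dot-δ x i) xᵢ≡0)
  ∣x∣≢ : ∀ i j → i ≢ j → ℤ.∣ x i ∣ ≢ ℤ.∣ x j ∣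
  ∣x∣≢ i j i≢j ∣xᵢ∣≡∣xⱼ∣ with ∣i∣≡∣j∣⇒ (x i) (x j) ∣xᵢ∣≡∣xⱼ∣
  ... | s , xᵢ≡sxⱼ = All.lookup (All.map⁻ (All.++⁻ˡ (List.map signedDifference (signedPairs n)) x•≢0))
    (∈-signedPairs j k s)
    (trans (•-δ-difference x (punchIn j k) j (signOf s))
      (trans (cong (λ l → x l ℤ.- signOf s ℤ.* x j) (Fin.punchIn-punchOut (i≢j ∘ sym)))
        (trans (cong (ℤ._- signOf s ℤ.* x j) xᵢ≡sxⱼ) (ℤ.+-inverseʳ (signOf s ℤ.* x j)))))
    where
    k = punchOut (i≢j ∘ sym)

-- From integer collections to real coverings

module ℝᴿ = CommutativeRing ℝ-commutativeRing
module ≃-Reasoning = SetoidReasoning ℝᴿ.setoid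

1/ℤ : ∀ {g} → g ≢ 0ℤ → ∃[ r ] (r ℚ.* (g / 1) ≡ 1ℚ × ℚ.∣ r ∣ ℚ.≤ 1ℚ)
1/ℤ {g} g≢0 = r , rg≡1 , ∣r∣≤1
  where
  instance
    g/1≢0 : ℚ.NonZero (g / 1)
    g/1≢0 = ℚ.≢-nonZero (g≢0 ∘ /1-injective)
  r : ℚ
  r = ℚ.1/ (g / 1)
  rg≡1 : r ℚ.* (g / 1) ≡ 1ℚ
  rg≡1 = ℚ.*-inverseˡ (g / 1)
  1≤∣g∣ : 1ℚ ℚ.≤ ℚ.∣ g / 1 ∣
  1≤∣g∣ = subst (1ℚ ℚ.≤_) (sym (∣/1∣ g))
    (/1-mono-≤ {1ℤ} {+ ℤ.∣ g ∣} (ℤ.+≤+ (ℕ.n≢0⇒n>0 (g≢0 ∘ ℤ.∣i∣≡0⇒i≡0))))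
  ∣r∣≤1 : ℚ.∣ r ∣ ℚ.≤ 1ℚ
  ∣r∣≤1 = begin
    ℚ.∣ r ∣                     ≡⟨ ℚ.*-identityʳ ℚ.∣ r ∣ ⟨
    ℚ.∣ r ∣ ℚ.* 1ℚ              ≤⟨ ℚ.*-monoˡ-≤-nonNeg ℚ.∣ r ∣ {{ℚ.∣-∣-nonNeg r}} 1≤∣g∣ ⟩
    ℚ.∣ r ∣ ℚ.* ℚ.∣ g / 1 ∣     ≡⟨ ℚ.∣p*q∣≡∣p∣*∣q∣ r (g / 1) ⟨
    ℚ.∣ r ℚ.* (g / 1) ∣         ≡⟨ cong ℚ.∣_∣ rg≡1 ⟩
    1ℚ                          ∎
    where open ℚ.≤-Reasoning

∣fromℚ∣≲ : ∀ {p q} → ℚ.∣ p ∣ ℚ.≤ q → ∣ fromℚ p ∣ᵣ ≲ fromℚ q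
∣fromℚ∣≲ p≤q = pointwise-≲ λ _ → p≤q

-- Apply `fredholm` with the generators as rows: a vector detecting a unit vector would be a
-- non-zero form vanishing on u. Hence a non-zero multiple of each unit vector is an integer
-- combination of the generators, and over ℝ one divides.
dualSpanning⇒spanning : ∀ {n d} (u : Vector (ℤ^ d) n) → DualSpanning u → Spanning u
dualSpanning⇒spanning {n} {d} u span x = c , λ l → unwrap≃ (x≃ l)
  where
  multiple : ∀ k → RowMultiple u (δ k)
  multiple k with fredholm u (δ k)
  ... | inj₁ row = row
  ... | inj₂ (y , uy≡0 , y•δ≢0) = contradiction (ℤᴸ.dot-zeroˡ (δ k) (span y uy≡0)) y•δ≢0
  F : Vector (ℤ^ n) d
  F k = proj₁ (multiple k)
  g : ℤ^ d
  g k = proj₁ (proj₂ (multiple k))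
  inv : ∀ k → ∃[ r ] (r ℚ.* (g k / 1) ≡ 1ℚ × ℚ.∣ r ∣ ℚ.≤ 1ℚ)
  inv k = 1/ℤ (proj₁ (proj₂ (proj₂ (multiple k))))
  y : ℝ^ d
  y k = x k *ᵣ fromℚ (proj₁ (inv k))
  c : ℝ^ n
  c i = ℝᴸ.dot y (λ k → F k i)
  yg≃x : ∀ k → y k *ᵣ fromℤ (g k) ≃ x k
  yg≃x k = pointwise-≃ λ n → trans (ℚ.*-assoc (seq (x k) n) _ _)
    (trans (cong (seq (x k) n ℚ.*_) (proj₁ (proj₂ (inv k)))) (ℚ.*-identityʳ (seq (x k) n)))
  yδ≃ : ∀ l k → y k *ᵣ fromℤ (g k ℤ.* δ k l) ≃ x k *ᵣ fromℤ (δ k l)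
  yδ≃ l k = begin
    y k *ᵣ fromℤ (g k ℤ.* δ k l)            ≈⟨ ℝᴿ.*-congˡ (pointwise-≃ λ _ → /1-homo-* (g k) (δ k l)) ⟩
    y k *ᵣ (fromℤ (g k) *ᵣ fromℤ (δ k l))   ≈⟨ ℝᴿ.*-assoc (y k) (fromℤ (g k)) (fromℤ (δ k l)) ⟨
    y k *ᵣ fromℤ (g k) *ᵣ fromℤ (δ k l)     ≈⟨ ℝᴿ.*-congʳ (yg≃x k) ⟩
    x k *ᵣ fromℤ (δ k l)                    ∎
    where open ≃-Reasoning
  x≃ : ∀ l → x l ≃ combℝ c u l
  x≃ l = ℝᴿ.sym (begin
    combℝ c u l                                ≈⟨ ℝᴸ.dot-dot y F (column u l) ⟩
    ℝᴸ.dot y (λ k → F k • column u l)          ≈⟨ ℝᴸ.dot-congʳ y (λ k → proj₂ (proj₂ (proj₂ (multiple k))) l) ⟩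
    ℝᴸ.dot y (λ k → g k ℤ.* δ k l)             ≈⟨ SemiringSum.sum-cong-≋ ℝᴿ.semiring (yδ≃ l) ⟩
    ℝᴸ.dot x (λ k → δ k l)                     ≈⟨ ℝᴸ.dot-δ x l ⟩
    x l                                        ∎)
    where open ≃-Reasoning

IntegerCosimple : ∀ {n d} → Vector (ℤ^ d) n → Set
IntegerCosimple {n} u = DualSpanning u × Σ[ c ∈ ℤ^ n ] (Kernel (column u) c × Distinguishing c)

integerCosimple⇒cosimple : ∀ {n d} (u : Vector (ℤ^ d) n) → IntegerCosimple u → Cosimple u
integerCosimple⇒cosimple u (span , c , uc≡0 , c≢0 , ∣c∣≢) = dualSpanning⇒spanning u span ,
  fromℤ ∘ c ,
  (λ k → unwrap≃ (ℝᴿ.trans (ℝᴿ.sym (ℝᴸ.dot-ι c (column u k))) (ℝᴿ.reflexive (cong fromℤ (uc≡0 k))))) ,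
  (λ i cᵢ≈0 → c≢0 i (fromℤ-injective (wrap≃ cᵢ≈0))) ,
  λ i j i≢j ∣cᵢ∣≈∣cⱼ∣ → ∣c∣≢ i j i≢j (ℤ.+-injective (/1-injective
    (trans (sym (∣/1∣ (c i))) (trans (fromℚ-injective {ℚ.∣ c i / 1 ∣} {ℚ.∣ c j / 1 ∣} (wrap≃ ∣cᵢ∣≈∣cⱼ∣)) (∣/1∣ (c j))))))

-- Bounding absolute values centers the dilated zonotope at the origin, which does away with
-- translation vectors.
Reach : ∀ {n d} → ℚ → Vector (ℤ^ d) n → ℝ^ d → Set
Reach {n} {d} h u x = Σ[ z ∈ ℤ^ d ] Σ[ σ ∈ ℝ^ n ]
  ((∀ i → ∣ σ i ∣ᵣ ≲ fromℚ h) × (∀ k → x k ≃ combℝ σ u k +ᵣ fromℤ (z k)))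

CosimpleCover : ℚ → ℕ → Set
CosimpleCover h d = ∀ n (u : Vector (ℤ^ d) n) → IntegerCosimple u → ∀ x → Reach h u x

coveringRadius⇒reach : ∀ {n d} (u : Vector (ℤ^ d) n) ρ μ → IsCoveringRadius (zonotope u) μ →
  μ ≲ fromℚ ρ → ∀ x → Reach (½ ℚ.* ρ) u x
coveringRadius⇒reach {n} {d} u ρ μ (0≤μ , covers , _) μ≲ρ x with
  -- The shift is by the center of ρ Z although μ Z does the covering: μ t lies in [0, ρ], so μ t -
  -- ρ / 2 has absolute value at most ρ / 2.
  covers (λ k → x k +ᵣ combℝ (λ _ → fromℚ (½ ℚ.* ρ)) u k)
... | y , (y′ , (t , t∈[0,1] , y′≈) , y≈) , z , x⁺≈ = z , σ , bounded , x≃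
  where
  open +-*-Solver
  h = fromℚ (½ ℚ.* ρ)
  σ : ℝ^ n
  σ i = μ *ᵣ t i +ᵣ -ᵣ h
  ρ≡h+h : ρ ≡ ½ ℚ.* ρ ℚ.+ ½ ℚ.* ρ
  ρ≡h+h = sym (halves ρ)
  μt≲ρ : ∀ i → μ *ᵣ t i ≲ fromℚ ρ
  μt≲ρ i = ≲-trans (≲-resp-≃ ≃-refl (ℝᴿ.*-identityʳ μ) (*ᵣ-monoˡ-≲ (wrap≲ 0≤μ) (wrap≲ (proj₂ (t∈[0,1] i))))) μ≲ρ
  bounded : ∀ i → ∣ σ i ∣ᵣ ≲ h
  bounded i = ∣x∣≲
    (≲-resp-≃ ≃-refl (pointwise-≃ λ _ → trans (cong (ℚ._- ½ ℚ.* ρ) ρ≡h+h)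
        (solve 1 (λ h → h :+ h :- h := h) refl (½ ℚ.* ρ)))
      (+ᵣ-mono-≲ (μt≲ρ i) (≃⇒≲ (≃-refl { -ᵣ h}))))
    (0≲-⇒≲ (≲-resp-≃ ≃-refl
      (pointwise-≃ λ n → solve 2 (λ a h → a := h :- :- (a :- h)) refl (seq μ n ℚ.* seq (t i) n) (½ ℚ.* ρ))
      (0≲* {μ} {t i} (wrap≲ 0≤μ) (wrap≲ (proj₁ (t∈[0,1] i))))))
  x≃ : ∀ k → x k ≃ combℝ σ u k +ᵣ fromℤ (z k)
  x≃ k = begin
    x k                                                      ≈⟨ pointwise-≃ (λ n → solve 2 (λ a b → a := a :+ b :- b) refl (seq (x k) n) (seq H n)) ⟩
    (x k +ᵣ H) +ᵣ -ᵣ H                                       ≈⟨ ℝᴿ.+-congʳ (wrap≃ (x⁺≈ k)) ⟩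
    (y k +ᵣ fromℤ (z k)) +ᵣ -ᵣ H                             ≈⟨ pointwise-≃ (λ n → solve 3 (λ a b c → a :+ b :- c := a :- c :+ b) refl (seq (y k) n) (z k / 1) (seq H n)) ⟩
    (y k +ᵣ -ᵣ H) +ᵣ fromℤ (z k)                             ≈⟨ ℝᴿ.+-congʳ (ℝᴿ.+-congʳ (≃-trans {y = μ *ᵣ y′ k} (wrap≃ (y≈ k)) (ℝᴿ.*-congˡ (wrap≃ (y′≈ k))))) ⟩
    (μ *ᵣ combℝ t u k +ᵣ -ᵣ H) +ᵣ fromℤ (z k)                ≈⟨ ℝᴿ.+-congʳ (ℝᴿ.+-cong (ℝᴸ.dot-*ˡ μ t (column u k)) (ℝᴸ.dot-negˡ (λ _ → h) (column u k))) ⟨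
    (combℝ (λ i → μ *ᵣ t i) u k +ᵣ combℝ (λ _ → -ᵣ h) u k) +ᵣ fromℤ (z k)
                                                             ≈⟨ ℝᴿ.+-congʳ (ℝᴸ.dot-+ˡ (λ i → μ *ᵣ t i) (λ _ → -ᵣ h) (column u k)) ⟨
    combℝ σ u k +ᵣ fromℤ (z k)                               ∎
    where
    open ≃-Reasoning
    H = combℝ (λ _ → h) u k

-- A cosimple collection in dimension d becomes cosimple in dimension 1 + d by
-- adding e₀ and -2e₀, with coefficients 2K and K in the dependence for K large.
lower-dimension : ∀ {h d} → CosimpleCover h (suc d) → CosimpleCover h d
lower-dimension {h} {d} cover n u (span , c , uc≡0 , c≢0 , ∣c∣≢) x =
  restrict (cover (suc (suc n)) u⁺ (span⁺ , c⁺ , kernel⁺ , c⁺≢0 , ∣c⁺∣≢) x⁺)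
  where
  u⁺ : Vector (ℤ^ (suc d)) (suc (suc n))
  u⁺ zero          zero    = 1ℤ
  u⁺ (suc zero)    zero    = ℤ.- (+ 2)
  u⁺ (suc (suc i)) zero    = 0ℤ
  u⁺ zero          (suc k) = 0ℤ
  u⁺ (suc zero)    (suc k) = 0ℤ
  u⁺ (suc (suc i)) (suc k) = u i k
  bound : ∃[ M ] All (λ i → ℤ.∣ c i ∣ ℕ.< M) (List.allFin n)
  bound = strict-bound (λ i → ℤ.∣ c i ∣) (List.allFin n)
  K : ℕ
  -- The extra `suc` keeps K positive when there are no generators.
  K = suc (proj₁ bound)
  ∣c∣<K : ∀ i → ℤ.∣ c i ∣ ℕ.< K
  ∣c∣<K i = ℕ.m<n⇒m<1+n (All.lookup (proj₂ bound) (List.∈-allFin i))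
  K<K+K : K ℕ.< K ℕ.+ K
  K<K+K = ℕ.m<m+n K ℕ.z<s
  c⁺ : ℤ^ (suc (suc n))
  c⁺ zero          = + (K ℕ.+ K)
  c⁺ (suc zero)    = + K
  c⁺ (suc (suc i)) = c i
  c⁺≢0 : ∀ i → c⁺ i ≢ 0ℤ
  c⁺≢0 zero          = λ ()
  c⁺≢0 (suc zero)    = λ ()
  c⁺≢0 (suc (suc i)) = c≢0 i
  ∣c⁺∣≢ : ∀ i j → i ≢ j → ℤ.∣ c⁺ i ∣ ≢ ℤ.∣ c⁺ j ∣
  ∣c⁺∣≢ zero          zero          i≢j = contradiction refl i≢j
  ∣c⁺∣≢ zero          (suc zero)    i≢j = ℕ.>⇒≢ K<K+K
  ∣c⁺∣≢ zero          (suc (suc j)) i≢j = ℕ.>⇒≢ (ℕ.<-trans (∣c∣<K j) K<K+K)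
  ∣c⁺∣≢ (suc zero)    zero          i≢j = ℕ.<⇒≢ K<K+K
  ∣c⁺∣≢ (suc zero)    (suc zero)    i≢j = contradiction refl i≢j
  ∣c⁺∣≢ (suc zero)    (suc (suc j)) i≢j = ℕ.>⇒≢ (∣c∣<K j)
  ∣c⁺∣≢ (suc (suc i)) zero          i≢j = ℕ.<⇒≢ (ℕ.<-trans (∣c∣<K i) K<K+K)
  ∣c⁺∣≢ (suc (suc i)) (suc zero)    i≢j = ℕ.<⇒≢ (∣c∣<K i)
  ∣c⁺∣≢ (suc (suc i)) (suc (suc j)) i≢j = ∣c∣≢ i j (i≢j ∘ cong (λ l → suc (suc l)))
  kernel⁺ : Kernel (column u⁺) c⁺
  kernel⁺ zero = trans
    (cong (λ z → + (K ℕ.+ K) ℤ.* 1ℤ ℤ.+ (+ K ℤ.* ℤ.- (+ 2) ℤ.+ z)) (ℤᴸ.dot-zeroʳ c (λ _ → refl)))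
    (solve 1 (λ k → (k :+ k) :* con 1ℤ :+ (k :* con (ℤ.- (+ 2)) :+ con 0ℤ) := con 0ℤ) refl (+ K))
    where open ℤSolver.+-*-Solver
  kernel⁺ (suc k) = trans (cong (λ z → + (K ℕ.+ K) ℤ.* 0ℤ ℤ.+ (+ K ℤ.* 0ℤ ℤ.+ z)) (uc≡0 k))
    (solve 1 (λ k → (k :+ k) :* con 0ℤ :+ (k :* con 0ℤ :+ con 0ℤ) := con 0ℤ) refl (+ K))
    where open ℤSolver.+-*-Solver
  span⁺ : DualSpanning u⁺
  span⁺ f fu⁺≡0 = λ { zero → f₀≡0 ; (suc k) → span (f ∘ suc) fu≡0 k }
    where
    open ℤSolver.+-*-Solver
    f₀≡0 : f zero ≡ 0ℤ
    f₀≡0 = begin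
      f zero                            ≡⟨ solve 1 (λ f → f := f :* con 1ℤ :+ con 0ℤ) refl (f zero) ⟩
      f zero ℤ.* 1ℤ ℤ.+ 0ℤ              ≡⟨ cong (λ z → f zero ℤ.* 1ℤ ℤ.+ z) (ℤᴸ.dot-zeroʳ (f ∘ suc) (λ _ → refl)) ⟨
      f • u⁺ zero                       ≡⟨ fu⁺≡0 zero ⟩
      0ℤ                                ∎
      where open ≡-Reasoning
    fu≡0 : ∀ i → (f ∘ suc) • u i ≡ 0ℤ
    fu≡0 i = trans (solve 2 (λ f a → a := f :* con 0ℤ :+ a) refl (f zero) ((f ∘ suc) • u i)) (fu⁺≡0 (suc (suc i)))
  x⁺ : ℝ^ (suc d)
  x⁺ zero    = 0ᵣ
  x⁺ (suc k) = x k
  restrict : Reach h u⁺ x⁺ → Reach h u x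
  restrict (z , σ , σ≤h , x⁺≃) = z ∘ suc , (λ i → σ (suc (suc i))) , (λ i → σ≤h (suc (suc i))) , λ k →
    ℝᴿ.trans (x⁺≃ (suc k)) (ℝᴿ.+-congʳ (pointwise-≃ λ n →
      solve 3 (λ a b c → a :* con 0ℚ :+ (b :* con 0ℚ :+ c) := c) refl
        (seq (σ zero) n) (seq (σ (suc zero)) n) (seq (combℝ (λ i → σ (suc (suc i))) u k) n)))
    where open +-*-Solver

-- The covering argument along a long lattice segment

-- τ is the difference of the coefficients of two points of the zonotope, which is all that is kept
-- of the segment between them; w need not be primitive.
record LongSegment {n d} (u : Vector (ℤ^ d) n) (K : ℕ) : Set where
  field
    w      : ℤ^ d
    index  : Fin d
    w≢0    : w index ≢ 0ℤ
    τ      : ℝ^ n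
    ∣τ∣≤1  : ∀ i → ∣ τ i ∣ᵣ ≲ 1ᵣ
    τu≃Kw  : ∀ k → combℝ τ u k ≃ fromℤ (+ K ℤ.* w k)

module Project {m} {w : ℤ^ (suc m)} (split : Splitting w) where
  open Splitting split public

  project : ∀ {n} → Vector (ℤ^ (suc m)) n → Vector (ℤ^ m) n
  project u i l = u i • column P l

  -- A form vanishing on the projections pulls back along P to a form vanishing on u, hence to zero,
  -- and evaluation on the section S recovers it.
  project-dualSpanning : ∀ {n} (u : Vector (ℤ^ (suc m)) n) → DualSpanning u → DualSpanning (project u)
  project-dualSpanning u span f fPu≡0 j = begin
    f j                              ≡⟨ ℤᴸ.dot-δ f j ⟨
    f • (λ l → δ l j)                ≡⟨ ℤᴸ.dot-congʳ f (λ l → trans (δ-sym l j) (trans (sym (PS j l)) (•-comm (S j) (column P l)))) ⟩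
    f • (λ l → column P l • S j)     ≡⟨ ℤᴸ.dot-dot f (column P) (S j) ⟨
    (λ k → f • P k) • S j            ≡⟨ ℤᴸ.dot-zeroˡ (S j) (span (λ k → f • P k) λ i →
      trans (ℤᴸ.dot-dot f (column P) (u i))
        (trans (ℤᴸ.dot-congʳ f (λ l → •-comm (column P l) (u i))) (fPu≡0 i))) ⟩
    0ℤ                               ∎
    where open ≡-Reasoning

  project-kernel : ∀ {n} (u : Vector (ℤ^ (suc m)) n) {c} → Kernel (column u) c → Kernel (column (project u)) c
  project-kernel u {c} uc≡0 l = trans (sym (ℤᴸ.dot-dot c u (column P l))) (ℤᴸ.dot-zeroˡ (column P l) uc≡0)

-- Lift the lattice point by S. What remains of x after subtracting this and the combination with
-- coefficients σ projects to 0, so it is T e. Rounding T to the nearest integer leaves θ e with θ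
-- at most ½ in absolute value, and the long segment produces θ e with coefficients at most κ / 2.
lift-reach : ExcludedMiddle 0ℓ → ∀ {m n} (u : Vector (ℤ^ (suc m)) n) {K κ} → κ ℚ.* (+ K / 1) ≡ 1ℚ → 0ℚ ℚ.≤ κ →
  (seg : LongSegment u K) (split : Splitting (LongSegment.w seg)) → ∀ h x →
  Reach h (Project.project split u) (λ l → ℝᴸ.dot x (column (Splitting.P split) l)) → Reach (h ℚ.+ ½ ℚ.* κ) u x
lift-reach em {m} {n} u {K} {κ} κK≡1 0≤κ seg split h x (z′ , σ , σ≤h , Px≃) = z , σ⁺ , σ⁺≤ , x≃
  where
  open LongSegment seg
  open Project split
  open ≃-Reasoning
  Sz : ℤ^ (suc m)
  Sz k = z′ • column S k
  y : ℝ^ (suc m)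
  y k = (x k +ᵣ -ᵣ combℝ σ u k) +ᵣ -ᵣ fromℤ (Sz k)
  PSz≡z : ∀ l → Sz • column P l ≡ z′ l
  PSz≡z l = trans (ℤᴸ.dot-dot z′ S (column P l)) (trans (ℤᴸ.dot-congʳ z′ (λ j → PS j l)) (ℤᴸ.dot-δ z′ l))
  Py≃0 : ∀ l → ℝᴸ.dot y (column P l) ≃ 0ᵣ
  Py≃0 l = begin
    ℝᴸ.dot y (column P l)
      ≈⟨ ℝᴸ.dot-+ˡ (λ k → x k +ᵣ -ᵣ combℝ σ u k) (λ k → -ᵣ fromℤ (Sz k)) (column P l) ⟩
    ℝᴸ.dot (λ k → x k +ᵣ -ᵣ combℝ σ u k) (column P l) +ᵣ ℝᴸ.dot (λ k → -ᵣ fromℤ (Sz k)) (column P l)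
      ≈⟨ ℝᴿ.+-cong (ℝᴸ.dot-+ˡ x (λ k → -ᵣ combℝ σ u k) (column P l)) (ℝᴸ.dot-negˡ (fromℤ ∘ Sz) (column P l)) ⟩
    (ℝᴸ.dot x (column P l) +ᵣ ℝᴸ.dot (λ k → -ᵣ combℝ σ u k) (column P l)) +ᵣ -ᵣ ℝᴸ.dot (fromℤ ∘ Sz) (column P l)
      ≈⟨ ℝᴿ.+-cong (ℝᴿ.+-cong (Px≃ l) (ℝᴿ.trans (ℝᴸ.dot-negˡ (combℝ σ u) (column P l)) (ℝᴿ.-‿cong (ℝᴸ.dot-dot σ u (column P l)))))
           (ℝᴿ.-‿cong (ℝᴿ.trans (ℝᴿ.sym (ℝᴸ.dot-ι Sz (column P l))) (ℝᴿ.reflexive (cong fromℤ (PSz≡z l))))) ⟩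
    ((combℝ σ (project u) l +ᵣ fromℤ (z′ l)) +ᵣ -ᵣ combℝ σ (project u) l) +ᵣ -ᵣ fromℤ (z′ l)
      ≈⟨ pointwise-≃ (λ n → solve 2 (λ a b → a :+ b :- a :- b := con 0ℚ) refl (seq (combℝ σ (project u) l) n) (z′ l / 1)) ⟩
    0ᵣ ∎
    where open +-*-Solver
  T : ℝ
  T = ℝᴸ.dot y φ
  y≃Te : ∀ k → y k ≃ fromℤ (e k) *ᵣ T
  y≃Te k = begin
    y k
      ≈⟨ ℝᴸ.dot-δ y k ⟨
    ℝᴸ.dot y (λ i → δ i k)
      ≈⟨ ℝᴸ.dot-congʳ y (λ i → trans (sym (φe+SP i k)) (cong (ℤ._+ P i • column S k) (ℤ.*-comm (φ i) (e k)))) ⟩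
    ℝᴸ.dot y (λ i → e k ℤ.* φ i ℤ.+ P i • column S k)
      ≈⟨ ℝᴸ.dot-+ʳ y (λ i → e k ℤ.* φ i) (λ i → P i • column S k) ⟩
    ℝᴸ.dot y (λ i → e k ℤ.* φ i) +ᵣ ℝᴸ.dot y (λ i → P i • column S k)
      ≈⟨ ℝᴿ.+-cong (ℝᴸ.dot-*ʳ y (e k) φ) (ℝᴿ.sym (ℝᴸ.dot-dot y P (column S k))) ⟩
    fromℤ (e k) *ᵣ T +ᵣ ℝᴸ.dot (λ l → ℝᴸ.dot y (column P l)) (column S k)
      ≈⟨ ℝᴿ.+-congˡ (ℝᴸ.dot-zeroˡ (column S k) Py≃0) ⟩
    fromℤ (e k) *ᵣ T +ᵣ 0ᵣ
      ≈⟨ ℝᴿ.+-identityʳ (fromℤ (e k) *ᵣ T) ⟩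
    fromℤ (e k) *ᵣ T ∎
  g≢0 : g ≢ 0ℤ
  g≢0 g≡0 = w≢0 (trans (w≡ge index) (cong (ℤ._* e index) g≡0))
  r : ℚ
  r = proj₁ (1/ℤ g≢0)
  m₀ : ℤ
  m₀ = proj₁ (nearest-integer em T)
  θ η : ℝ
  θ = T +ᵣ -ᵣ fromℤ m₀
  -- Since κ K = 1 and r g = 1, the factor κ r takes K w = K g e to e; as r is at most 1 in absolute
  -- value, a non-primitive w costs nothing.
  η = fromℚ (κ ℚ.* r) *ᵣ θ
  z : ℤ^ (suc m)
  z k = Sz k ℤ.+ e k ℤ.* m₀
  σ⁺ : ℝ^ n
  σ⁺ i = σ i +ᵣ η *ᵣ τ i
  ∣κr∣≤κ : ℚ.∣ κ ℚ.* r ∣ ℚ.≤ κ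
  ∣κr∣≤κ = subst₂ ℚ._≤_ (sym (ℚ.∣p*q∣≡∣p∣*∣q∣ κ r)) (trans (ℚ.*-identityʳ ℚ.∣ κ ∣) (ℚ.0≤p⇒∣p∣≡p 0≤κ))
    (ℚ.*-monoˡ-≤-nonNeg ℚ.∣ κ ∣ {{ℚ.∣-∣-nonNeg κ}} (proj₂ (proj₂ (1/ℤ g≢0))))
  σ⁺≤ : ∀ i → ∣ σ⁺ i ∣ᵣ ≲ fromℚ (h ℚ.+ ½ ℚ.* κ)
  σ⁺≤ i = ≲-resp-≃ ≃-refl
    (pointwise-≃ λ _ → solve 2 (λ h κ → h :+ κ :* con ½ :* con 1ℚ := h :+ con ½ :* κ) refl h κ)
    (∣x+y∣≲ (σ≤h i) (∣x*y∣≲ (∣x*y∣≲ (∣fromℚ∣≲ ∣κr∣≤κ) (proj₂ (nearest-integer em T))) (∣τ∣≤1 i)))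
    where open +-*-Solver
  κrKg≡1 : ∀ k → κ ℚ.* r ℚ.* ((+ K ℤ.* w k) / 1) ≡ e k / 1
  κrKg≡1 k = trans (cong (κ ℚ.* r ℚ.*_) (trans (/1-homo-* (+ K) (w k))
      (cong (+ K / 1 ℚ.*_) (trans (cong (_/ 1) (w≡ge k)) (/1-homo-* g (e k))))))
    (trans (solve 5 (λ κ r K g e → κ :* r :* (K :* (g :* e)) := κ :* K :* (r :* g) :* e) refl
        κ r (+ K / 1) (g / 1) (e k / 1))
      (trans (cong (ℚ._* (e k / 1)) (trans (cong₂ ℚ._*_ κK≡1 (proj₁ (proj₂ (1/ℤ g≢0)))) (ℚ.*-identityˡ 1ℚ)))
        (ℚ.*-identityˡ (e k / 1))))
    where open +-*-Solver
  ητu≃ : ∀ k → combℝ (λ i → η *ᵣ τ i) u k ≃ fromℤ (e k) *ᵣ θ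
  ητu≃ k = begin
    combℝ (λ i → η *ᵣ τ i) u k                      ≈⟨ ℝᴸ.dot-*ˡ η τ (column u k) ⟩
    η *ᵣ combℝ τ u k                                ≈⟨ ℝᴿ.*-congˡ (τu≃Kw k) ⟩
    fromℚ (κ ℚ.* r) *ᵣ θ *ᵣ fromℤ (+ K ℤ.* w k)     ≈⟨ pointwise-≃ (λ n → trans
      (solve 3 (λ a b c → a :* b :* c := a :* c :* b) refl (κ ℚ.* r) (seq θ n) ((+ K ℤ.* w k) / 1))
      (cong (ℚ._* seq θ n) (κrKg≡1 k))) ⟩
    fromℤ (e k) *ᵣ θ                                ∎
    where open +-*-Solver
  x≃ : ∀ k → x k ≃ combℝ σ⁺ u k +ᵣ fromℤ (z k)
  x≃ k = begin
    x k
      ≈⟨ pointwise-≃ (λ n → solve 3 (λ x a b → x := a :+ (x :- a :- b) :+ b) refl (seq (x k) n) (seq (combℝ σ u k) n) (Sz k / 1)) ⟩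
    (combℝ σ u k +ᵣ y k) +ᵣ fromℤ (Sz k)
      ≈⟨ ℝᴿ.+-congʳ (ℝᴿ.+-congˡ (y≃Te k)) ⟩
    (combℝ σ u k +ᵣ fromℤ (e k) *ᵣ T) +ᵣ fromℤ (Sz k)
      ≈⟨ pointwise-≃ (λ n → solve 5 (λ a b e t m → a :+ e :* t :+ b := a :+ e :* (t :- m) :+ (b :+ e :* m)) refl
           (seq (combℝ σ u k) n) (Sz k / 1) (e k / 1) (seq T n) (m₀ / 1)) ⟩
    (combℝ σ u k +ᵣ fromℤ (e k) *ᵣ θ) +ᵣ (fromℤ (Sz k) +ᵣ fromℤ (e k) *ᵣ fromℤ m₀)
      ≈⟨ ℝᴿ.+-cong (ℝᴿ.+-congˡ (ℝᴿ.sym (ητu≃ k))) (pointwise-≃ λ _ → sym (trans (/1-homo-+ (Sz k) (e k ℤ.* m₀))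
           (cong (Sz k / 1 ℚ.+_) (/1-homo-* (e k) m₀)))) ⟩
    (combℝ σ u k +ᵣ combℝ (λ i → η *ᵣ τ i) u k) +ᵣ fromℤ (z k)
      ≈⟨ ℝᴿ.+-congʳ (ℝᴸ.dot-+ˡ σ (λ i → η *ᵣ τ i) (column u k)) ⟨
    combℝ σ⁺ u k +ᵣ fromℤ (z k) ∎
    where open +-*-Solver

-- The center of a zonotope

δ-refl : ∀ {n} (i : Fin n) → δ i i ≡ 1ℤ
δ-refl zero    = refl
δ-refl (suc i) = δ-refl i

δ-punchInᵢ : ∀ {n} j (l : Fin n) → δ (punchIn j l) j ≡ 0ℤ
δ-punchInᵢ zero    l       = refl
δ-punchInᵢ (suc j) zero    = refl
δ-punchInᵢ (suc j) (suc l) = δ-punchInᵢ j l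

δ-punchIn : ∀ {n} j (l k : Fin n) → δ (punchIn j l) (punchIn j k) ≡ δ l k
δ-punchIn zero    l       k       = refl
δ-punchIn (suc j) zero    zero    = refl
δ-punchIn (suc j) zero    (suc k) = refl
δ-punchIn (suc j) (suc l) zero    = refl
δ-punchIn (suc j) (suc l) (suc k) = δ-punchIn j l k

punchIn-elim : ∀ {n} (j : Fin (suc n)) (P : Fin (suc n) → Set) → P j → (∀ l → P (punchIn j l)) → ∀ i → P i
punchIn-elim j P Pj Pl i with j Fin.≟ i
... | yes refl = Pj
... | no j≢i = subst P (Fin.punchIn-punchOut j≢i) (Pl (punchOut j≢i))

signOf² : ∀ s → signOf s ℤ.* signOf s ≡ 1ℤ
signOf² true  = refl
signOf² false = refl

∣signOf∣ : ∀ s → ℚ.∣ signOf s / 1 ∣ ≡ 1ℚ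
∣signOf∣ true  = refl
∣signOf∣ false = refl

-- Replacing u i and u j by u i + s u j moves the center by ½ (1 - s) u j; integrality of this
-- factor makes the move a lattice vector.
½[1-signOf] : ∀ s → ∃[ η ] ½ ℚ.* (1ℚ ℚ.- signOf s / 1) ≡ η / 1
½[1-signOf] true  = 0ℤ , refl
½[1-signOf] false = 1ℤ , refl

-- When two coordinates agree up to sign on all dependences of u, the
-- corresponding two generators can be merged into one; the result lies on the
-- hyperplane f = 0, and is rewritten in coordinates of this hyperplane.
module Merged {m n} (u : Vector (ℤ^ (suc m)) (suc n)) (j : Fin (suc n)) (k : Fin n) (s : Bool)
  (f : ℤ^ (suc m)) (a : ℤ) (a≢0 : a ≢ 0ℤ)
  (fu : ∀ i → f • u i ≡ a ℤ.* (δ i (punchIn j k) ℤ.- signOf s ℤ.* δ i j))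
  (split : Splitting f) where

  open Splitting split

  private
    ε = signOf s
    i = punchIn j k
    w : Vector (ℤ^ (suc m)) n
    w = merge u j k ε

  generators : Vector (ℤ^ m) n
  generators l r = w l • S r

  private
    f•i : f • u i ≡ a
    f•i = trans (fu i) (trans (cong₂ (λ p q → a ℤ.* (p ℤ.- ε ℤ.* q)) (δ-refl i) (δ-punchInᵢ j k))
      (solve 2 (λ a e → a :* (con 1ℤ :- e :* con 0ℤ) := a) refl a ε))
      where open ℤSolver.+-*-Solver

    x•w : ∀ x l → x • w l ≡ x • u (punchIn j l) ℤ.+ ε ℤ.* δ l k ℤ.* (x • u j)
    x•w x l = trans (ℤᴸ.dot-+ʳ x (u (punchIn j l)) (λ r → ε ℤ.* u j r ℤ.* δ l k))
      (cong (λ y → x • u (punchIn j l) ℤ.+ y) (trans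
        (ℤᴸ.dot-congʳ x (λ r → solve 3 (λ e u d → e :* u :* d := e :* d :* u) refl ε (u j r) (δ l k)))
        (ℤᴸ.dot-*ʳ x (ε ℤ.* δ l k) (u j))))
      where open ℤSolver.+-*-Solver

    f•w≡0 : ∀ l → f • w l ≡ 0ℤ
    f•w≡0 l = begin
      f • w l
        ≡⟨ x•w f l ⟩
      f • u (punchIn j l) ℤ.+ ε ℤ.* δ l k ℤ.* (f • u j)
        ≡⟨ cong₂ (λ p q → p ℤ.+ ε ℤ.* δ l k ℤ.* q) (fu (punchIn j l)) (fu j) ⟩
      a ℤ.* (δ (punchIn j l) i ℤ.- ε ℤ.* δ (punchIn j l) j) ℤ.+ ε ℤ.* δ l k ℤ.* (a ℤ.* (δ j i ℤ.- ε ℤ.* δ j j))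
        ≡⟨ cong₂ (λ p q → a ℤ.* (p ℤ.- ε ℤ.* q) ℤ.+ ε ℤ.* δ l k ℤ.* (a ℤ.* (δ j i ℤ.- ε ℤ.* δ j j)))
             (δ-punchIn j l k) (δ-punchInᵢ j l) ⟩
      a ℤ.* (δ l k ℤ.- ε ℤ.* 0ℤ) ℤ.+ ε ℤ.* δ l k ℤ.* (a ℤ.* (δ j i ℤ.- ε ℤ.* δ j j))
        ≡⟨ cong₂ (λ p q → a ℤ.* (δ l k ℤ.- ε ℤ.* 0ℤ) ℤ.+ ε ℤ.* δ l k ℤ.* (a ℤ.* (p ℤ.- ε ℤ.* q)))
             (trans (δ-sym j i) (δ-punchInᵢ j k)) (δ-refl j) ⟩
      a ℤ.* (δ l k ℤ.- ε ℤ.* 0ℤ) ℤ.+ ε ℤ.* δ l k ℤ.* (a ℤ.* (0ℤ ℤ.- ε ℤ.* 1ℤ))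
        ≡⟨ solve 3 (λ a d e → a :* (d :- e :* con 0ℤ) :+ e :* d :* (a :* (con 0ℤ :- e :* con 1ℤ))
             := a :* d :* (con 1ℤ :- e :* e)) refl a (δ l k) ε ⟩
      a ℤ.* δ l k ℤ.* (1ℤ ℤ.- ε ℤ.* ε)
        ≡⟨ cong (λ p → a ℤ.* δ l k ℤ.* (1ℤ ℤ.- p)) (signOf² s) ⟩
      a ℤ.* δ l k ℤ.* 0ℤ
        ≡⟨ ℤ.*-zeroʳ (a ℤ.* δ l k) ⟩
      0ℤ ∎
      where
      open ≡-Reasoning
      open ℤSolver.+-*-Solver

    f•≡ge• : ∀ x → f • x ≡ g ℤ.* (e • x)
    f•≡ge• x = trans (ℤᴸ.dot-congˡ x w≡ge) (ℤᴸ.dot-*ˡ g e x)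

    e•i≢0 : e • u i ≢ 0ℤ
    e•i≢0 e•i≡0 = a≢0 (trans (sym f•i) (trans (f•≡ge• (u i)) (trans (cong (g ℤ.*_) e•i≡0) (ℤ.*-zeroʳ g))))

    g≢0 : g ≢ 0ℤ
    g≢0 g≡0 = a≢0 (trans (sym f•i) (trans (f•≡ge• (u i))
      (trans (cong (ℤ._* (e • u i)) g≡0) (ℤ.*-zeroˡ (e • u i)))))

    e•w≡0 : ∀ l → e • w l ≡ 0ℤ
    e•w≡0 l = a*b≡0⇒b≡0 g (e • w l) g≢0 (trans (sym (f•≡ge• (w l))) (f•w≡0 l))

    generators•P : ∀ l r → generators l • P r ≡ w l r
    generators•P l r = sym (begin
      w l r
        ≡⟨ ℤᴸ.dot-δ (w l) r ⟨
      w l • (λ k → δ k r)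
        ≡⟨ ℤᴸ.dot-congʳ (w l) (λ k → trans (δ-sym k r) (sym (φe+SP r k))) ⟩
      w l • (λ k → φ r ℤ.* e k ℤ.+ P r • (λ j → S j k))
        ≡⟨ ℤᴸ.dot-+ʳ (w l) (λ k → φ r ℤ.* e k) (λ k → P r • (λ j → S j k)) ⟩
      w l • (λ k → φ r ℤ.* e k) ℤ.+ w l • (λ k → P r • (λ j → S j k))
        ≡⟨ cong₂ ℤ._+_ (trans (ℤᴸ.dot-*ʳ (w l) (φ r) e) (cong (φ r ℤ.*_) (trans (•-comm (w l) e) (e•w≡0 l))))
             (trans (•-comm (w l) (λ k → P r • (λ j → S j k))) (ℤᴸ.dot-dot (P r) S (w l))) ⟩
      φ r ℤ.* 0ℤ ℤ.+ P r • (λ j → S j • w l)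
        ≡⟨ cong₂ ℤ._+_ (ℤ.*-zeroʳ (φ r)) (trans (ℤᴸ.dot-congʳ (P r) (λ j → •-comm (S j) (w l)))
             (•-comm (P r) (generators l))) ⟩
      0ℤ ℤ.+ generators l • P r
        ≡⟨ ℤ.+-identityˡ (generators l • P r) ⟩
      generators l • P r ∎)
      where open ≡-Reasoning

  -- The pullback X of h vanishes on the merged collection, and so does e. Some combination F = c X
  -- - b e therefore also vanishes on u i, hence on u j, since u i and u j are tied by the merged
  -- vector. So F = 0, and on the columns of P, where e vanishes, this reads c h = 0 with c
  -- non-zero.
  dualSpanning : DualSpanning u → DualSpanning generators
  dualSpanning span h h•≡0 r = hr≡0
    where
    open ≡-Reasoning
    X F : ℤ^ (suc m)
    X t = h • (λ l → S l t)
    b = X • u i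
    c = e • u i
    F t = c ℤ.* X t ℤ.+ ℤ.- b ℤ.* e t
    X•w≡0 : ∀ l → X • w l ≡ 0ℤ
    X•w≡0 l = trans (ℤᴸ.dot-dot h S (w l)) (trans (ℤᴸ.dot-congʳ h (λ r → •-comm (S r) (w l))) (h•≡0 l))
    F•w≡0 : ∀ l → F • w l ≡ 0ℤ
    F•w≡0 l = trans (•-linear c (ℤ.- b) X e (w l)) (trans (cong₂ (λ p q → c ℤ.* p ℤ.+ ℤ.- b ℤ.* q) (X•w≡0 l) (e•w≡0 l))
      (cong₂ ℤ._+_ (ℤ.*-zeroʳ c) (ℤ.*-zeroʳ (ℤ.- b))))
    F•i≡0 : F • u i ≡ 0ℤ
    F•i≡0 = trans (•-linear c (ℤ.- b) X e (u i)) (solve 2 (λ b c → c :* b :+ :- b :* c := con 0ℤ) refl b c)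
      where open ℤSolver.+-*-Solver
    F•j≡0 : F • u j ≡ 0ℤ
    F•j≡0 = begin
      F • u j
        ≡⟨ trans (cong (ℤ._* (F • u j)) (signOf² s)) (ℤ.*-identityˡ (F • u j)) ⟨
      ε ℤ.* ε ℤ.* (F • u j)
        ≡⟨ solve 2 (λ e x → e :* e :* x := e :* (con 0ℤ :+ e :* con 1ℤ :* x)) refl ε (F • u j) ⟩
      ε ℤ.* (0ℤ ℤ.+ ε ℤ.* 1ℤ ℤ.* (F • u j))
        ≡⟨ cong (ε ℤ.*_) (trans (cong₂ (λ p q → p ℤ.+ ε ℤ.* q ℤ.* (F • u j)) (sym F•i≡0) (sym (δ-refl k)))
             (trans (sym (x•w F k)) (F•w≡0 k))) ⟩
      ε ℤ.* 0ℤ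
        ≡⟨ ℤ.*-zeroʳ ε ⟩
      0ℤ ∎
      where open ℤSolver.+-*-Solver
    F•p≡0 : ∀ l → F • u (punchIn j l) ≡ 0ℤ
    F•p≡0 l = begin
      F • u (punchIn j l)
        ≡⟨ solve 2 (λ x y → x := x :+ y :* con 0ℤ) refl (F • u (punchIn j l)) (ε ℤ.* δ l k) ⟩
      F • u (punchIn j l) ℤ.+ ε ℤ.* δ l k ℤ.* 0ℤ
        ≡⟨ cong (λ z → F • u (punchIn j l) ℤ.+ ε ℤ.* δ l k ℤ.* z) F•j≡0 ⟨
      F • u (punchIn j l) ℤ.+ ε ℤ.* δ l k ℤ.* (F • u j)
        ≡⟨ trans (sym (x•w F l)) (F•w≡0 l) ⟩
      0ℤ ∎
      where open ℤSolver.+-*-Solver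
    F≡0 : ∀ t → F t ≡ 0ℤ
    F≡0 = span F (punchIn-elim j (λ t → F • u t ≡ 0ℤ) F•j≡0 F•p≡0)
    X•P : X • column P r ≡ h r
    X•P = trans (ℤᴸ.dot-dot h S (column P r)) (trans (ℤᴸ.dot-congʳ h (λ l → PS l r)) (ℤᴸ.dot-δ h r))
    c*hr≡0 : c ℤ.* h r ≡ 0ℤ
    c*hr≡0 = begin
      c ℤ.* h r
        ≡⟨ solve 3 (λ b c h → c :* h := c :* h :+ :- b :* con 0ℤ) refl b c (h r) ⟩
      c ℤ.* h r ℤ.+ ℤ.- b ℤ.* 0ℤ
        ≡⟨ cong₂ (λ p q → c ℤ.* p ℤ.+ ℤ.- b ℤ.* q) X•P (Pe r) ⟨
      c ℤ.* (X • column P r) ℤ.+ ℤ.- b ℤ.* (e • column P r)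
        ≡⟨ •-linear c (ℤ.- b) X e (column P r) ⟨
      F • column P r
        ≡⟨ ℤᴸ.dot-zeroˡ (column P r) F≡0 ⟩
      0ℤ ∎
      where open ℤSolver.+-*-Solver
    hr≡0 : h r ≡ 0ℤ
    hr≡0 = a*b≡0⇒b≡0 c (h r) e•i≢0 c*hr≡0

  -- Applying f to the dependence gives a (c i - ε c j) = 0, so c j = ε c i and c i (u i + ε u j) =
  -- c i u i + c j u j.
  kernel : ∀ c → Kernel (column u) c → Kernel (column generators) (removeAt c j)
  kernel c uc≡0 r = trans (sym (ℤᴸ.dot-dot (removeAt c j) w (S r)))
    (ℤᴸ.dot-zeroˡ (S r) λ t → trans (ℤᴸ.dot-merge u j k ε (removeAt c j) t)
      (trans (ℤᴸ.dot-congˡ (column u t) inserted) (uc≡0 t)))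
    where
    open ≡-Reasoning
    open ℤSolver.+-*-Solver
    cᵢ-εcⱼ≡0 : c i ℤ.- ε ℤ.* c j ≡ 0ℤ
    cᵢ-εcⱼ≡0 = a*b≡0⇒b≡0 a (c i ℤ.- ε ℤ.* c j) a≢0 (begin
      a ℤ.* (c i ℤ.- ε ℤ.* c j)                       ≡⟨ cong (a ℤ.*_) (•-δ-difference c i j ε) ⟨
      a ℤ.* (c • (λ l → δ l i ℤ.- ε ℤ.* δ l j))       ≡⟨ ℤᴸ.dot-*ʳ c a (λ l → δ l i ℤ.- ε ℤ.* δ l j) ⟨
      c • (λ l → a ℤ.* (δ l i ℤ.- ε ℤ.* δ l j))       ≡⟨ ℤᴸ.dot-congʳ c (λ l → trans (•-comm (u l) f) (fu l)) ⟨
      c • (λ l → u l • f)                             ≡⟨ ℤᴸ.dot-dot c u f ⟨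
      (λ t → c • column u t) • f                      ≡⟨ ℤᴸ.dot-zeroˡ f uc≡0 ⟩
      0ℤ                                              ∎)
    εcᵢ≡cⱼ : ε ℤ.* c i ≡ c j
    εcᵢ≡cⱼ = begin
      ε ℤ.* c i                                          ≡⟨ solve 3 (λ e x y → e :* x := e :* (x :- e :* y) :+ e :* e :* y) refl ε (c i) (c j) ⟩
      ε ℤ.* (c i ℤ.- ε ℤ.* c j) ℤ.+ ε ℤ.* ε ℤ.* c j      ≡⟨ cong₂ (λ p q → ε ℤ.* p ℤ.+ q ℤ.* c j) cᵢ-εcⱼ≡0 (signOf² s) ⟩
      ε ℤ.* 0ℤ ℤ.+ 1ℤ ℤ.* c j                            ≡⟨ solve 2 (λ e x → e :* con 0ℤ :+ con 1ℤ :* x := x) refl ε (c j) ⟩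
      c j                                                ∎
    inserted : insertAt (removeAt c j) j (ε ℤ.* c i) ≗ c
    inserted t = trans (cong (λ x → insertAt (removeAt c j) j x t) εcᵢ≡cⱼ) (Vector.insertAt-removeAt c j t)

  -- A coefficient of the merged generator serves for u i and, up to sign, for u j, so the bound h
  -- is unchanged.
  reach : ∀ {h} → Reach h generators (center generators) → Reach h u (center u)
  reach {h} (z′ , σ′ , σ′≤h , center≃) = z , σ , σ≤h , x≃
    where
    open ≃-Reasoning
    η = proj₁ (½[1-signOf] s)
    z : ℤ^ (suc m)
    z r = z′ • P r ℤ.+ η ℤ.* u j r
    σ : ℝ^ (suc n)
    σ = insertAt σ′ j (fromℤ ε *ᵣ σ′ k)
    σ≤h : ∀ t → ∣ σ t ∣ᵣ ≲ fromℚ h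
    σ≤h = punchIn-elim j (λ t → ∣ σ t ∣ᵣ ≲ fromℚ h)
      (subst (λ x → ∣ x ∣ᵣ ≲ fromℚ h) (sym (Vector.insertAt-lookup σ′ j _))
        (≲-resp-≃ (pointwise-≃ λ n → sym (trans (ℚ.∣p*q∣≡∣p∣*∣q∣ (ε / 1) (seq (σ′ k) n))
          (trans (cong (ℚ._* _) (∣signOf∣ s)) (ℚ.*-identityˡ _)))) ≃-refl (σ′≤h k)))
      (λ l → subst (λ x → ∣ x ∣ᵣ ≲ fromℚ h) (sym (Vector.insertAt-punchIn σ′ j _ l)) (σ′≤h l))
    dot-w : ∀ (x : ℝ^ n) r → ℝᴸ.dot x (column w r) ≃ ℝᴸ.dot (combℝ x generators) (P r)
    dot-w x r = ℝᴿ.sym (ℝᴿ.trans (ℝᴸ.dot-dot x generators (P r)) (ℝᴸ.dot-congʳ x (λ l → generators•P l r)))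
    ones : ∀ {n} → ℝ^ n
    ones _ = 1ᵣ
    x≃ : ∀ r → center u r ≃ combℝ σ u r +ᵣ fromℤ (z r)
    x≃ r = begin
      fromℚ ½ *ᵣ ℝᴸ.dot ones (column u r)
        ≈⟨ ℝᴿ.*-congˡ (ℝᴸ.dot-removeAt ones (column u r) j) ⟩
      fromℚ ½ *ᵣ (1ᵣ *ᵣ fromℤ (u j r) +ᵣ R)
        ≈⟨ pointwise-≃ (λ n → trans
             (solve 4 (λ h e v x → h :* (con 1ℚ :* v :+ x) := h :* (e :* con 1ℚ :* v :+ x) :+ h :* (con 1ℚ :- e) :* v) refl
               ½ (ε / 1) (u j r / 1) (seq R n))
             (cong (λ p → ½ ℚ.* (ε / 1 ℚ.* 1ℚ ℚ.* (u j r / 1) ℚ.+ seq R n) ℚ.+ p ℚ.* (u j r / 1)) (proj₂ (½[1-signOf] s)))) ⟩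
      fromℚ ½ *ᵣ (fromℤ ε *ᵣ 1ᵣ *ᵣ fromℤ (u j r) +ᵣ R) +ᵣ fromℤ η *ᵣ fromℤ (u j r)
        ≈⟨ ℝᴿ.+-congʳ (ℝᴿ.*-congˡ (ℝᴿ.trans (ℝᴸ.dot-merge u j k ε ones r) (ℝᴸ.dot-insertAt ones j (fromℤ ε *ᵣ 1ᵣ) (column u r)))) ⟨
      fromℚ ½ *ᵣ ℝᴸ.dot ones (column w r) +ᵣ fromℤ η *ᵣ fromℤ (u j r)
        ≈⟨ ℝᴿ.+-congʳ (ℝᴿ.trans (ℝᴿ.*-congˡ (dot-w ones r)) (ℝᴿ.sym (ℝᴸ.dot-*ˡ (fromℚ ½) (combℝ ones generators) (P r)))) ⟩
      ℝᴸ.dot (center generators) (P r) +ᵣ fromℤ η *ᵣ fromℤ (u j r)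
        ≈⟨ ℝᴿ.+-congʳ (ℝᴿ.trans (ℝᴸ.dot-congˡ (P r) center≃) (ℝᴸ.dot-+ˡ (combℝ σ′ generators) (fromℤ ∘ z′) (P r))) ⟩
      (ℝᴸ.dot (combℝ σ′ generators) (P r) +ᵣ ℝᴸ.dot (fromℤ ∘ z′) (P r)) +ᵣ fromℤ η *ᵣ fromℤ (u j r)
        ≈⟨ ℝᴿ.+-congʳ (ℝᴿ.+-cong (ℝᴿ.trans (ℝᴿ.sym (dot-w σ′ r)) (ℝᴸ.dot-merge u j k ε σ′ r)) (ℝᴿ.sym (ℝᴸ.dot-ι z′ (P r)))) ⟩
      (combℝ σ u r +ᵣ fromℤ (z′ • P r)) +ᵣ fromℤ η *ᵣ fromℤ (u j r)
        ≈⟨ ℝᴿ.+-assoc (combℝ σ u r) (fromℤ (z′ • P r)) (fromℤ η *ᵣ fromℤ (u j r)) ⟩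
      combℝ σ u r +ᵣ (fromℤ (z′ • P r) +ᵣ fromℤ η *ᵣ fromℤ (u j r))
        ≈⟨ ℝᴿ.+-congˡ (pointwise-≃ λ _ → sym (trans (/1-homo-+ (z′ • P r) (η ℤ.* u j r))
             (cong (λ y → (z′ • P r) / 1 ℚ.+ y) (/1-homo-* η (u j r))))) ⟩
      combℝ σ u r +ᵣ fromℤ (z r) ∎
      where
      open +-*-Solver
      R = ℝᴸ.dot ones (removeAt (column u r) j)

center-reach : ∀ {h} m → CosimpleCover h m → ∀ {n} (u : Vector (ℤ^ m) n) → DualSpanning u →
  ∀ c → Kernel (column u) c → (∀ i → c i ≢ 0ℤ) → Reach h u (center u)
center-reach m cover {zero} u span c uc≡0 c≢0 = cover 0 u (span , c , uc≡0 , (λ ()) , λ ()) (center u)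
center-reach m cover {suc n} u span c uc≡0 c≢0 with distinguish u c uc≡0 c≢0
center-reach m cover {suc n} u span c uc≡0 c≢0 | inj₂ cosimple = cover (suc n) u (span , cosimple) (center u)
-- In dimension 0 every dot product is empty, so `fu` at `punchIn j k` would read 0 = a.
center-reach zero cover {suc n} u span c uc≡0 c≢0 | inj₁ ((j , k , s) , f , a , a≢0 , fu) =
  contradiction (trans (solve 2 (λ a e → a := a :* (con 1ℤ :- e :* con 0ℤ)) refl a (signOf s))
    (trans (sym (cong₂ (λ p q → a ℤ.* (p ℤ.- signOf s ℤ.* q)) (δ-refl (punchIn j k)) (δ-punchInᵢ j k)))
      (sym (fu (punchIn j k))))) a≢0
  where open ℤSolver.+-*-Solver
center-reach (suc m) cover {suc n} u span c uc≡0 c≢0 | inj₁ ((j , k , s) , f , a , a≢0 , fu) =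
  reach (center-reach m (lower-dimension cover) generators (dualSpanning span)
    (removeAt c j) (kernel c uc≡0) (c≢0 ∘ punchIn j))
  where open Merged u j k s f a a≢0 fu (splitting f)

-- Counting lattice points

longSegment : ∀ {n d} (u : Vector (ℤ^ d) n) K .{{_ : ℕ.NonZero K}} {N} (p : Fin N → ℤ^ d) →
  Injective _≡_ _≗_ p → (∀ i → embed (p i) ∈ zonotope u) → K ℕ.^ d ℕ.< N → LongSegment u K
longSegment {n} {d} u K {N} p p-injective p∈Z K^d<N = segment (Fin.pigeonhole K^d<N residues)
  where
  residue : ℤ → Fin K
  residue a = fromℕ< (ℤ.n%ℕd<d a K)
  residues : Fin N → Fin (K ℕ.^ d)
  residues i = funToFin (λ k → residue (p i k))
  segment : (∃[ i ] ∃[ j ] (toℕ i ℕ.< toℕ j × residues i ≡ residues j)) → LongSegment u K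
  segment (i , j , i<j , eq) = record
    { w = w ; index = proj₁ nonzero ; w≢0 = proj₂ nonzero ; τ = τ ; ∣τ∣≤1 = ∣τ∣≤1 ; τu≃Kw = τu≃Kw }
    where
    w : ℤ^ d
    -- The remainders agree, so K times the difference of the quotients is p i - p j.
    w k = (p i k ℤ./ℕ K) ℤ.- (p j k ℤ./ℕ K)
    remainders : ∀ k → p i k ℤ.%ℕ K ≡ p j k ℤ.%ℕ K
    remainders k = trans (sym (Fin.toℕ-fromℕ< (ℤ.n%ℕd<d (p i k) K))) (trans (cong toℕ
      (trans (sym (Fin.finToFun-funToFin (λ k → residue (p i k)) k)) (trans (cong (λ x → finToFun x k) eq)
        (Fin.finToFun-funToFin (λ k → residue (p j k)) k)))) (Fin.toℕ-fromℕ< (ℤ.n%ℕd<d (p j k) K)))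
    Kw≡ : ∀ k → + K ℤ.* w k ≡ p i k ℤ.- p j k
    Kw≡ k = begin
      + K ℤ.* w k
        ≡⟨ solve 4 (λ K a b r → K :* (a :- b) := (r :+ a :* K) :- (r :+ b :* K)) refl
             (+ K) (p i k ℤ./ℕ K) (p j k ℤ./ℕ K) (+ (p i k ℤ.%ℕ K)) ⟩
      (+ (p i k ℤ.%ℕ K) ℤ.+ (p i k ℤ./ℕ K) ℤ.* + K) ℤ.- (+ (p i k ℤ.%ℕ K) ℤ.+ (p j k ℤ./ℕ K) ℤ.* + K)
        ≡⟨ cong₂ ℤ._-_ (ℤ.a≡a%ℕn+[a/ℕn]*n (p i k) K)
             (trans (ℤ.a≡a%ℕn+[a/ℕn]*n (p j k) K) (cong (λ r → + r ℤ.+ (p j k ℤ./ℕ K) ℤ.* + K) (sym (remainders k)))) ⟨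
      p i k ℤ.- p j k ∎
      where
      open ≡-Reasoning
      open ℤSolver.+-*-Solver
    nonzero : ∃[ k ] w k ≢ 0ℤ
    nonzero with Fin.all? (λ k → w k ℤ.≟ 0ℤ)
    ... | no w≢0 = Fin.¬∀⟶∃¬ _ _ (λ k → w k ℤ.≟ 0ℤ) w≢0
    ... | yes w≡0 = contradiction (p-injective λ k → ℤ.i-j≡0⇒i≡j (p i k) (p j k)
      (trans (sym (Kw≡ k)) (trans (cong (+ K ℤ.*_) (w≡0 k)) (ℤ.*-zeroʳ (+ K))))) (Fin.<⇒≢ i<j)
    t t′ τ : ℝ^ n
    t  = proj₁ (p∈Z i)
    t′ = proj₁ (p∈Z j)
    τ l = t l +ᵣ -ᵣ t′ l
    difference≤1 : ∀ {x y} → x ≲ 1ᵣ → 0ᵣ ≲ y → x +ᵣ -ᵣ y ≲ 1ᵣ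
    difference≤1 {x} {y} x≤1 0≤y = 0≲-⇒≲ (≲-resp-≃ (ℝᴿ.+-identityˡ 0ᵣ)
      (pointwise-≃ λ n → solve 2 (λ x y → (con 1ℚ :- x) :+ y := con 1ℚ :- (x :- y)) refl (seq x n) (seq y n))
      (+ᵣ-mono-≲ (≲⇒0≲- x≤1) 0≤y))
      where open +-*-Solver
    ∣τ∣≤1 : ∀ l → ∣ τ l ∣ᵣ ≲ 1ᵣ
    ∣τ∣≤1 l = ∣x∣≲
      (difference≤1 (wrap≲ (proj₂ (proj₁ (proj₂ (p∈Z i)) l))) (wrap≲ (proj₁ (proj₁ (proj₂ (p∈Z j)) l))))
      (≲-resp-≃ (pointwise-≃ λ n → solve 2 (λ x y → y :- x := :- (x :- y)) refl (seq (t l) n) (seq (t′ l) n)) ≃-refl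
        (difference≤1 {t′ l} {t l} (wrap≲ (proj₂ (proj₁ (proj₂ (p∈Z j)) l))) (wrap≲ (proj₁ (proj₁ (proj₂ (p∈Z i)) l)))))
      where open +-*-Solver
    τu≃Kw : ∀ k → combℝ τ u k ≃ fromℤ (+ K ℤ.* w k)
    τu≃Kw k = begin
      combℝ τ u k                             ≈⟨ ℝᴸ.dot-+ˡ t (λ l → -ᵣ t′ l) (column u k) ⟩
      combℝ t u k +ᵣ combℝ (λ l → -ᵣ t′ l) u k ≈⟨ ℝᴿ.+-cong (wrap≃ (proj₂ (proj₂ (p∈Z i)) k))
        (ℝᴿ.trans (ℝᴿ.-‿cong (wrap≃ (proj₂ (proj₂ (p∈Z j)) k))) (ℝᴿ.sym (ℝᴸ.dot-negˡ t′ (column u k)))) ⟨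
      fromℤ (p i k) +ᵣ -ᵣ fromℤ (p j k)       ≈⟨ pointwise-≃ (λ _ → trans (cong (p i k / 1 ℚ.+_) (sym (/1-homo-neg (p j k))))
        (trans (sym (/1-homo-+ (p i k) (ℤ.- p j k))) (cong (_/ 1) (sym (Kw≡ k))))) ⟩
      fromℤ (+ K ℤ.* w k)                     ∎
      where open ≃-Reasoning

generatesLattice⇒dualSpanning : ∀ {n d} (u : Vector (ℤ^ d) n) → GeneratesLattice u → DualSpanning u
generatesLattice⇒dualSpanning {d = d} u generates f fu≡0 k = begin
  f k                                  ≡⟨ ℤᴸ.dot-δ f k ⟨
  f • (λ l → δ l k)                    ≡⟨ •-comm f (λ l → δ l k) ⟩
  (λ l → δ l k) • f                    ≡⟨ ℤᴸ.dot-congˡ f (λ l → proj₂ (generates (λ l → δ l k)) l) ⟩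
  (λ l → a • column u l) • f           ≡⟨ ℤᴸ.dot-dot a u f ⟩
  a • (λ i → u i • f)                  ≡⟨ ℤᴸ.dot-zeroʳ a (λ i → trans (•-comm (u i) f) (fu≡0 i)) ⟩
  0ℤ                                   ∎
  where
  open ≡-Reasoning
  a = proj₁ (generates (λ l → δ l k))

linearlyIndependent⇒trivialKernel : ∀ {n d} (u : Vector (ℤ^ d) n) → LinearlyIndependent u →
  ∀ c → Kernel (column u) c → ∀ i → c i ≡ 0ℤ
linearlyIndependent⇒trivialKernel u independent c uc≡0 i = fromℤ-injective (wrap≃ (independent (fromℤ ∘ c)
  (λ k → unwrap≃ (ℝᴿ.trans (ℝᴿ.sym (ℝᴸ.dot-ι c (column u k))) (ℝᴿ.reflexive (cong fromℤ (uc≡0 k))))) i))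

-- If f k is non-zero, the generators without coordinate k are too many for their dimension and have
-- a dependence c. Applying f to the combination of the full generators gives 0, and only coordinate
-- k contributes, so c is a dependence of u itself.
linearlyIndependent⇒dualSpanning : ∀ {m} (u : Vector (ℤ^ (suc m)) (suc m)) → LinearlyIndependent u → DualSpanning u
linearlyIndependent⇒dualSpanning {m} u independent f fu≡0 k with f k ℤ.≟ 0ℤ
... | yes fₖ≡0 = fₖ≡0
... | no fₖ≢0 with nontrivial-dependence (λ i → removeAt (u i) k)
...   | c , (i , cᵢ≢0) , kernel = contradiction (linearlyIndependent⇒trivialKernel u independent c
  (punchIn-elim k (λ l → c • column u l ≡ 0ℤ) c•uₖ≡0 kernel) i) cᵢ≢0
  where
  open ≡-Reasoning
  fₖ[c•uₖ]≡0 : f k ℤ.* (c • column u k) ≡ 0ℤ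
  fₖ[c•uₖ]≡0 = begin
    f k ℤ.* (c • column u k)
      ≡⟨ ℤ.*-comm (f k) (c • column u k) ⟩
    (c • column u k) ℤ.* f k
      ≡⟨ ℤ.+-identityʳ ((c • column u k) ℤ.* f k) ⟨
    (c • column u k) ℤ.* f k ℤ.+ 0ℤ
      ≡⟨ cong (λ z → (c • column u k) ℤ.* f k ℤ.+ z) (ℤᴸ.dot-zeroˡ (removeAt f k) kernel) ⟨
    (c • column u k) ℤ.* f k ℤ.+ removeAt (λ l → c • column u l) k • removeAt f k
      ≡⟨ ℤᴸ.dot-removeAt (λ l → c • column u l) f k ⟨
    (λ l → c • column u l) • f
      ≡⟨ ℤᴸ.dot-dot c u f ⟩
    c • (λ i → u i • f)
      ≡⟨ ℤᴸ.dot-zeroʳ c (λ i → trans (•-comm (u i) f) (fu≡0 i)) ⟩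
    0ℤ ∎
  c•uₖ≡0 : c • column u k ≡ 0ℤ
  c•uₖ≡0 = a*b≡0⇒b≡0 (f k) (c • column u k) fₖ≢0 fₖ[c•uₖ]≡0

coveringRadius⇒cosimpleCover : ∀ d ρ →
  (∀ n (u : Vector (ℤ^ d) n) → Cosimple u → ∃[ μ ] (IsCoveringRadius (zonotope u) μ × μ ≤ᵣ fromℚ ρ)) →
  CosimpleCover (½ ℚ.* ρ) d
coveringRadius⇒cosimpleCover d ρ bound n u cosimple =
  coveringRadius⇒reach u ρ μ (proj₁ (proj₂ b)) (wrap≲ {μ} {fromℚ ρ} (proj₂ (proj₂ b)))
  where
  b = bound n u (integerCosimple⇒cosimple u cosimple)
  μ = proj₁ b

-- From coefficients in [-ρ/2, ρ/2] to dilates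

module Dilate {n d} (u : Vector (ℤ^ d) n) {ρ r : ℚ} (rρ≡1 : r ℚ.* ρ ≡ 1ℚ) (0≤r : 0ℚ ℚ.≤ r)
  (σ : ℝ^ n) (σ≤ : ∀ i → ∣ σ i ∣ᵣ ≲ fromℚ (½ ℚ.* ρ)) where
  open +-*-Solver

  h : ℝ
  h = fromℚ (½ ℚ.* ρ)

  t : ℝ^ n
  -- The affine map taking [-ρ / 2, ρ / 2] to [0, 1].
  t i = fromℚ r *ᵣ (σ i +ᵣ h)

  ρt≃σ+h : ∀ i → fromℚ ρ *ᵣ t i ≃ σ i +ᵣ h
  ρt≃σ+h i = pointwise-≃ λ n → trans
    (solve 3 (λ ρ r x → ρ :* (r :* x) := r :* ρ :* x) refl ρ r (seq (σ i) n ℚ.+ ½ ℚ.* ρ))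
    (trans (cong (ℚ._* (seq (σ i) n ℚ.+ ½ ℚ.* ρ)) rρ≡1) (ℚ.*-identityˡ (seq (σ i) n ℚ.+ ½ ℚ.* ρ)))

  t∈[0,1] : ∀ i → 0ᵣ ≤ᵣ t i × t i ≤ᵣ 1ᵣ
  t∈[0,1] i = unwrap≲ (0≲* (fromℚ-mono-≤ 0≤r) 0≤σ+h) , unwrap≲ t≤1
    where
    0≤σ+h : 0ᵣ ≲ σ i +ᵣ h
    0≤σ+h = ≲-resp-≃ ≃-refl (pointwise-≃ λ n → solve 2 (λ σ h → h :- (:- σ) := σ :+ h) refl (seq (σ i) n) (½ ℚ.* ρ))
      (≲⇒0≲- (≲-trans (-x≲∣x∣ (σ i)) (σ≤ i)))
    σ+h≤h+h : σ i +ᵣ h ≲ h +ᵣ h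
    σ+h≤h+h = +ᵣ-mono-≲ (≲-trans (x≲∣x∣ (σ i)) (σ≤ i)) (≃⇒≲ ≃-refl)
    t≤1 : t i ≲ 1ᵣ
    t≤1 = ≲-resp-≃ ≃-refl (pointwise-≃ λ _ → trans (cong (r ℚ.*_) (halves ρ)) rρ≡1)
      (*ᵣ-monoˡ-≲ (fromℚ-mono-≤ 0≤r) σ+h≤h+h)

  t∈zonotope : combℝ t u ∈ zonotope u
  t∈zonotope = t , t∈[0,1] , λ k → unwrap≃ (≃-refl {combℝ t u k})

  ρt≃σ+h-comb : ∀ k → fromℚ ρ *ᵣ combℝ t u k ≃ combℝ σ u k +ᵣ combℝ (λ _ → h) u k
  ρt≃σ+h-comb k = begin
    fromℚ ρ *ᵣ combℝ t u k                 ≈⟨ ℝᴸ.dot-*ˡ (fromℚ ρ) t (column u k) ⟨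
    combℝ (λ i → fromℚ ρ *ᵣ t i) u k       ≈⟨ ℝᴸ.dot-congˡ (column u k) ρt≃σ+h ⟩
    combℝ (λ i → σ i +ᵣ h) u k             ≈⟨ ℝᴸ.dot-+ˡ σ (λ _ → h) (column u k) ⟩
    combℝ σ u k +ᵣ combℝ (λ _ → h) u k     ∎
    where open ≃-Reasoning

reach⇒covers : ∀ {n d} (u : Vector (ℤ^ d) n) {ρ r : ℚ} → r ℚ.* ρ ≡ 1ℚ → 0ℚ ℚ.≤ r →
  (∀ x → Reach (½ ℚ.* ρ) u x) → CoversSpace (dilate (fromℚ ρ) (zonotope u))
reach⇒covers u {ρ} {r} rρ≡1 0≤r reach x with reach (λ k → x k +ᵣ -ᵣ combℝ (λ _ → fromℚ (½ ℚ.* ρ)) u k)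
... | z , σ , σ≤ , x≃ = fromℚ ρ ·ᵥ combℝ t u ,
  (combℝ t u , t∈zonotope , λ k → unwrap≃ (≃-refl {fromℚ ρ *ᵣ combℝ t u k})) , z , λ k → unwrap≃ (x≃′ k)
  where
  open Dilate u rρ≡1 0≤r σ σ≤
  x≃′ : ∀ k → x k ≃ fromℚ ρ *ᵣ combℝ t u k +ᵣ fromℤ (z k)
  x≃′ k = begin
    x k                                        ≈⟨ pointwise-≃ (λ n → solve 2 (λ x b → x := (x :- b) :+ b) refl (seq (x k) n) (seq H n)) ⟩
    (x k +ᵣ -ᵣ H) +ᵣ H                         ≈⟨ ℝᴿ.+-congʳ (x≃ k) ⟩
    (combℝ σ u k +ᵣ fromℤ (z k)) +ᵣ H          ≈⟨ pointwise-≃ (λ n → solve 3 (λ a b c → a :+ b :+ c := a :+ c :+ b) refl (seq (combℝ σ u k) n) (z k / 1) (seq H n)) ⟩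
    (combℝ σ u k +ᵣ H) +ᵣ fromℤ (z k)          ≈⟨ ℝᴿ.+-congʳ (ρt≃σ+h-comb k) ⟨
    fromℚ ρ *ᵣ combℝ t u k +ᵣ fromℤ (z k)      ∎
    where
    open ≃-Reasoning
    open +-*-Solver
    H = combℝ (λ _ → h) u k

-- The common point is the combination with coefficients σ: it differs from the center by a lattice
-- vector, and ρ / 2 times the sum of the generators is ρ times the center.
reach⇒nonempty : ∀ {n d} (u : Vector (ℤ^ d) n) {ρ r : ℚ} → r ℚ.* ρ ≡ 1ℚ → 0ℚ ℚ.≤ r →
  Reach (½ ℚ.* ρ) u (center u) →
  ¬ Empty (dilate (fromℚ ρ) (translate (zonotope u) (-ᵥ center u)) ∩ latticeCoset (center u))
reach⇒nonempty u {ρ} {r} rρ≡1 0≤r (z , σ , σ≤ , center≃) empty = empty (combℝ σ u)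
  ( ( (λ k → combℝ t u k +ᵣ -ᵣ center u k)
    , (combℝ t u , t∈zonotope , λ k → unwrap≃ (≃-refl {combℝ t u k +ᵣ -ᵣ center u k}))
    , λ k → unwrap≃ (σ≃ k) )
  , (λ k → ℤ.- z k) , λ k → unwrap≃ (coset k) )
  where
  open Dilate u rρ≡1 0≤r σ σ≤
  open ≃-Reasoning
  open +-*-Solver
  H≃ : ∀ k → combℝ (λ _ → h) u k ≃ fromℚ ρ *ᵣ center u k
  H≃ k = begin
    combℝ (λ _ → h) u k                              ≈⟨ ℝᴸ.dot-congˡ (column u k) (λ _ → pointwise-≃ λ _ → ℚ.*-identityʳ (½ ℚ.* ρ)) ⟨
    combℝ (λ _ → h *ᵣ 1ᵣ) u k                        ≈⟨ ℝᴸ.dot-*ˡ h (λ _ → 1ᵣ) (column u k) ⟩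
    h *ᵣ combℝ (λ _ → 1ᵣ) u k                        ≈⟨ pointwise-≃ (λ n → solve 3 (λ a b c → a :* b :* c := b :* (a :* c)) refl ½ ρ (seq (combℝ (λ _ → 1ᵣ) u k) n)) ⟩
    fromℚ ρ *ᵣ center u k                            ∎
  σ≃ : ∀ k → combℝ σ u k ≃ fromℚ ρ *ᵣ (combℝ t u k +ᵣ -ᵣ center u k)
  σ≃ k = begin
    combℝ σ u k
      ≈⟨ pointwise-≃ (λ n → solve 2 (λ a b → a := a :+ b :- b) refl (seq (combℝ σ u k) n) (seq (combℝ (λ _ → h) u k) n)) ⟩
    (combℝ σ u k +ᵣ combℝ (λ _ → h) u k) +ᵣ -ᵣ combℝ (λ _ → h) u k
      ≈⟨ ℝᴿ.+-cong (ℝᴿ.sym (ρt≃σ+h-comb k)) (ℝᴿ.-‿cong (H≃ k)) ⟩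
    fromℚ ρ *ᵣ combℝ t u k +ᵣ -ᵣ (fromℚ ρ *ᵣ center u k)
      ≈⟨ pointwise-≃ (λ n → solve 3 (λ ρ a b → ρ :* a :- ρ :* b := ρ :* (a :- b)) refl ρ (seq (combℝ t u k) n) (seq (center u k) n)) ⟩
    fromℚ ρ *ᵣ (combℝ t u k +ᵣ -ᵣ center u k) ∎
  coset : ∀ k → combℝ σ u k ≃ center u k +ᵣ fromℤ (ℤ.- z k)
  coset k = begin
    combℝ σ u k
      ≈⟨ pointwise-≃ (λ n → solve 2 (λ a b → a := a :+ b :- b) refl (seq (combℝ σ u k) n) (z k / 1)) ⟩
    (combℝ σ u k +ᵣ fromℤ (z k)) +ᵣ -ᵣ fromℤ (z k)
      ≈⟨ ℝᴿ.+-cong (ℝᴿ.sym (center≃ k)) (pointwise-≃ λ _ → sym (/1-homo-neg (z k))) ⟩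
    center u k +ᵣ fromℤ (ℤ.- z k) ∎

-- Arithmetic of the bound

2*nC2 : ∀ n → 2 ℕ.* (suc (suc n) C 2) ≡ suc (suc n) ℕ.* suc n
2*nC2 zero    = refl
2*nC2 (suc n) = begin
  2 ℕ.* (suc (suc (suc n)) C 2)                          ≡⟨ cong (2 ℕ.*_) (nCk+nC[k+1]≡[n+1]C[k+1] (suc (suc n)) 1) ⟨
  2 ℕ.* ((suc (suc n) C 1) ℕ.+ (suc (suc n) C 2))          ≡⟨ cong (λ c → 2 ℕ.* (c ℕ.+ (suc (suc n) C 2))) (nC1≡n (suc (suc n))) ⟩
  2 ℕ.* (suc (suc n) ℕ.+ (suc (suc n) C 2))                ≡⟨ ℕ.*-distribˡ-+ 2 (suc (suc n)) (suc (suc n) C 2) ⟩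
  2 ℕ.* suc (suc n) ℕ.+ 2 ℕ.* (suc (suc n) C 2)            ≡⟨ cong (λ c → 2 ℕ.* suc (suc n) ℕ.+ c) (2*nC2 n) ⟩
  2 ℕ.* suc (suc n) ℕ.+ suc (suc n) ℕ.* suc n              ≡⟨ solve 1 (λ n → con 2 :* (con 2 :+ n) :+ (con 2 :+ n) :* (con 1 :+ n)
                                                              := (con 3 :+ n) :* (con 2 :+ n)) refl n ⟩
  suc (suc (suc n)) ℕ.* suc (suc n)                      ∎
  where
  open ≡-Reasoning
  open ℕSolver.+-*-Solver

2*[m+3]C2 : ∀ m → 2 ℕ.* ((suc m ℕ.+ 2) C 2) ≡ suc (suc (suc m)) ℕ.* suc (suc m)
2*[m+3]C2 m = trans (cong (λ n → 2 ℕ.* (suc n C 2)) (ℕ.+-comm m 2)) (2*nC2 (suc m))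

2*K≡suc⇒nonZero : ∀ K {n} → 2 ℕ.* K ≡ suc n → ℕ.NonZero K
2*K≡suc⇒nonZero (suc K) _ = _

[a/b]*b≡a : ∀ a b .{{_ : ℕ.NonZero b}} → (a / b) ℚ.* (+ b / 1) ≡ a / 1
[a/b]*b≡a a b@(suc b-1) = ℚ.toℚᵘ-injective (begin
  ℚ.toℚᵘ ((a / b) ℚ.* (+ b / 1))               ≈⟨ ℚ.toℚᵘ-homo-* (a / b) (+ b / 1) ⟩
  ℚ.toℚᵘ (a / b) ℚᵘ.* ℚ.toℚᵘ (+ b / 1)         ≈⟨ ℚᵘ.*-cong (ℚ.toℚᵘ-fromℚᵘ (ℚᵘ.mkℚᵘ a b-1)) (toℚᵘ-/1 (+ b)) ⟩
  ℚᵘ.mkℚᵘ a b-1 ℚᵘ.* ℚᵘ.mkℚᵘ (+ b) 0           ≈⟨ ℚᵘ.*≡* (trans (ℤ.*-identityʳ (a ℤ.* + b))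
                                                    (cong (λ c → a ℤ.* + c) (sym (ℕ.*-identityʳ b)))) ⟩
  ℚᵘ.mkℚᵘ a 0                                  ≈⟨ toℚᵘ-/1 a ⟨
  ℚ.toℚᵘ (a / 1)                               ∎)
  where open ℚᵘ.≃-Reasoning

-- Here d = 1 + m and K = binom (d + 2) 2.
module Radii (m K : ℕ) (2K≡ : 2 ℕ.* K ≡ suc (suc (suc m)) ℕ.* suc (suc m)) {ρ ρ′ : ℚ}
  (ρ≡ : ρ ℚ.* (+ suc (suc m) / 1) ≡ + m / 1)
  (ρ′≡ : ρ′ ℚ.* (+ suc (suc (suc m)) / 1) ≡ + suc m / 1) where
  κ : ℚ
  -- This is the gap 2 / ((d + 1) (d + 2)) between the radii. Both enter by cross-multiplied
  -- equations, so that `κK≡1` becomes a polynomial identity in m.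
  κ = ρ′ ℚ.- ρ

  κK≡1 : κ ℚ.* (+ K / 1) ≡ 1ℚ
  κK≡1 = begin
    κ ℚ.* k
      ≡⟨ solve 3 (λ a b k → (a :- b) :* k := con ½ :* ((a :- b) :* (con (+ 2 / 1) :* k))) refl ρ′ ρ k ⟩
    ½ ℚ.* (κ ℚ.* (+ 2 / 1 ℚ.* k))
      ≡⟨ cong (λ x → ½ ℚ.* (κ ℚ.* x)) (trans (sym (/1-homo-* (+ 2) (+ K)))
           (trans (cong (_/ 1) (trans (sym (ℤ.pos-* 2 K)) (trans (cong +_ 2K≡) (ℤ.pos-* (suc (suc (suc m))) (suc (suc m))))))
             (/1-homo-* (+ suc (suc (suc m))) (+ suc (suc m))))) ⟩
    ½ ℚ.* (κ ℚ.* (b₃ ℚ.* b₂))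
      ≡⟨ solve 4 (λ a b x y → con ½ :* ((a :- b) :* (x :* y)) := con ½ :* (a :* x :* y :- b :* y :* x)) refl ρ′ ρ b₃ b₂ ⟩
    ½ ℚ.* (ρ′ ℚ.* b₃ ℚ.* b₂ ℚ.- ρ ℚ.* b₂ ℚ.* b₃)
      ≡⟨ cong₂ (λ x y → ½ ℚ.* (x ℚ.* b₂ ℚ.- y ℚ.* b₃)) ρ′≡ ρ≡ ⟩
    ½ ℚ.* (+ suc m / 1 ℚ.* b₂ ℚ.- b₀ ℚ.* b₃)
      ≡⟨ cong (λ x → ½ ℚ.* (proj₁ x ℚ.* proj₁ (proj₂ x) ℚ.- b₀ ℚ.* proj₂ (proj₂ x)))
           (cong₂ _,_ (/1-homo-+ 1ℤ (+ m)) (cong₂ _,_ (/1-homo-+ (+ 2) (+ m)) (/1-homo-+ (+ 3) (+ m)))) ⟩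
    ½ ℚ.* ((1ℚ ℚ.+ b₀) ℚ.* (+ 2 / 1 ℚ.+ b₀) ℚ.- b₀ ℚ.* (+ 3 / 1 ℚ.+ b₀))
      ≡⟨ solve 1 (λ x → con ½ :* ((con 1ℚ :+ x) :* (con (+ 2 / 1) :+ x) :- x :* (con (+ 3 / 1) :+ x)) := con 1ℚ) refl b₀ ⟩
    1ℚ ∎
    where
    open ≡-Reasoning
    open +-*-Solver
    k  = + K / 1
    b₀ = + m / 1
    b₂ = + suc (suc m) / 1
    b₃ = + suc (suc (suc m)) / 1

  0≤κ : .{{ℕ.NonZero K}} → 0ℚ ℚ.≤ κ
  0≤κ = ℚ.*-cancelʳ-≤-pos (+ K / 1) {{ℚ.normalize-pos K 1}}
    (subst₂ ℚ._≤_ (sym (ℚ.*-zeroˡ (+ K / 1))) (sym κK≡1) (ℚ.nonNegative⁻¹ 1ℚ))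

  ½ρ+½κ≡½ρ′ : ½ ℚ.* ρ ℚ.+ ½ ℚ.* κ ≡ ½ ℚ.* ρ′
  ½ρ+½κ≡½ρ′ = solve 2 (λ a b → con ½ :* a :+ con ½ :* (b :- a) := con ½ :* b) refl ρ ρ′
    where open +-*-Solver

1/pos : ∀ p → .{{ℚ.Positive p}} → ∃[ r ] (r ℚ.* p ≡ 1ℚ × 0ℚ ℚ.≤ r)
1/pos p {{p>0}} = ℚ.1/ p , ℚ.*-inverseˡ p , ℚ.<⇒≤ (ℚ.positive⁻¹ (ℚ.1/ p) {{ℚ.1/pos⇒pos p}})
  where
  instance
    p≢0 : ℚ.NonZero p
    p≢0 = ℚ.pos⇒nonZero p

-- The two bounds from projection, lifting and counting

module Bounds (em : ExcludedMiddle 0ℓ) (m : ℕ) {ρ ρ′ κ r : ℚ} (K : ℕ) {{_ : ℕ.NonZero K}}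
  (κK≡1 : κ ℚ.* (+ K / 1) ≡ 1ℚ) (0≤κ : 0ℚ ℚ.≤ κ) (½ρ+½κ≡½ρ′ : ½ ℚ.* ρ ℚ.+ ½ ℚ.* κ ≡ ½ ℚ.* ρ′)
  (rρ′≡1 : r ℚ.* ρ′ ≡ 1ℚ) (0≤r : 0ℚ ℚ.≤ r) (0≤ρ′ : 0ℚ ℚ.≤ ρ′)
  (cover : CosimpleCover (½ ℚ.* ρ) m) (u : Vector (ℤ^ (suc m)) (suc (suc m))) where

  atMost : ¬ LongSegment u K → AtMostLatticePoints (K ℕ.^ suc m) (zonotope u)
  atMost ¬long p p-injective p∈Z = ℕ.≮⇒≥ λ K^d<N → ¬long (longSegment u K p p-injective p∈Z K^d<N)

  lift : (seg : LongSegment u K) (split : Splitting (LongSegment.w seg)) → ∀ x →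
    Reach (½ ℚ.* ρ) (Project.project split u) (λ l → ℝᴸ.dot x (column (Splitting.P split) l)) →
    Reach (½ ℚ.* ρ′) u x
  lift seg split x reach = subst (λ h → Reach h u x) ½ρ+½κ≡½ρ′
    (lift-reach em u κK≡1 0≤κ seg split (½ ℚ.* ρ) x reach)

  strong : IsStrongLonelyRunner u →
    ∃[ μ ] (IsCoveringRadius (zonotope u) μ × fromℚ ρ′ <ᵣ μ) → AtMostLatticePoints (K ℕ.^ suc m) (zonotope u)
  strong (v , (0<v , _ , generates , uv≡0) , v-injective) (μ , (_ , _ , minimal) , ρ′<μ) =
    atMost λ seg → <ᵣ⇒¬≲ {fromℚ ρ′} {μ} ρ′<μ (wrap≲ (minimal (fromℚ ρ′) (unwrap≲ (fromℚ-mono-≤ 0≤ρ′))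
      (covers seg (splitting (LongSegment.w seg)))))
    where
    covers : (seg : LongSegment u K) → Splitting (LongSegment.w seg) → CoversSpace (dilate (fromℚ ρ′) (zonotope u))
    covers seg split = reach⇒covers u rρ′≡1 0≤r λ x →
      lift seg split x (cover (suc (suc m)) (project u) cosimple (λ l → ℝᴸ.dot x (column P l)))
      where
      open Project split
      cosimple : IntegerCosimple (project u)
      cosimple = project-dualSpanning u (generatesLattice⇒dualSpanning u generates) ,
        (λ i → + v i) , project-kernel u {λ i → + v i} uv≡0 ,
        (λ i vᵢ≡0 → ℕ.<⇒≢ (0<v i) (sym (ℤ.+-injective vᵢ≡0))) , λ i j i≢j vᵢ≡vⱼ → i≢j (v-injective vᵢ≡vⱼ)

  runner : IsLonelyRunner u →
    Empty (dilate (fromℚ ρ′) (translate (zonotope u) (-ᵥ center u)) ∩ latticeCoset (center u)) →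
    AtMostLatticePoints (K ℕ.^ suc m) (zonotope u)
  runner independent empty = atMost λ seg →
    reach⇒nonempty u rρ′≡1 0≤r (center-reached seg (splitting (LongSegment.w seg)) (nontrivial-dependence u)) empty
    where
    span : DualSpanning u
    span f fu≡0 = linearlyIndependent⇒dualSpanning (u ∘ suc) (independent suc Fin.suc-injective) f (fu≡0 ∘ suc)
    -- A vanishing coefficient would leave a dependence among the other d generators, which are
    -- independent.
    full-support : ∀ c → Kernel (column u) c → (∃[ i ] c i ≢ 0ℤ) → ∀ i → c i ≢ 0ℤ
    full-support c uc≡0 (i₀ , cᵢ₀≢0) i cᵢ≡0 = cᵢ₀≢0 (punchIn-elim i (λ j → c j ≡ 0ℤ) cᵢ≡0
      (linearlyIndependent⇒trivialKernel (u ∘ punchIn i)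
        (independent (punchIn i) (λ {x} {y} → Fin.punchIn-injective i x y)) (c ∘ punchIn i) removed) i₀)
      where
      removed : Kernel (column (u ∘ punchIn i)) (c ∘ punchIn i)
      removed k = trans (sym (trans (ℤᴸ.dot-removeAt c (column u k) i)
        (trans (cong (λ z → z ℤ.* u i k ℤ.+ removeAt c i • removeAt (column u k) i) cᵢ≡0)
          (ℤ.+-identityˡ (removeAt c i • removeAt (column u k) i))))) (uc≡0 k)
    center-reached : (seg : LongSegment u K) → Splitting (LongSegment.w seg) →
      Σ[ c ∈ ℤ^ (suc (suc m)) ] ((∃[ i ] c i ≢ 0ℤ) × Kernel (column u) c) → Reach (½ ℚ.* ρ′) u (center u)
    center-reached seg split (c , c≢0 , uc≡0) = lift seg split (center u) (z , σ , σ≤ , λ l → ℝᴿ.trans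
        (ℝᴿ.trans (ℝᴸ.dot-*ˡ (fromℚ ½) (combℝ (λ _ → 1ᵣ) u) (column P l))
          (ℝᴿ.*-congˡ (ℝᴸ.dot-dot (λ _ → 1ᵣ) u (column P l))))
        (center≃ l))
      where
      open Project split
      reach = center-reach m cover (project u) (project-dualSpanning u span) c (project-kernel u {c} uc≡0)
        (full-support c uc≡0 c≢0)
      z  = proj₁ reach
      σ  = proj₁ (proj₂ reach)
      σ≤ = proj₁ (proj₂ (proj₂ reach))
      center≃ = proj₂ (proj₂ (proj₂ reach))

lonely-runner-bounds : ExcludedMiddle 0ℓ → ∀ m K → 2 ℕ.* K ≡ suc (suc (suc m)) ℕ.* suc (suc m) → ∀ ρ ρ′ →
  ρ ℚ.* (+ suc (suc m) / 1) ≡ + m / 1 → ρ′ ℚ.* (+ suc (suc (suc m)) / 1) ≡ + suc m / 1 → ℚ.Positive ρ′ →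
  (∀ n (u : Vector (ℤ^ m) n) → Cosimple u → ∃[ μ ] (IsCoveringRadius (zonotope u) μ × μ ≤ᵣ fromℚ ρ)) →
  (∀ (u : Vector (ℤ^ (suc m)) (suc (suc m))) → IsStrongLonelyRunner u →
    (∃[ μ ] (IsCoveringRadius (zonotope u) μ × fromℚ ρ′ <ᵣ μ)) →
    AtMostLatticePoints (K ℕ.^ suc m) (zonotope u))
  × (∀ (u : Vector (ℤ^ (suc m)) (suc (suc m))) → IsLonelyRunner u →
    Empty (dilate (fromℚ ρ′) (translate (zonotope u) (-ᵥ center u)) ∩ latticeCoset (center u)) →
    AtMostLatticePoints (K ℕ.^ suc m) (zonotope u))
lonely-runner-bounds em m K 2K≡ ρ ρ′ ρ≡ ρ′≡ ρ′>0 bound = Bound.strong , Bound.runner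
  where
  instance _ = ρ′>0
  instance _ = 2*K≡suc⇒nonZero K 2K≡
  open Radii m K 2K≡ {ρ} {ρ′} ρ≡ ρ′≡
  -- Only ρ′ is inverted: ρ is 0 when d = 1.
  1/ρ′ : ∃[ r ] (r ℚ.* ρ′ ≡ 1ℚ × 0ℚ ℚ.≤ r)
  1/ρ′ = 1/pos ρ′
  module Bound = Bounds em m {ρ} {ρ′} {κ} {proj₁ 1/ρ′} K κK≡1 0≤κ ½ρ+½κ≡½ρ′
    (proj₁ (proj₂ 1/ρ′)) (proj₂ (proj₂ 1/ρ′)) (ℚ.<⇒≤ (ℚ.positive⁻¹ ρ′)) (coveringRadius⇒cosimpleCover m ρ bound)

open import Data.Nat.Base using (_+_; _∸_; _^_; _≤_)

corollary1p10 : ExcludedMiddle 0ℓ →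
    (d : ℕ) → 1 ≤ d →
    (∀ n (u : Vector (ℤ^ (d ∸ 1)) n) → Cosimple u →
    ∃[ μ ] (IsCoveringRadius (zonotope u) μ × μ ≤ᵣ fromℚ (+ (d ∸ 1) / suc d))) →
    ( (∀ (u : Vector (ℤ^ d) (suc d)) → IsStrongLonelyRunner u →
    (∃[ μ ] (IsCoveringRadius (zonotope u) μ × fromℚ (+ d / suc (suc d)) <ᵣ μ)) →
    AtMostLatticePoints (((d + 2) C 2) ^ d) (zonotope u))
    × (∀ (u : Vector (ℤ^ d) (suc d)) → IsLonelyRunner u →
    Empty (dilate (fromℚ (+ d / suc (suc d))) (translate (zonotope u) (-ᵥ center u))
    ∩ latticeCoset (center u)) →
    AtMostLatticePoints (((d + 2) C 2) ^ d) (zonotope u)))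
corollary1p10 em (suc m) _ bound = lonely-runner-bounds em m ((suc m + 2) C 2) (2*[m+3]C2 m)
  (+ m / suc (suc m)) (+ suc m / suc (suc (suc m)))
  ([a/b]*b≡a (+ m) (suc (suc m))) ([a/b]*b≡a (+ suc m) (suc (suc (suc m))))
  (ℚ.normalize-pos (suc m) (suc (suc (suc m)))) bound
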